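{- The map $\mathtt{M}:(\mathfrak{A}^0,\,\sqcup\!\sqcup)\to\mathbb{R}$, $\mathtt{M}(w)=\int_0^1 w$, is a homomorphism of $\mathbb{Q}$-algebras, where $\sqcup\!\sqcup$ is the shuffle product.
   Context: Put $\omega_0=\frac{dt}{t}$, $\omega_{+1}^{ -1}=\frac{2\,dt}{1-t^2}$, $\omega_{ -1}^{ -1}=\frac{ -2\,dt}{1+t^2}$, $\omega_{+1}^{+1}=\frac{2t\,dt}{1-t^2}$, $\omega_{ -1}^{+1}=\frac{ -2t\,dt}{1+t^2}$. Let $\mathfrak{A}$ be the noncommutative polynomial $\mathbb{Q}$-algebra of words (including the empty word) in the letters $\omega_0$ and $\omega_\sigma^\varepsilon$ ($\sigma,\varepsilon=\pm1$). $\mathfrak{A}^0$ is the $\mathbb{Q}$-span of the admissible words: the empty word and the words not beginning with $\omega_{+1}^{+1}$ or $\omega_{+1}^{ -1}$ and not ending with $\omega_0$. For an admissible word, $\int_0^1 f_1(t)dt\cdots f_p(t)dt=\int_{1>t_1>\cdots>t_p>0}f_1(t_1)\cdots f_p(t_p)\,dt_1\cdots dt_p$, with value $1$ on the empty word, and $\mathtt{M}$ is extended $\mathbb{Q}$-linearly. The shuffle product is the usual one on words: bilinear, with the empty word as unit, and $au\sqcup\!\sqcup bv=a(u\sqcup\!\sqcup bv)+b(au\sqcup\!\sqcup v)$ for letters $a,b$ and words $u,v$. -}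

module Defs where

open import Algebra.Bundles.Raw using (RawRing)
open import Algebra.Module.Bundles.Raw using (RawLeftModule)
open import Algebra.Module.Morphism.Structures using (module LeftModuleMorphisms)
open import Algebra.Morphism.Structures using (module RingMorphisms)
open import Data.List.Base using (List; []; _∷_; [_]; _++_; _∷ʳ_; map; concatMap)
open import Data.List.Properties using (≡-dec)
open import Data.List.Relation.Unary.All as All using (All; []; _∷_)
import Data.List.Relation.Unary.All.Properties as All
open import Data.Nat.Base as ℕ using (ℕ)
import Data.Nat.Properties as ℕ
open import Data.Product.Base using (Σ-syntax; ∃-syntax; _×_; _,_; proj₁; proj₂)
open import Data.Rational.Base as ℚ using (ℚ; 0ℚ; 1ℚ; ½; 1/_)
import Data.Rational.Properties as ℚ
open import Data.Rational.Solver using (module +-*-Solver)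
open import Data.Sign.Base using (Sign; +; -)
import Data.Sign.Properties as Sign
open import Function.Base using (_∘_)
open import Level using (0ℓ)
open import Relation.Binary.Core using (Rel)
open import Relation.Binary.Definitions using (DecidableEquality)
open import Relation.Binary.PropositionalEquality.Core
  using (_≡_; _≢_; refl; sym; trans; cong; cong₂; subst)
open import Relation.Binary.PropositionalEquality.Properties using (module ≡-Reasoning)
open import Relation.Nullary.Decidable.Core using (yes; no)

private
  variable
    P Q : ℕ → Set

-- Real numbers are Cauchy sequences of rationals; null sequences are ≈ 0.

Eventually : (ℕ → Set) → Set
Eventually P = ∃[ N ] ∀ n → N ℕ.≤ n → P n

eventually₂ : {R : ℕ → Set} → (∀ n → P n → Q n → R n) →
              Eventually P → Eventually Q → Eventually R
eventually₂ f (M , p) (N , q) = M ℕ.⊔ N , λ n le →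
  f n (p n (ℕ.≤-trans (ℕ.m≤m⊔n M N) le)) (q n (ℕ.≤-trans (ℕ.m≤n⊔m M N) le))

IsCauchy : (ℕ → ℚ) → Set
IsCauchy x = ∀ ε → 0ℚ ℚ.< ε →
  ∃[ N ] ∀ m n → N ℕ.≤ m → N ℕ.≤ n → ℚ.∣ x m ℚ.- x n ∣ ℚ.≤ ε

record ℝ : Set where
  constructor _,_
  field
    seq    : ℕ → ℚ
    cauchy : IsCauchy seq

open ℝ public

infix 4 _≈_ _≤_ _<_

_≈_ _≤_ _<_ : Rel ℝ 0ℓ
x ≈ y = ∀ ε → 0ℚ ℚ.< ε → Eventually λ n → ℚ.∣ seq x n ℚ.- seq y n ∣ ℚ.≤ ε
x ≤ y = ∀ ε → 0ℚ ℚ.< ε → Eventually λ n → seq x n ℚ.≤ seq y n ℚ.+ ε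
x < y = ∃[ ε ] 0ℚ ℚ.< ε × Eventually λ n → seq x n ℚ.+ ε ℚ.≤ seq y n

module _ where
  half>0 : ∀ {ε} → 0ℚ ℚ.< ε → 0ℚ ℚ.< ε ℚ.* ½
  half>0 0<ε = ℚ.*-monoˡ-<-pos ½ 0<ε

  half+half : ∀ ε → ε ℚ.* ½ ℚ.+ ε ℚ.* ½ ≡ ε
  half+half ε = trans (sym (ℚ.*-distribˡ-+ ε ½ ½)) (ℚ.*-identityʳ ε)

  *-pos : ∀ {p q} → 0ℚ ℚ.< p → 0ℚ ℚ.< q → 0ℚ ℚ.< p ℚ.* q
  *-pos {p} {q} 0<p 0<q = subst (ℚ._< p ℚ.* q) (ℚ.*-zeroˡ q)
    (ℚ.*-monoˡ-<-pos q {{ℚ.positive 0<q}} 0<p)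

  *-mono-≤ : ∀ {a b c d} → 0ℚ ℚ.≤ b → 0ℚ ℚ.≤ c → a ℚ.≤ b → c ℚ.≤ d → a ℚ.* c ℚ.≤ b ℚ.* d
  *-mono-≤ {a} {b} {c} {d} 0≤b 0≤c a≤b c≤d = ℚ.≤-trans
    (ℚ.*-monoʳ-≤-nonNeg c {{ℚ.nonNegative 0≤c}} a≤b)
    (ℚ.*-monoˡ-≤-nonNeg b {{ℚ.nonNegative 0≤b}} c≤d)

  1/[_] : ∀ {p} → 0ℚ ℚ.< p → ℚ
  1/[_] {p} 0<p = (1/ p) {{ℚ.>-nonZero 0<p}}

  1/>0 : ∀ {p} (0<p : 0ℚ ℚ.< p) → 0ℚ ℚ.< 1/[ 0<p ]
  1/>0 {p} 0<p = ℚ.positive⁻¹ 1/[ 0<p ] {{ℚ.1/pos⇒pos p {{ℚ.positive 0<p}}}}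

  *-1/ : ∀ {p} (0<p : 0ℚ ℚ.< p) → p ℚ.* 1/[ 0<p ] ≡ 1ℚ
  *-1/ {p} 0<p = ℚ.*-inverseʳ p {{ℚ.>-nonZero 0<p}}

  cancel-1/ : ∀ {p} (0<p : 0ℚ ℚ.< p) q → p ℚ.* (q ℚ.* 1/[ 0<p ]) ≡ q
  cancel-1/ {p} 0<p q = trans
    (solve 3 (λ p q r → p :* (q :* r) := q :* (p :* r)) refl p q 1/[ 0<p ])
    (trans (cong (q ℚ.*_) (*-1/ 0<p)) (ℚ.*-identityʳ q))
    where open +-*-Solver

  bound : ∀ {x} → IsCauchy x → ∃[ B ] 0ℚ ℚ.< B × Eventually λ n → ℚ.∣ x n ∣ ℚ.≤ B
  bound {x} cx with cx 1ℚ (ℚ.positive⁻¹ 1ℚ)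
  ... | N , c = 1ℚ ℚ.+ ℚ.∣ x N ∣
              , ℚ.<-≤-trans (ℚ.positive⁻¹ 1ℚ)
                  (ℚ.≤-trans (ℚ.≤-reflexive (sym (ℚ.+-identityʳ 1ℚ)))
                             (ℚ.+-monoʳ-≤ 1ℚ (ℚ.0≤∣p∣ (x N))))
              , N , λ n N≤n → ℚ.≤-trans
                  (ℚ.≤-reflexive (cong ℚ.∣_∣
                    (solve 2 (λ a b → a := (a :- b) :+ b) refl (x n) (x N))))
                  (ℚ.≤-trans (ℚ.∣p+q∣≤∣p∣+∣q∣ (x n ℚ.- x N) (x N))
                    (ℚ.+-monoˡ-≤ ℚ.∣ x N ∣ (c n N N≤n ℕ.≤-refl)))
    where open +-*-Solver

  +-cauchy : ∀ {x y} → IsCauchy x → IsCauchy y → IsCauchy (λ n → x n ℚ.+ y n)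
  +-cauchy {x} {y} cx cy ε 0<ε with cx _ (half>0 0<ε) | cy _ (half>0 0<ε)
  ... | M , p | N , q = M ℕ.⊔ N , λ m n lm ln → let open ℚ.≤-Reasoning in begin
    ℚ.∣ (x m ℚ.+ y m) ℚ.- (x n ℚ.+ y n) ∣
      ≡⟨ cong ℚ.∣_∣ (solve 4 (λ a b c d → (a :+ b) :- (c :+ d) := (a :- c) :+ (b :- d))
           refl (x m) (y m) (x n) (y n)) ⟩
    ℚ.∣ (x m ℚ.- x n) ℚ.+ (y m ℚ.- y n) ∣
      ≤⟨ ℚ.∣p+q∣≤∣p∣+∣q∣ (x m ℚ.- x n) (y m ℚ.- y n) ⟩
    ℚ.∣ x m ℚ.- x n ∣ ℚ.+ ℚ.∣ y m ℚ.- y n ∣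
      ≤⟨ ℚ.+-mono-≤
           (p m n (ℕ.≤-trans (ℕ.m≤m⊔n M N) lm) (ℕ.≤-trans (ℕ.m≤m⊔n M N) ln))
           (q m n (ℕ.≤-trans (ℕ.m≤n⊔m M N) lm) (ℕ.≤-trans (ℕ.m≤n⊔m M N) ln)) ⟩
    ε ℚ.* ½ ℚ.+ ε ℚ.* ½
      ≡⟨ half+half ε ⟩
    ε ∎
    where open +-*-Solver

  neg-cauchy : ∀ {x} → IsCauchy x → IsCauchy (λ n → ℚ.- x n)
  neg-cauchy {x} cx ε 0<ε with cx ε 0<ε
  ... | N , p = N , λ m n lm ln → ℚ.≤-trans
    (ℚ.≤-reflexive (trans
      (cong ℚ.∣_∣ (solve 2 (λ a b → (:- a) :- (:- b) := :- (a :- b)) refl (x m) (x n)))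
      (ℚ.∣-p∣≡∣p∣ (x m ℚ.- x n))))
    (p m n lm ln)
    where open +-*-Solver

  *-estimate : ∀ {A B δ η x x′ y y′} → 0ℚ ℚ.≤ A → 0ℚ ℚ.≤ B →
               ℚ.∣ x ∣ ℚ.≤ A → ℚ.∣ y′ ∣ ℚ.≤ B → ℚ.∣ y ℚ.- y′ ∣ ℚ.≤ δ → ℚ.∣ x ℚ.- x′ ∣ ℚ.≤ η →
               ℚ.∣ x ℚ.* y ℚ.- x′ ℚ.* y′ ∣ ℚ.≤ A ℚ.* δ ℚ.+ B ℚ.* η
  *-estimate {A} {B} {δ} {η} {x} {x′} {y} {y′} 0≤A 0≤B x≤A y′≤B y-y′ x-x′ = begin
    ℚ.∣ x ℚ.* y ℚ.- x′ ℚ.* y′ ∣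
      ≡⟨ cong ℚ.∣_∣ (solve 4 (λ a b c d → a :* b :- c :* d := a :* (b :- d) :+ d :* (a :- c))
           refl x y x′ y′) ⟩
    ℚ.∣ x ℚ.* (y ℚ.- y′) ℚ.+ y′ ℚ.* (x ℚ.- x′) ∣
      ≤⟨ ℚ.∣p+q∣≤∣p∣+∣q∣ (x ℚ.* (y ℚ.- y′)) (y′ ℚ.* (x ℚ.- x′)) ⟩
    ℚ.∣ x ℚ.* (y ℚ.- y′) ∣ ℚ.+ ℚ.∣ y′ ℚ.* (x ℚ.- x′) ∣
      ≡⟨ cong₂ ℚ._+_ (ℚ.∣p*q∣≡∣p∣*∣q∣ x (y ℚ.- y′)) (ℚ.∣p*q∣≡∣p∣*∣q∣ y′ (x ℚ.- x′)) ⟩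
    ℚ.∣ x ∣ ℚ.* ℚ.∣ y ℚ.- y′ ∣ ℚ.+ ℚ.∣ y′ ∣ ℚ.* ℚ.∣ x ℚ.- x′ ∣
      ≤⟨ ℚ.+-mono-≤ (*-mono-≤ 0≤A (ℚ.0≤∣p∣ (y ℚ.- y′)) x≤A y-y′)
                    (*-mono-≤ 0≤B (ℚ.0≤∣p∣ (x ℚ.- x′)) y′≤B x-x′) ⟩
    A ℚ.* δ ℚ.+ B ℚ.* η ∎
    where
    open +-*-Solver
    open ℚ.≤-Reasoning

  *-cauchy : ∀ {x y} → IsCauchy x → IsCauchy y → IsCauchy (λ n → x n ℚ.* y n)
  *-cauchy {x} {y} cx cy ε 0<ε =
    let A , 0<A , K , a = bound {x} cx
        B , 0<B , L , b = bound {y} cy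
        M , p = cx (ε ℚ.* ½ ℚ.* 1/[ 0<B ]) (*-pos (half>0 0<ε) (1/>0 0<B))
        N , q = cy (ε ℚ.* ½ ℚ.* 1/[ 0<A ]) (*-pos (half>0 0<ε) (1/>0 0<A))
        k≤ = ℕ.≤-trans (ℕ.m≤m⊔n K L) (ℕ.m≤m⊔n (K ℕ.⊔ L) (M ℕ.⊔ N))
        l≤ = ℕ.≤-trans (ℕ.m≤n⊔m K L) (ℕ.m≤m⊔n (K ℕ.⊔ L) (M ℕ.⊔ N))
        m≤ = ℕ.≤-trans (ℕ.m≤m⊔n M N) (ℕ.m≤n⊔m (K ℕ.⊔ L) (M ℕ.⊔ N))
        n≤ = ℕ.≤-trans (ℕ.m≤n⊔m M N) (ℕ.m≤n⊔m (K ℕ.⊔ L) (M ℕ.⊔ N))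
    in (K ℕ.⊔ L) ℕ.⊔ (M ℕ.⊔ N) , λ m n lm ln →
       ℚ.≤-trans
         (*-estimate {x = x m} {x n} {y m} {y n} (ℚ.<⇒≤ 0<A) (ℚ.<⇒≤ 0<B) (a m (ℕ.≤-trans k≤ lm)) (b n (ℕ.≤-trans l≤ ln))
           (q m n (ℕ.≤-trans n≤ lm) (ℕ.≤-trans n≤ ln)) (p m n (ℕ.≤-trans m≤ lm) (ℕ.≤-trans m≤ ln)))
         (ℚ.≤-reflexive (trans
           (cong₂ ℚ._+_ (cancel-1/ 0<A (ε ℚ.* ½)) (cancel-1/ 0<B (ε ℚ.* ½)))
           (half+half ε)))

  const-cauchy : ∀ q → IsCauchy (λ _ → q)
  const-cauchy q ε 0<ε = 0 , λ _ _ _ _ →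
    ℚ.≤-trans (ℚ.≤-reflexive (cong ℚ.∣_∣ (ℚ.+-inverseʳ q))) (ℚ.<⇒≤ 0<ε)

infixl 7 _*_
infixl 6 _+ᴿ_ _-ᴿ_

fromℚ : ℚ → ℝ
fromℚ q = (λ _ → q) , const-cauchy q

0ℝ 1ℝ 2ℝ : ℝ
0ℝ = fromℚ 0ℚ
1ℝ = fromℚ 1ℚ
2ℝ = fromℚ (1ℚ ℚ.+ 1ℚ)

_+ᴿ_ _-ᴿ_ _*_ : ℝ → ℝ → ℝ
x +ᴿ y = (λ n → seq x n ℚ.+ seq y n) , +-cauchy {seq x} {seq y} (cauchy x) (cauchy y)
x * y  = (λ n → seq x n ℚ.* seq y n) , *-cauchy {seq x} {seq y} (cauchy x) (cauchy y)

neg : ℝ → ℝ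
neg x = (λ n → ℚ.- seq x n) , neg-cauchy {seq x} (cauchy x)

x -ᴿ y = x +ᴿ neg y

module _ where
  clamp>0 : ∀ {ε} → 0ℚ ℚ.< ε → ∀ q → 0ℚ ℚ.< q ℚ.⊔ ε
  clamp>0 {ε} 0<ε q = ℚ.<-≤-trans 0<ε (ℚ.p≤q⊔p q ε)

  1/-antitone : ∀ {p q} (0<p : 0ℚ ℚ.< p) (0<q : 0ℚ ℚ.< q) → p ℚ.≤ q → 1/[ 0<q ] ℚ.≤ 1/[ 0<p ]
  1/-antitone {p} {q} 0<p 0<q p≤q = begin
    r              ≡⟨ cancel-1/ 0<p r ⟨
    p ℚ.* (r ℚ.* s) ≤⟨ ℚ.*-monoʳ-≤-nonNeg (r ℚ.* s)
                        {{ℚ.nonNegative (ℚ.<⇒≤ (*-pos (1/>0 0<q) (1/>0 0<p)))}} p≤q ⟩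
    q ℚ.* (r ℚ.* s) ≡⟨ cong (q ℚ.*_) (ℚ.*-comm r s) ⟩
    q ℚ.* (s ℚ.* r) ≡⟨ cancel-1/ 0<q s ⟩
    s              ∎
    where
    open ℚ.≤-Reasoning
    r = 1/[ 0<q ]
    s = 1/[ 0<p ]

  1/-difference : ∀ {p q} (0<p : 0ℚ ℚ.< p) (0<q : 0ℚ ℚ.< q) →
                  ℚ.∣ 1/[ 0<p ] ℚ.- 1/[ 0<q ] ∣ ≡ (1/[ 0<p ] ℚ.* 1/[ 0<q ]) ℚ.* ℚ.∣ p ℚ.- q ∣
  1/-difference {p} {q} 0<p 0<q = begin
    ℚ.∣ r ℚ.- s ∣
      ≡⟨ cong ℚ.∣_∣ (cong₂ ℚ._-_ (cancel-1/ 0<q r) (cancel-1/ 0<p s)) ⟨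
    ℚ.∣ q ℚ.* (r ℚ.* s) ℚ.- p ℚ.* (s ℚ.* r) ∣
      ≡⟨ cong ℚ.∣_∣ (solve 4 (λ p q r s → q :* (r :* s) :- p :* (s :* r) := (r :* s) :* (:- (p :- q)))
           refl p q r s) ⟩
    ℚ.∣ (r ℚ.* s) ℚ.* (ℚ.- (p ℚ.- q)) ∣
      ≡⟨ ℚ.∣p*q∣≡∣p∣*∣q∣ (r ℚ.* s) (ℚ.- (p ℚ.- q)) ⟩
    ℚ.∣ r ℚ.* s ∣ ℚ.* ℚ.∣ ℚ.- (p ℚ.- q) ∣
      ≡⟨ cong₂ ℚ._*_ (ℚ.0≤p⇒∣p∣≡p (ℚ.<⇒≤ (*-pos (1/>0 0<p) (1/>0 0<q)))) (ℚ.∣-p∣≡∣p∣ (p ℚ.- q)) ⟩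
    (r ℚ.* s) ℚ.* ℚ.∣ p ℚ.- q ∣ ∎
    where
    open +-*-Solver
    open ≡-Reasoning
    r = 1/[ 0<p ]
    s = 1/[ 0<q ]

  1/-estimate : ∀ {ε η p q} (0<ε : 0ℚ ℚ.< ε) (0<p : 0ℚ ℚ.< p) (0<q : 0ℚ ℚ.< q) →
                ε ℚ.≤ p → ε ℚ.≤ q → ℚ.∣ p ℚ.- q ∣ ℚ.≤ ε ℚ.* (ε ℚ.* η) →
                ℚ.∣ 1/[ 0<p ] ℚ.- 1/[ 0<q ] ∣ ℚ.≤ η
  1/-estimate {ε} {η} {p} {q} 0<ε 0<p 0<q ε≤p ε≤q d = begin
    ℚ.∣ 1/[ 0<p ] ℚ.- 1/[ 0<q ] ∣
      ≡⟨ 1/-difference 0<p 0<q ⟩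
    (1/[ 0<p ] ℚ.* 1/[ 0<q ]) ℚ.* ℚ.∣ p ℚ.- q ∣
      ≤⟨ *-mono-≤ (ℚ.<⇒≤ (*-pos (1/>0 0<ε) (1/>0 0<ε))) (ℚ.0≤∣p∣ (p ℚ.- q))
           (*-mono-≤ (ℚ.<⇒≤ (1/>0 0<ε)) (ℚ.<⇒≤ (1/>0 0<q))
             (1/-antitone 0<ε 0<p ε≤p) (1/-antitone 0<ε 0<q ε≤q)) d ⟩
    (s ℚ.* s) ℚ.* (ε ℚ.* (ε ℚ.* η))
      ≡⟨ solve 3 (λ s ε η → (s :* s) :* (ε :* (ε :* η)) := ε :* (ε :* (η :* s) :* s)) refl s ε η ⟩
    ε ℚ.* (ε ℚ.* (η ℚ.* s) ℚ.* s)
      ≡⟨ cancel-1/ 0<ε (ε ℚ.* (η ℚ.* s)) ⟩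
    ε ℚ.* (η ℚ.* s)
      ≡⟨ cancel-1/ 0<ε η ⟩
    η ∎
    where
    open +-*-Solver
    open ℚ.≤-Reasoning
    s = 1/[ 0<ε ]

  1/-clamp-cauchy : ∀ {x ε} (0<ε : 0ℚ ℚ.< ε) → IsCauchy x → (Eventually λ n → ε ℚ.≤ x n) →
                    IsCauchy (λ n → 1/[ clamp>0 0<ε (x n) ])
  1/-clamp-cauchy {x} {ε} 0<ε cx (K , e) η 0<η =
    let N , p = cx (ε ℚ.* (ε ℚ.* η)) (*-pos 0<ε (*-pos 0<ε 0<η))
        c≡x = λ i (K⊔N≤i : K ℕ.⊔ N ℕ.≤ i) →
          ℚ.p≥q⇒p⊔q≡p (e i (ℕ.≤-trans (ℕ.m≤m⊔n K N) K⊔N≤i))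
    in K ℕ.⊔ N , λ m n lm ln →
       1/-estimate {η = η} 0<ε (clamp>0 0<ε (x m)) (clamp>0 0<ε (x n)) (ℚ.p≤q⊔p (x m) ε) (ℚ.p≤q⊔p (x n) ε)
         (ℚ.≤-trans
           (ℚ.≤-reflexive (cong₂ (λ a b → ℚ.∣ a ℚ.- b ∣) (c≡x m lm) (c≡x n ln)))
           (p m n (ℕ.≤-trans (ℕ.m≤n⊔m K N) lm) (ℕ.≤-trans (ℕ.m≤n⊔m K N) ln)))

-- The lower bound ε in the proof of 0 < x makes the sequence invertible
-- at every index; max(xₙ , ε) agrees with xₙ for all large n.
recip : (x : ℝ) → 0ℝ < x → ℝ
recip x (ε , 0<ε , e) =
    (λ n → 1/[ clamp>0 0<ε (seq x n) ])
  , 1/-clamp-cauchy {seq x} 0<ε (cauchy x)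
      (proj₁ e , λ n N≤n → subst (ℚ._≤ seq x n) (ℚ.+-identityˡ ε) (proj₂ e n N≤n))

-- ∣ x − y ∣ ≤ ε
Within : ℚ → ℝ → ℝ → Set
Within ε x y = x -ᴿ y ≤ fromℚ ε × y -ᴿ x ≤ fromℚ ε

record 𝕀 : Set where
  field
    pt   : ℝ
    0<pt : 0ℝ < pt
    pt<1 : pt < 1ℝ

open 𝕀 public

-- Tagged partitions of [ s , y ] all of whose cells have length at most δ.
data Partition (δ : ℚ) : 𝕀 → 𝕀 → Set where
  end  : ∀ {s y} → pt s ≈ pt y → Partition δ s y
  cell : ∀ {s y} (tag m : 𝕀) → pt s ≤ pt tag → pt tag ≤ pt m → pt m -ᴿ pt s ≤ fromℚ δ →
         Partition δ m y → Partition δ s y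

riemannSum : ∀ {δ s y} → (𝕀 → ℝ) → Partition δ s y → ℝ
riemannSum f (end _) = 0ℝ
riemannSum {s = s} f (cell tag m _ _ _ π) = f tag * (pt m -ᴿ pt s) +ᴿ riemannSum f π

-- v = ∫ₛʸ f(t) dt, as a proper Riemann integral.
IsIntegral : (𝕀 → ℝ) → 𝕀 → 𝕀 → ℝ → Set
IsIntegral f s y v = ∀ ε → 0ℚ ℚ.< ε → ∃[ δ ] 0ℚ ℚ.< δ ×
  ((π : Partition δ s y) → Within ε (riemannSum f π) v)

-- v = ∫₀ᵇ f(t) dt, as the limit of ∫ₛʸ f(t) dt for s → 0⁺ and y → b⁻.
IsImproperIntegral : (𝕀 → ℝ) → ℝ → ℝ → Set
IsImproperIntegral f b v = ∀ ε → 0ℚ ℚ.< ε → ∃[ δ ] 0ℚ ℚ.< δ ×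
  ((s y : 𝕀) → pt s ≤ pt y → pt y < b → pt s ≤ fromℚ δ → b -ᴿ pt y ≤ fromℚ δ →
   ∃[ u ] IsIntegral f s y u × Within ε u v)

data Letter : Set where
  ω₀ : Letter
  ω  : (σ ε : Sign) → Letter

Word : Set
Word = List Letter

module _ where
  1-t²>0 : (t : 𝕀) → 0ℝ < 1ℝ -ᴿ pt t * pt t
  1-t²>0 t with 0<pt t | pt<1 t
  ... | ε , 0<ε , ε≤ | η , 0<η , ≤1 = η , 0<η , eventually₂ (λ n → lem (seq (pt t) n)) ε≤ ≤1
    where
    open +-*-Solver
    open ℚ.≤-Reasoning
    lem : ∀ a → 0ℚ ℚ.+ ε ℚ.≤ a → a ℚ.+ η ℚ.≤ 1ℚ → 0ℚ ℚ.+ η ℚ.≤ 1ℚ ℚ.- a ℚ.* a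
    lem a εa aη = begin
      0ℚ ℚ.+ η                ≡⟨ solve 2 (λ η a → con 0ℚ :+ η := (a :+ η) :- a) refl η a ⟩
      (a ℚ.+ η) ℚ.- a         ≤⟨ ℚ.+-mono-≤ aη (ℚ.neg-antimono-≤ a²≤a) ⟩
      1ℚ ℚ.- a ℚ.* a          ∎
      where
      0≤a : 0ℚ ℚ.≤ a
      0≤a = ℚ.≤-trans (ℚ.≤-trans (ℚ.<⇒≤ 0<ε) (ℚ.≤-reflexive (sym (ℚ.+-identityˡ ε)))) εa
      a≤1 : a ℚ.≤ 1ℚ
      a≤1 = ℚ.≤-trans (ℚ.≤-trans (ℚ.≤-reflexive (sym (ℚ.+-identityʳ a)))
                        (ℚ.+-monoʳ-≤ a (ℚ.<⇒≤ 0<η))) aη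
      a²≤a : a ℚ.* a ℚ.≤ a
      a²≤a = ℚ.≤-trans (ℚ.*-monoʳ-≤-nonNeg a {{ℚ.nonNegative 0≤a}} a≤1)
                       (ℚ.≤-reflexive (ℚ.*-identityˡ a))

  1+t²>0 : (t : 𝕀) → 0ℝ < 1ℝ +ᴿ pt t * pt t
  1+t²>0 t with 0<pt t
  ... | ε , 0<ε , N , ε≤ = 1ℚ , ℚ.positive⁻¹ 1ℚ , N , λ n N≤n →
    let a   = seq (pt t) n
        0≤a = ℚ.≤-trans (ℚ.≤-trans (ℚ.<⇒≤ 0<ε) (ℚ.≤-reflexive (sym (ℚ.+-identityˡ ε)))) (ε≤ n N≤n)
    in ℚ.≤-trans (ℚ.≤-reflexive (ℚ.+-comm 0ℚ 1ℚ))
         (ℚ.+-monoʳ-≤ 1ℚ (ℚ.≤-trans (ℚ.≤-reflexive (sym (ℚ.*-zeroˡ a)))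
           (ℚ.*-monoʳ-≤-nonNeg a {{ℚ.nonNegative 0≤a}} 0≤a)))

-- The coefficient f in the differential form f(t) dt.
density : Letter → 𝕀 → ℝ
density ω₀      t = recip (pt t) (0<pt t)
density (ω + -) t = 2ℝ * recip (1ℝ -ᴿ pt t * pt t) (1-t²>0 t)
density (ω - -) t = neg 2ℝ * recip (1ℝ +ᴿ pt t * pt t) (1+t²>0 t)
density (ω + +) t = 2ℝ * pt t * recip (1ℝ -ᴿ pt t * pt t) (1-t²>0 t)
density (ω - +) t = neg 2ℝ * pt t * recip (1ℝ +ᴿ pt t * pt t) (1+t²>0 t)

-- v = ∫_{b > t₁ > ⋯ > tₚ > 0} f₁(t₁)⋯fₚ(tₚ) dt₁⋯dtₚ, read as the nested integral
--   ∫₀ᵇ f₁(t₁) (∫₀^{t₁} f₂(t₂) ⋯ (∫₀^{tₚ₋₁} fₚ(tₚ) dtₚ) ⋯ dt₂) dt₁.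
IsIteratedIntegral : Word → ℝ → ℝ → Set
IsIteratedIntegral []      b v = v ≈ 1ℝ
IsIteratedIntegral (a ∷ w) b v =
  Σ[ g ∈ (𝕀 → ℝ) ] (∀ t → IsIteratedIntegral w (pt t) (g t)) ×
                   IsImproperIntegral (λ t → density a t * g t) b v

Admissible : Word → Set
Admissible w = (∀ ε u → w ≢ ω + ε ∷ u) × (∀ u → w ≢ u ∷ʳ ω₀)

infixr 7 _⧢_ _⧢ʷ_

_⧢ʷ_ : Word → Word → List Word
[]      ⧢ʷ v       = [ v ]
(a ∷ u) ⧢ʷ []      = [ a ∷ u ]
(a ∷ u) ⧢ʷ (b ∷ v) = map (a ∷_) (u ⧢ʷ (b ∷ v)) ++ map (b ∷_) ((a ∷ u) ⧢ʷ v)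

-- Finite formal sums of terms c·w; two sums denote the same element of the
-- algebra when all their coefficients agree.
𝔄 : Set
𝔄 = List (ℚ × Word)

_≟ᴸ_ : DecidableEquality Letter
ω₀    ≟ᴸ ω₀      = yes refl
ω₀    ≟ᴸ ω _ _   = no λ ()
ω _ _ ≟ᴸ ω₀      = no λ ()
ω σ ε ≟ᴸ ω σ′ ε′ with σ Sign.≟ σ′ | ε Sign.≟ ε′
... | yes refl | yes refl = yes refl
... | no σ≢    | _        = no λ { refl → σ≢ refl }
... | _        | no ε≢    = no λ { refl → ε≢ refl }

coeff : 𝔄 → Word → ℚ
coeff []            w = 0ℚ
coeff ((c , u) ∷ p) w with ≡-dec _≟ᴸ_ u w
... | yes _ = c ℚ.+ coeff p w
... | no  _ = coeff p w

_≋_ : Rel 𝔄 0ℓ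
p ≋ q = ∀ w → coeff p w ≡ coeff q w

_·_ : ℚ → 𝔄 → 𝔄
c · p = map (λ (d , w) → c ℚ.* d , w) p

_⧢_ : 𝔄 → 𝔄 → 𝔄
p ⧢ q = concatMap (λ (c , u) → concatMap (λ (d , v) → map (c ℚ.* d ,_) (u ⧢ʷ v)) q) p

-- Every element of the span of the admissible words is represented by a
-- formal sum of admissible words; equality is that of 𝔄.
record 𝔄⁰ : Set where
  constructor _,_
  field
    poly       : 𝔄
    admissible : All (Admissible ∘ proj₂) poly

open 𝔄⁰ public

module _ where
  Starts Ends : Word → Set
  Starts w = ∀ ε u → w ≢ ω + ε ∷ u
  Ends w = ∀ u → w ≢ u ∷ʳ ω₀

  ends-tail : ∀ a w → Ends (a ∷ w) → Ends w
  ends-tail a w e u refl = e (a ∷ u) refl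

  ends-cons : ∀ a {w} → w ≢ [] → Ends w → Ends (a ∷ w)
  ends-cons a ne e []      refl = ne refl
  ends-cons a ne e (_ ∷ u) refl = e u refl

  starts-cons : ∀ {a} {w} w′ → Starts (a ∷ w) → Starts (a ∷ w′)
  starts-cons {w = w} w′ s ε u refl = s ε w refl

  ⧢ʷ-nonempty : ∀ a u b v → All (_≢ []) ((a ∷ u) ⧢ʷ (b ∷ v))
  ⧢ʷ-nonempty a u b v = All.++⁺
    (All.map⁺ (All.universal (λ _ ()) (u ⧢ʷ (b ∷ v))))
    (All.map⁺ (All.universal (λ _ ()) ((a ∷ u) ⧢ʷ v)))

  nonemptyˡ : ∀ a u v → All (_≢ []) ((a ∷ u) ⧢ʷ v)
  nonemptyˡ a u []      = (λ ()) ∷ []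
  nonemptyˡ a u (b ∷ v) = ⧢ʷ-nonempty a u b v

  nonemptyʳ : ∀ u b v → All (_≢ []) (u ⧢ʷ (b ∷ v))
  nonemptyʳ []      b v = (λ ()) ∷ []
  nonemptyʳ (a ∷ u) b v = ⧢ʷ-nonempty a u b v

  ⧢ʷ-ends : ∀ u v → Ends u → Ends v → All Ends (u ⧢ʷ v)
  ⧢ʷ-ends []      v       eu ev = ev ∷ []
  ⧢ʷ-ends (a ∷ u) []      eu ev = eu ∷ []
  ⧢ʷ-ends (a ∷ u) (b ∷ v) eu ev = All.++⁺
    (All.map⁺ (All.zipWith (λ (ne , e) → ends-cons a ne e)
      (nonemptyʳ u b v , ⧢ʷ-ends u (b ∷ v) (ends-tail a u eu) ev)))
    (All.map⁺ (All.zipWith (λ (ne , e) → ends-cons b ne e)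
      (nonemptyˡ a u v , ⧢ʷ-ends (a ∷ u) v eu (ends-tail b v ev))))

  ⧢ʷ-starts : ∀ u v → Starts u → Starts v → All Starts (u ⧢ʷ v)
  ⧢ʷ-starts []      v       su sv = sv ∷ []
  ⧢ʷ-starts (a ∷ u) []      su sv = su ∷ []
  ⧢ʷ-starts (a ∷ u) (b ∷ v) su sv = All.++⁺
    (All.map⁺ (All.universal (λ w → starts-cons w su) (u ⧢ʷ (b ∷ v))))
    (All.map⁺ (All.universal (λ w → starts-cons w sv) ((a ∷ u) ⧢ʷ v)))

  ⧢ʷ-admissible : ∀ u v → Admissible u → Admissible v → All Admissible (u ⧢ʷ v)
  ⧢ʷ-admissible u v (su , eu) (sv , ev) = All.zip (⧢ʷ-starts u v su sv , ⧢ʷ-ends u v eu ev)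

  []-admissible : Admissible []
  []-admissible = (λ _ _ ()) , λ { [] () ; (_ ∷ _) () }

  ⧢-admissible : ∀ {p q} → All (Admissible ∘ proj₂) p → All (Admissible ∘ proj₂) q →
                 All (Admissible ∘ proj₂) (p ⧢ q)
  ⧢-admissible ps qs =
    All.concat⁺ (All.map⁺ (All.map (λ {(c , u)} au →
      All.concat⁺ (All.map⁺ (All.map (λ {(d , v)} av →
        All.map⁺ (⧢ʷ-admissible u v au av)) qs))) ps))

_*ˢ_ : ℚ → 𝔄⁰ → 𝔄⁰
c *ˢ (p , ps) = c · p , All.map⁺ ps

𝔄⁰-rawRing : RawRing 0ℓ 0ℓ
𝔄⁰-rawRing = record
  { Carrier = 𝔄⁰
  ; _≈_     = λ p q → poly p ≋ poly q
  ; _+_     = λ (p , ps) (q , qs) → p ++ q , All.++⁺ ps qs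
  ; _*_     = λ (p , ps) (q , qs) → p ⧢ q , ⧢-admissible ps qs
  ; -_      = (ℚ.- 1ℚ) *ˢ_
  ; 0#      = [] , []
  ; 1#      = [ 1ℚ , [] ] , []-admissible ∷ []
  }

ℝ-rawRing : RawRing 0ℓ 0ℓ
ℝ-rawRing = record
  { Carrier = ℝ
  ; _≈_     = _≈_
  ; _+_     = _+ᴿ_
  ; _*_     = _*_
  ; -_      = neg
  ; 0#      = 0ℝ
  ; 1#      = 1ℝ
  }

rawLeftModule : (R : RawRing 0ℓ 0ℓ) → (ℚ → RawRing.Carrier R → RawRing.Carrier R) →
                RawLeftModule ℚ 0ℓ 0ℓ
rawLeftModule R _*ₗ_ = record
  { Carrierᴹ = R.Carrier
  ; _≈ᴹ_     = R._≈_
  ; _+ᴹ_     = R._+_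
  ; _*ₗ_     = _*ₗ_
  ; 0ᴹ       = R.0#
  ; -ᴹ_      = R.-_
  }
  where module R = RawRing R

𝔄⁰-rawLeftModule ℝ-rawLeftModule : RawLeftModule ℚ 0ℓ 0ℓ
𝔄⁰-rawLeftModule = rawLeftModule 𝔄⁰-rawRing _*ˢ_
ℝ-rawLeftModule  = rawLeftModule ℝ-rawRing (λ c x → fromℚ c * x)

IsℚAlgebraHomomorphism : (𝔄⁰ → ℝ) → Set
IsℚAlgebraHomomorphism M =
  RingMorphisms.IsRingHomomorphism 𝔄⁰-rawRing ℝ-rawRing M ×
  LeftModuleMorphisms.IsLeftModuleHomomorphism 𝔄⁰-rawLeftModule ℝ-rawLeftModule M

linearExtension : (∀ w → Admissible w → ℝ) → 𝔄⁰ → ℝ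
linearExtension I ([]          , [])     = 0ℝ
linearExtension I ((c , w) ∷ p , a ∷ as) = fromℚ c * I w a +ᴿ linearExtension I (p , as)

{-# OPTIONS --safe #-}
-- Each form is f(t) dt with t f(t) a rational power series, so the iterated integral of a word over
-- [0 , t] is a power series F(t) with rational coefficients: F for the word x w is obtained from the one
-- for w by multiplying with t f(t) and inverting θ = t d/dt.  As θ is a derivation, the shuffle identity
-- F_u F_v = Σ F_w holds formally, by the induction that defines the shuffle product.  For t < 1 it may be
-- evaluated, since the coefficients are bounded; and F is uniformly differentiable away from 1, so that
-- Riemann sums telescope to differences of F.  If the word does not begin with ω₊, then (1 + t²) F(t)
-- converges absolutely at t = 1, whence F(t) tends to the sum of its coefficients as t → 1 (Abel).
module Submission where

open import Algebra.Bundles.Raw using (RawRing)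
open import Algebra.Morphism.Structures using (module MonoidMorphisms)
open import Data.Integer.Base as ℤ using (+[1+_]; -[1+_])
import Data.Integer.Properties as ℤ
open import Data.List.Base using (List; []; _∷_; _++_; map; concatMap)
open import Data.List.Membership.Propositional using (_∈_)
open import Data.List.Membership.Propositional.Properties using (∈-map⁺; ∈-++⁺ˡ; ∈-++⁺ʳ)
open import Data.List.Properties using (≡-dec)
open import Data.List.Relation.Unary.All as All using (All; []; _∷_)
open import Data.List.Relation.Unary.Any using (here; there)
open import Data.Nat.Base as ℕ using (ℕ; zero; suc)
import Data.Nat.Properties as ℕ
open import Data.Product.Base using (Σ-syntax; ∃-syntax; _×_; _,_; proj₁; proj₂)
open import Data.Rational.Base as ℚ
  using (ℚ; mkℚ; 0ℚ; 1ℚ; ½; _+_; _*_; _-_; -_; _≤_; _<_; ∣_∣; toℚᵘ)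
import Data.Rational.Properties as ℚ
open import Data.Rational.Solver using (module +-*-Solver)
open import Data.Rational.Unnormalised.Base as ℚᵘ using (mkℚᵘ; _≃_; *≡*; *≤*)
import Data.Rational.Unnormalised.Properties as ℚᵘ
open import Data.Sign.Base as Sign using (Sign)
open import Data.Sum.Base using (inj₁; inj₂)
open import Defs as Real hiding (_≤_; _<_; _*_; _≈_)
open import Function.Base using (_∘_)
open import Relation.Binary.PropositionalEquality
  using (_≡_; _≢_; refl; sym; trans; cong; cong₂; subst; subst₂; module ≡-Reasoning)
open import Relation.Nullary.Decidable.Core using (yes; no)
open import Relation.Nullary.Negation using (contradiction)
open +-*-Solver using (solve; con; _:=_; _:+_; _:*_; _:-_; :-_)

-- Rational arithmetic and null sequences

-- At t = 1 absolute convergence fails for words that begin with σ = -1: those letters have the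
-- poles ±i on the unit circle, and the only available bound on the coefficients is O(βₖ), where βₖ
-- has order k^(-1/2). So the double series for a product of two values cannot be rearranged. The
-- factor 1 + t² is chosen to cancel exactly these poles. The product formula is proved at a
-- rational point q < 1, where geometric decay controls everything, and Abel's argument is then
-- applied three times: to both factors and to their product.
--
-- The encoding of reals imposes a second constraint. The n-th approximation to F(t) is diagonal: n
-- terms of the series, evaluated at the n-th approximation to t. Every estimate must therefore be
-- uniform in the argument, estimates along a varying truncation must be uniform in n as well, and
-- each identity of power series has to be restated for truncations, with an error that tends to 0.

0≤1 : 0ℚ ≤ 1ℚ
0≤1 = ℚ.nonNegative⁻¹ 1ℚ

0<1 : 0ℚ < 1ℚ
0<1 = ℚ.positive⁻¹ 1ℚ

≤-slack : ∀ {a b} d → 0ℚ ≤ d → b ≡ a + d → a ≤ b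
≤-slack {a} d 0≤d refl = subst (_≤ a + d) (ℚ.+-identityʳ a) (ℚ.+-monoʳ-≤ a 0≤d)

slack : ∀ {a b} → a ≤ b → 0ℚ ≤ b - a
slack {a} {b} a≤b = subst (_≤ b - a) (ℚ.+-inverseʳ a) (ℚ.+-monoˡ-≤ (- a) a≤b)

+-nonNeg : ∀ {a b} → 0ℚ ≤ a → 0ℚ ≤ b → 0ℚ ≤ a + b
+-nonNeg 0≤a 0≤b = ℚ.+-mono-≤ 0≤a 0≤b

+-pos-nonNeg : ∀ {a b} → 0ℚ < a → 0ℚ ≤ b → 0ℚ < a + b
+-pos-nonNeg 0<a 0≤b = ℚ.+-mono-<-≤ 0<a 0≤b

*-monoˡ : ∀ {a b} c → 0ℚ ≤ c → a ≤ b → c * a ≤ c * b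
*-monoˡ c 0≤c = ℚ.*-monoˡ-≤-nonNeg c {{ℚ.nonNegative 0≤c}}

*-monoʳ : ∀ {a b} c → 0ℚ ≤ c → a ≤ b → a * c ≤ b * c
*-monoʳ c 0≤c = ℚ.*-monoʳ-≤-nonNeg c {{ℚ.nonNegative 0≤c}}

*-nonNeg : ∀ {a b} → 0ℚ ≤ a → 0ℚ ≤ b → 0ℚ ≤ a * b
*-nonNeg {a} {b} 0≤a 0≤b = subst (_≤ a * b) (ℚ.*-zeroʳ a) (*-monoˡ a 0≤a 0≤b)

*-cancelˡ : ∀ {a b} c → 0ℚ < c → c * a ≤ c * b → a ≤ b
*-cancelˡ c 0<c = ℚ.*-cancelˡ-≤-pos c {{ℚ.positive 0<c}}

x≤∣x∣ : ∀ x → x ≤ ∣ x ∣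
x≤∣x∣ x with ℚ.≤-total 0ℚ x
... | inj₁ 0≤x = ℚ.≤-reflexive (sym (ℚ.0≤p⇒∣p∣≡p 0≤x))
... | inj₂ x≤0 = ℚ.≤-trans x≤0 (ℚ.0≤∣p∣ x)

-x≤∣x∣ : ∀ x → - x ≤ ∣ x ∣
-x≤∣x∣ x = subst (- x ≤_) (ℚ.∣-p∣≡∣p∣ x) (x≤∣x∣ (- x))

∣∣-intro : ∀ {x a} → x ≤ a → - x ≤ a → ∣ x ∣ ≤ a
∣∣-intro {x} {a} x≤a -x≤a with ℚ.∣p∣≡p∨∣p∣≡-p x
... | inj₁ eq = subst (_≤ a) (sym eq) x≤a
... | inj₂ eq = subst (_≤ a) (sym eq) -x≤a

∣∣≤⇒0≤ : ∀ {x a} → ∣ x ∣ ≤ a → 0ℚ ≤ a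
∣∣≤⇒0≤ {x} = ℚ.≤-trans (ℚ.0≤∣p∣ x)

∣∣-nonNeg : ∀ {x a} → 0ℚ ≤ x → x ≤ a → ∣ x ∣ ≤ a
∣∣-nonNeg 0≤x x≤a = ℚ.≤-trans (ℚ.≤-reflexive (ℚ.0≤p⇒∣p∣≡p 0≤x)) x≤a

∣+∣ : ∀ {x y a b} → ∣ x ∣ ≤ a → ∣ y ∣ ≤ b → ∣ x + y ∣ ≤ a + b
∣+∣ {x} {y} p q = ℚ.≤-trans (ℚ.∣p+q∣≤∣p∣+∣q∣ x y) (ℚ.+-mono-≤ p q)

∣-∣ : ∀ {x y a b} → ∣ x ∣ ≤ a → ∣ y ∣ ≤ b → ∣ x - y ∣ ≤ a + b
∣-∣ {x} {y} p q = ℚ.≤-trans (ℚ.∣p-q∣≤∣p∣+∣q∣ x y) (ℚ.+-mono-≤ p q)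

∣*∣ : ∀ {x y a b} → ∣ x ∣ ≤ a → ∣ y ∣ ≤ b → ∣ x * y ∣ ≤ a * b
∣*∣ {x} {y} p q = ℚ.≤-trans (ℚ.≤-reflexive (ℚ.∣p*q∣≡∣p∣*∣q∣ x y))
  (*-mono-≤ (∣∣≤⇒0≤ {x} p) (ℚ.0≤∣p∣ y) p q)

∣-∣-sym : ∀ x y {a} → ∣ x - y ∣ ≤ a → ∣ y - x ∣ ≤ a
∣-∣-sym x y {a} = subst (_≤ a) (trans (sym (ℚ.∣-p∣≡∣p∣ (x - y)))
  (cong ∣_∣ (solve 2 (λ x y → :- (x :- y) := y :- x) refl x y)))

∣-∣-trans : ∀ x y z {a b} → ∣ x - y ∣ ≤ a → ∣ y - z ∣ ≤ b → ∣ x - z ∣ ≤ a + b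
∣-∣-trans x y z {a} {b} p q = subst (λ d → ∣ d ∣ ≤ a + b)
  (solve 3 (λ x y z → (x :- y) :+ (y :- z) := x :- z) refl x y z) (∣+∣ {x - y} p q)

*-1/-≤ : ∀ {a} (0<a : 0ℚ < a) {x y} → a * x ≤ y → x ≤ y * 1/[ 0<a ]
*-1/-≤ {a} 0<a {x} {y} ax≤y = *-cancelˡ a 0<a (ℚ.≤-trans ax≤y (ℚ.≤-reflexive (sym (cancel-1/ 0<a y))))

ι : ℕ → ℚ
ι zero    = 0ℚ
ι (suc n) = 1ℚ + ι n

0≤ι : ∀ n → 0ℚ ≤ ι n
0≤ι zero    = ℚ.≤-refl
0≤ι (suc n) = +-nonNeg 0≤1 (0≤ι n)

0<ι : ∀ n → 0ℚ < ι (suc n)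
0<ι n = +-pos-nonNeg 0<1 (0≤ι n)

ι-mono : ∀ {m n} → m ℕ.≤ n → ι m ≤ ι n
ι-mono {n = n} ℕ.z≤n = 0≤ι n
ι-mono (ℕ.s≤s m≤n)   = ℚ.+-monoʳ-≤ 1ℚ (ι-mono m≤n)

toℚᵘ-ι : ∀ n → toℚᵘ (ι n) ≃ mkℚᵘ (ℤ.+ n) 0
toℚᵘ-ι zero    = *≡* refl
toℚᵘ-ι (suc n) = ℚᵘ.≃-trans (ℚ.toℚᵘ-homo-+ 1ℚ (ι n))
  (ℚᵘ.≃-trans (ℚᵘ.+-congʳ (toℚᵘ 1ℚ) (toℚᵘ-ι n))
    (*≡* (cong (λ i → (ℤ.+ 1 ℤ.+ i) ℤ.* ℤ.+ 1) (ℤ.*-identityʳ (ℤ.+ n)))))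

-- A positive numerator is at least 1, so the denominator of ε is already a large enough multiple;
-- comparing unnormalised fractions leaves an inequality of naturals.
archimedean : ∀ {ε} → 0ℚ < ε → ∃[ n ] 1ℚ ≤ ι (suc n) * ε
archimedean {mkℚ -[1+ a ] d c} 0<ε with ℚ.positive 0<ε
... | ()
archimedean {mkℚ (ℤ.+ 0) d c} 0<ε with ℚ.positive 0<ε
... | ()
archimedean {ε@(mkℚ +[1+ a ] d c)} _ = d , ℚ.toℚᵘ-cancel-≤
  (ℚᵘ.≤-respʳ-≃
    (ℚᵘ.≃-sym (ℚᵘ.≃-trans (ℚ.toℚᵘ-homo-* (ι (suc d)) ε) (ℚᵘ.*-congʳ {toℚᵘ ε} (toℚᵘ-ι (suc d)))))
    (*≤* (ℤ.+≤+ lem)))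
  where
  lem : 1 ℕ.* (1 ℕ.* suc d) ℕ.≤ suc d ℕ.* suc a ℕ.* 1
  lem = subst₂ ℕ._≤_ (sym (trans (ℕ.*-identityˡ _) (ℕ.*-identityˡ _))) (sym (ℕ.*-identityʳ _))
    (ℕ.m≤m*n (suc d) (suc a))

1/suc : ℕ → ℚ
1/suc n = 1/[ 0<ι n ]

0≤1/suc : ∀ n → 0ℚ ≤ 1/suc n
0≤1/suc n = ℚ.<⇒≤ (1/>0 (0<ι n))

ι*1/suc : ∀ n → ι (suc n) * 1/suc n ≡ 1ℚ
ι*1/suc n = *-1/ (0<ι n)

Null : (ℕ → ℚ) → Set
Null x = ∀ ε → 0ℚ < ε → Eventually λ n → ∣ x n ∣ ≤ ε

private
  variable
    P Q R : ℕ → Set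

always : (∀ n → P n) → Eventually P
always p = 0 , λ n _ → p n

eventually-map : (∀ n → P n → Q n) → Eventually P → Eventually Q
eventually-map f (N , p) = N , λ n N≤n → f n (p n N≤n)

-- Estimates that involve a series shifted twice are cleanest for `2 + n` terms; this brings them
-- back to index n.
eventually-shift : ∀ k → Eventually (λ n → P (k ℕ.+ n)) → Eventually P
eventually-shift {P} k (N , p) = k ℕ.+ N , λ n le → subst P (ℕ.m+[n∸m]≡n (ℕ.≤-trans (ℕ.m≤m+n k N) le))
  (p (n ℕ.∸ k) (ℕ.≤-trans (ℕ.≤-reflexive (sym (ℕ.m+n∸m≡n k N))) (ℕ.∸-monoˡ-≤ k le)))

eventually-const : ∀ {A : Set} → Eventually (λ _ → A) → A
eventually-const (N , p) = p N ℕ.≤-refl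

-- The witness is ε / (1 + C): the added 1 keeps the divisor positive even for C = 0.
divide : ∀ {ε C} → 0ℚ < ε → 0ℚ ≤ C → ∃[ δ ] 0ℚ < δ × C * δ ≤ ε
divide {ε} {C} 0<ε 0≤C = ε * 1/[ 0<1+C ] , *-pos 0<ε (1/>0 0<1+C) , ℚ.≤-trans
  (*-monoʳ (ε * 1/[ 0<1+C ]) (ℚ.<⇒≤ (*-pos 0<ε (1/>0 0<1+C)))
    (≤-slack {C} {1ℚ + C} 1ℚ 0≤1 (ℚ.+-comm 1ℚ C)))
  (ℚ.≤-reflexive (cancel-1/ 0<1+C ε))
  where
  0<1+C = +-pos-nonNeg 0<1 0≤C

null-cong : ∀ {x y} → (Eventually λ n → x n ≡ y n) → Null x → Null y
null-cong e nx ε 0<ε = eventually₂ (λ n eq → subst (λ z → ∣ z ∣ ≤ ε) eq) e (nx ε 0<ε)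

null-+ : ∀ {x y} → Null x → Null y → Null (λ n → x n + y n)
null-+ {x} nx ny ε 0<ε = eventually₂
  (λ n p q → ℚ.≤-trans (∣+∣ {x n} p q) (ℚ.≤-reflexive (half+half ε)))
  (nx _ (half>0 0<ε)) (ny _ (half>0 0<ε))

null-*ˡ : ∀ {x y : ℕ → ℚ} {C} → (Eventually λ n → ∣ y n ∣ ≤ C) → Null x → Null (λ n → y n * x n)
null-*ˡ {x} {y} {C} by nx ε 0<ε =
  let δ , 0<δ , Cδ≤ε = divide 0<ε 0≤C
  in eventually₂ (λ n (p : ∣ y n ∣ ≤ C) q → ℚ.≤-trans (∣*∣ {y n} p q) Cδ≤ε) by (nx δ 0<δ)
  where
  0≤C = ∣∣≤⇒0≤ {y (proj₁ by)} (proj₂ by _ ℕ.≤-refl)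

ι*∣x∣-bounded⇒null : ∀ {C x} → (∀ n → ι n * ∣ x n ∣ ≤ C) → Null x
ι*∣x∣-bounded⇒null {C} {x} b ε 0<ε =
  let δ , 0<δ , Cδ≤ε = divide 0<ε 0≤C
      N , 1≤ιNδ = archimedean 0<δ
  in suc N , λ { (suc n) N≤n → *-cancelˡ (ι (suc n)) (0<ι n) (begin
    ι (suc n) * ∣ x (suc n) ∣  ≤⟨ b (suc n) ⟩
    C                          ≡⟨ ℚ.*-identityʳ C ⟨
    C * 1ℚ                     ≤⟨ *-monoˡ C 0≤C 1≤ιNδ ⟩
    C * (ι (suc N) * δ)        ≡⟨ solve 3 (λ C i δ → C :* (i :* δ) := i :* (C :* δ)) refl C (ι (suc N)) δ ⟩
    ι (suc N) * (C * δ)        ≤⟨ *-monoˡ _ (0≤ι (suc N)) Cδ≤ε ⟩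
    ι (suc N) * ε              ≤⟨ *-monoʳ _ (ℚ.<⇒≤ 0<ε) (ι-mono N≤n) ⟩
    ι (suc n) * ε              ∎) }
  where
  open ℚ.≤-Reasoning
  0≤C = ℚ.≤-trans (ℚ.≤-reflexive (sym (ℚ.*-zeroˡ ∣ x 0 ∣))) (b 0)

-- Powers and their decay

infixr 8 _^_

_^_ : ℚ → ℕ → ℚ
q ^ zero  = 1ℚ
q ^ suc n = q * q ^ n

^-nonNeg : ∀ {q} n → 0ℚ ≤ q → 0ℚ ≤ q ^ n
^-nonNeg zero    0≤q = 0≤1
^-nonNeg (suc n) 0≤q = *-nonNeg 0≤q (^-nonNeg n 0≤q)

∣^∣ : ∀ {q r} n → ∣ q ∣ ≤ r → ∣ q ^ n ∣ ≤ r ^ n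
∣^∣ zero p        = ℚ.≤-refl
∣^∣ {q} (suc n) p = ∣*∣ {q} p (∣^∣ n p)

^-mono : ∀ {q r} n → 0ℚ ≤ q → q ≤ r → q ^ n ≤ r ^ n
^-mono zero    0≤q q≤r = ℚ.≤-refl
^-mono (suc n) 0≤q q≤r = *-mono-≤ (ℚ.≤-trans 0≤q q≤r) (^-nonNeg n 0≤q) q≤r (^-mono n 0≤q q≤r)

1^ : ∀ n → 1ℚ ^ n ≡ 1ℚ
1^ zero    = refl
1^ (suc n) = trans (ℚ.*-identityˡ _) (1^ n)

^-* : ∀ q n → (q * q) ^ n ≡ q ^ n * q ^ n
^-* q zero    = refl
^-* q (suc n) = trans (cong (q * q *_) (^-* q n))
  (solve 2 (λ q p → q :* q :* (p :* p) := q :* p :* (q :* p)) refl q (q ^ n))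

module _ {r η} (0≤r : 0ℚ ≤ r) (0<η : 0ℚ < η) (r+η≤1 : r + η ≤ 1ℚ) where
  -- Bernoulli's inequality in division-free form. The inductive step is (1 + (n+1)η) r ≤ 1 + nη,
  -- which follows from r ≤ 1 - η; `d` is the exact defect, multiplied by rⁿ.
  bernoulli : ∀ n → (1ℚ + ι n * η) * r ^ n ≤ 1ℚ
  bernoulli zero    = ℚ.≤-reflexive (solve 1 (λ η → (con 1ℚ :+ con 0ℚ :* η) :* con 1ℚ := con 1ℚ) refl η)
  bernoulli (suc n) = ℚ.≤-trans (≤-slack d 0≤d eq) (bernoulli n)
    where
    d = ((1ℚ + ι n * η + η) * (1ℚ - (r + η)) + η * (ι n * η + η)) * r ^ n
    0≤ηι : 0ℚ ≤ ι n * η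
    0≤ηι = *-nonNeg (0≤ι n) (ℚ.<⇒≤ 0<η)
    0≤d : 0ℚ ≤ d
    0≤d = *-nonNeg (+-nonNeg
      (*-nonNeg (+-nonNeg (+-nonNeg 0≤1 0≤ηι) (ℚ.<⇒≤ 0<η)) (slack r+η≤1))
      (*-nonNeg (ℚ.<⇒≤ 0<η) (+-nonNeg 0≤ηι (ℚ.<⇒≤ 0<η)))) (^-nonNeg n 0≤r)
    eq : (1ℚ + ι n * η) * r ^ n ≡ (1ℚ + ι (suc n) * η) * r ^ suc n + d
    eq = solve 4 (λ i η r p → (con 1ℚ :+ i :* η) :* p :=
      (con 1ℚ :+ (con 1ℚ :+ i) :* η) :* (r :* p)
        :+ ((con 1ℚ :+ i :* η :+ η) :* (con 1ℚ :- (r :+ η)) :+ η :* (i :* η :+ η)) :* p)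
      refl (ι n) η r (r ^ n)

  ι*^-bounded : ∀ n → ι n * r ^ n ≤ 1/[ 0<η ]
  ι*^-bounded n = ℚ.≤-trans (*-1/-≤ 0<η (ℚ.≤-trans
    (≤-slack (r ^ n) (^-nonNeg n 0≤r)
      (solve 3 (λ i η p → (con 1ℚ :+ i :* η) :* p := η :* (i :* p) :+ p) refl (ι n) η (r ^ n)))
    (bernoulli n))) (ℚ.≤-reflexive (ℚ.*-identityˡ _))

  ^-null : Null (r ^_)
  ^-null = ι*∣x∣-bounded⇒null λ n → ℚ.≤-trans
    (ℚ.≤-reflexive (cong (ι n *_) (ℚ.0≤p⇒∣p∣≡p (^-nonNeg n 0≤r)))) (ι*^-bounded n)

-- r ≤ κ² for κ = 1 - η/2, so that n² rⁿ ≤ (n κⁿ)².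
module _ {r η} (0≤r : 0ℚ ≤ r) (0<η : 0ℚ < η) (r+η≤1 : r + η ≤ 1ℚ) where
  private
    κ   = 1ℚ - η * ½
    r≤κ² : r ≤ κ * κ
    r≤κ² = ≤-slack (1ℚ - (r + η) + (η * ½) * (η * ½))
      (+-nonNeg (slack r+η≤1) (*-nonNeg 0≤h 0≤h))
      (solve 2 (λ r η → (con 1ℚ :- η :* con ½) :* (con 1ℚ :- η :* con ½)
        := r :+ (con 1ℚ :- (r :+ η) :+ (η :* con ½) :* (η :* con ½))) refl r η)
      where
      0≤h = ℚ.<⇒≤ (half>0 0<η)
    0≤κ : 0ℚ ≤ κ
    0≤κ = subst (0ℚ ≤_) (solve 2 (λ r η → (con 1ℚ :- (r :+ η)) :+ r :+ η :* con ½ := con 1ℚ :- η :* con ½)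
        refl r η)
      (+-nonNeg (+-nonNeg (slack r+η≤1) 0≤r) (ℚ.<⇒≤ (half>0 0<η)))
    κ+η/2≤1 : κ + η * ½ ≤ 1ℚ
    κ+η/2≤1 = ℚ.≤-reflexive (solve 1 (λ h → con 1ℚ :- h :+ h := con 1ℚ) refl (η * ½))
    B = 1/[ half>0 0<η ]

  ι*^-null : Null (λ n → ι n * r ^ n)
  ι*^-null = ι*∣x∣-bounded⇒null λ n → begin
    ι n * ∣ ι n * r ^ n ∣           ≡⟨ cong (ι n *_) (ℚ.0≤p⇒∣p∣≡p (*-nonNeg (0≤ι n) (^-nonNeg n 0≤r))) ⟩
    ι n * (ι n * r ^ n)             ≤⟨ *-monoˡ _ (0≤ι n) (*-monoˡ _ (0≤ι n) (^-mono n 0≤r r≤κ²)) ⟩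
    ι n * (ι n * (κ * κ) ^ n)       ≡⟨ cong (λ p → ι n * (ι n * p)) (^-* κ n) ⟩
    ι n * (ι n * (κ ^ n * κ ^ n))   ≡⟨ solve 2 (λ i k → i :* (i :* (k :* k)) := i :* k :* (i :* k)) refl (ι n) (κ ^ n) ⟩
    (ι n * κ ^ n) * (ι n * κ ^ n)   ≤⟨ *-mono-≤ 0≤B (*-nonNeg (0≤ι n) (^-nonNeg n 0≤κ)) (b n) (b n) ⟩
    B * B                           ∎
    where
    open ℚ.≤-Reasoning
    0≤B = ℚ.<⇒≤ (1/>0 (half>0 0<η))
    b = ι*^-bounded 0≤κ (half>0 0<η) κ+η/2≤1

-- Truncated power series

Series : Set
Series = ℕ → ℚ

eval : ℕ → Series → ℚ → ℚ
eval zero    a q = 0ℚ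
eval (suc n) a q = a 0 + q * eval n (a ∘ suc) q

eval-cong : ∀ n {a b : Series} q → (∀ k → a k ≡ b k) → eval n a q ≡ eval n b q
eval-cong zero    q a≡b = refl
eval-cong (suc n) q a≡b = cong₂ (λ x y → x + q * y) (a≡b 0) (eval-cong n q (a≡b ∘ suc))

eval-0 : ∀ n q → eval n (λ _ → 0ℚ) q ≡ 0ℚ
eval-0 zero    q = refl
eval-0 (suc n) q = trans (cong (λ x → 0ℚ + q * x) (eval-0 n q))
  (solve 1 (λ q → con 0ℚ :+ q :* con 0ℚ := con 0ℚ) refl q)

eval-+ : ∀ n (a b : Series) q → eval n (λ k → a k + b k) q ≡ eval n a q + eval n b q
eval-+ zero    a b q = refl
eval-+ (suc n) a b q = trans (cong (λ x → a 0 + b 0 + q * x) (eval-+ n (a ∘ suc) (b ∘ suc) q))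
  (solve 5 (λ a b q x y → a :+ b :+ q :* (x :+ y) := (a :+ q :* x) :+ (b :+ q :* y)) refl
    (a 0) (b 0) q (eval n (a ∘ suc) q) (eval n (b ∘ suc) q))

eval-* : ∀ n c (a : Series) q → eval n (λ k → c * a k) q ≡ c * eval n a q
eval-* zero    c a q = sym (ℚ.*-zeroʳ c)
eval-* (suc n) c a q = trans (cong (λ x → c * a 0 + q * x) (eval-* n c (a ∘ suc) q))
  (solve 4 (λ c a q x → c :* a :+ q :* (c :* x) := c :* (a :+ q :* x)) refl c (a 0) q (eval n (a ∘ suc) q))

eval-split : ∀ m n (a : Series) q → eval (m ℕ.+ n) a q ≡ eval m a q + q ^ m * eval n (a ∘ (m ℕ.+_)) q
eval-split zero    n a q = solve 1 (λ x → x := con 0ℚ :+ con 1ℚ :* x) refl (eval n a q)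
eval-split (suc m) n a q = trans (cong (λ x → a 0 + q * x) (eval-split m n (a ∘ suc) q))
  (solve 5 (λ a q x p y → a :+ q :* (x :+ p :* y) := a :+ q :* x :+ q :* p :* y) refl
    (a 0) q (eval m (a ∘ suc) q) (q ^ m) (eval n (a ∘ (suc m ℕ.+_)) q))

eval-suc : ∀ n (a : Series) q → eval (suc n) a q ≡ eval n a q + a n * q ^ n
eval-suc zero    a q = solve 2 (λ a q → a :+ q :* con 0ℚ := con 0ℚ :+ a :* con 1ℚ) refl (a 0) q
eval-suc (suc n) a q = trans (cong (λ x → a 0 + q * x) (eval-suc n (a ∘ suc) q))
  (solve 5 (λ a q x b p → a :+ q :* (x :+ b :* p) := a :+ q :* x :+ b :* (q :* p)) refl
    (a 0) q (eval n (a ∘ suc) q) (a (suc n)) (q ^ n))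

-- The divided difference (P(q) - P(p)) / (q - p) of P = eval n a; on the diagonal it is P′.
slope : ℕ → Series → ℚ → ℚ → ℚ
slope zero    a p q = 0ℚ
slope (suc n) a p q = eval n (a ∘ suc) q + p * slope n (a ∘ suc) p q

eval-slope : ∀ n a p q → eval n a q - eval n a p ≡ slope n a p q * (q - p)
eval-slope zero    a p q = sym (ℚ.*-zeroˡ (q - p))
eval-slope (suc n) a p q = begin
  (a 0 + q * x) - (a 0 + p * y)    ≡⟨ solve 5 (λ a q x p y → (a :+ q :* x) :- (a :+ p :* y)
                                        := (q :- p) :* x :+ p :* (x :- y)) refl (a 0) q x p y ⟩
  (q - p) * x + p * (x - y)        ≡⟨ cong (λ d → (q - p) * x + p * d) (eval-slope n (a ∘ suc) p q) ⟩
  (q - p) * x + p * (s * (q - p))  ≡⟨ solve 4 (λ q p x s → (q :- p) :* x :+ p :* (s :* (q :- p))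
                                        := (x :+ p :* s) :* (q :- p)) refl q p x s ⟩
  (x + p * s) * (q - p)            ∎
  where
  open ≡-Reasoning
  x = eval n (a ∘ suc) q
  y = eval n (a ∘ suc) p
  s = slope n (a ∘ suc) p q

θ : Series → Series
θ a k = ι k * a k

-- On the diagonal `slope` is the derivative, so this is q P′(q) = (θP)(q). It links the analytic
-- derivative to the formal operator by which `coef` is built.
*-slope : ∀ n a q → q * slope n a q q ≡ eval n (θ a) q
*-slope zero    a q = ℚ.*-zeroʳ q
*-slope (suc n) a q = begin
  q * (x + q * slope n (a ∘ suc) q q)      ≡⟨ cong (λ y → q * (x + y)) (*-slope n (a ∘ suc) q) ⟩
  q * (x + y)                              ≡⟨ cong (q *_) (eval-+ n (a ∘ suc) (θ (a ∘ suc)) q) ⟨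
  q * eval n (λ k → a (suc k) + ι k * a (suc k)) q
    ≡⟨ cong (q *_) (eval-cong n q λ k →
         solve 2 (λ i a → a :+ i :* a := (con 1ℚ :+ i) :* a) refl (ι k) (a (suc k))) ⟩
  q * eval n (θ a ∘ suc) q                 ≡⟨ solve 2 (λ a z → z := con 0ℚ :* a :+ z) refl (a 0) _ ⟩
  0ℚ * a 0 + q * eval n (θ a ∘ suc) q      ∎
  where
  open ≡-Reasoning
  x = eval n (a ∘ suc) q
  y = eval n (θ (a ∘ suc)) q

conv : Series → Series → Series
conv a b zero    = a 0 * b 0
conv a b (suc k) = a 0 * b (suc k) + conv (a ∘ suc) b k

-- Estimates for ∣ q ∣ ≤ ρ < 1. `η⁻¹` bounds 1/(1 - ρ), hence the sum of the geometric series in ρ.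
module Disc {ρ η} (0≤ρ : 0ℚ ≤ ρ) (0<η : 0ℚ < η) (ρ+η≤1 : ρ + η ≤ 1ℚ) where
  η⁻¹ : ℚ
  η⁻¹ = 1/[ 0<η ]

  0≤η⁻¹ : 0ℚ ≤ η⁻¹
  0≤η⁻¹ = ℚ.<⇒≤ (1/>0 0<η)

  -- A/η dominates the fixed point of X = A + ρX, which closes every induction along the Horner
  -- recursion.
  geometric : ∀ {A} → 0ℚ ≤ A → A + ρ * (A * η⁻¹) ≤ A * η⁻¹
  geometric {A} 0≤A = ≤-slack (A * ((1ℚ - (ρ + η)) * η⁻¹)) (*-nonNeg 0≤A (*-nonNeg (slack ρ+η≤1) 0≤η⁻¹)) (begin
    A * η⁻¹                                         ≡⟨ solve 4 (λ A η⁻¹ ρ η → A :* η⁻¹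
      := A :* (η :* η⁻¹) :+ ρ :* (A :* η⁻¹) :+ A :* ((con 1ℚ :- (ρ :+ η)) :* η⁻¹)) refl A η⁻¹ ρ η ⟩
    A * (η * η⁻¹) + ρ * (A * η⁻¹) + A * ((1ℚ - (ρ + η)) * η⁻¹)
      ≡⟨ cong (λ x → A * x + ρ * (A * η⁻¹) + A * ((1ℚ - (ρ + η)) * η⁻¹)) (*-1/ 0<η) ⟩
    A * 1ℚ + ρ * (A * η⁻¹) + A * ((1ℚ - (ρ + η)) * η⁻¹)
      ≡⟨ cong (λ x → x + ρ * (A * η⁻¹) + A * ((1ℚ - (ρ + η)) * η⁻¹)) (ℚ.*-identityʳ A) ⟩
    A + ρ * (A * η⁻¹) + A * ((1ℚ - (ρ + η)) * η⁻¹)    ∎)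
    where open ≡-Reasoning

  module _ {A} (0≤A : 0ℚ ≤ A) where
    0≤A/η : 0ℚ ≤ A * η⁻¹
    0≤A/η = *-nonNeg 0≤A 0≤η⁻¹

    -- A/η² bounds ∑ k A ρ^(k-1), the derivative of a series with coefficients at most A.
    Lip : ℚ
    Lip = A * η⁻¹ * η⁻¹

    0≤Lip : 0ℚ ≤ Lip
    0≤Lip = *-nonNeg 0≤A/η 0≤η⁻¹

    eval-bound : ∀ n {a q} → (∀ k → ∣ a k ∣ ≤ A) → ∣ q ∣ ≤ ρ → ∣ eval n a q ∣ ≤ A * η⁻¹
    eval-bound zero            a≤ q≤ = 0≤A/η
    eval-bound (suc n) {a} {q} a≤ q≤ = ℚ.≤-trans
      (∣+∣ {a 0} (a≤ 0) (∣*∣ {q} q≤ (eval-bound n (a≤ ∘ suc) q≤)))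
      (geometric 0≤A)

    eval-tail : ∀ m n {a q} → (∀ k → ∣ a k ∣ ≤ A) → ∣ q ∣ ≤ ρ →
                ∣ eval (m ℕ.+ n) a q - eval m a q ∣ ≤ ρ ^ m * (A * η⁻¹)
    eval-tail m n {a} {q} a≤ q≤ = subst (λ x → ∣ x ∣ ≤ ρ ^ m * (A * η⁻¹))
      (sym (trans (cong (_- eval m a q) (eval-split m n a q))
        (solve 2 (λ x y → x :+ y :- x := y) refl (eval m a q) _)))
      (∣*∣ {q ^ m} (∣^∣ m q≤) (eval-bound n (a≤ ∘ (m ℕ.+_)) q≤))

    slope-bound : ∀ n {a p q} → (∀ k → ∣ a k ∣ ≤ A) → ∣ p ∣ ≤ ρ → ∣ q ∣ ≤ ρ → ∣ slope n a p q ∣ ≤ Lip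
    slope-bound zero                a≤ p≤ q≤ = 0≤Lip
    slope-bound (suc n) {a} {p} {q} a≤ p≤ q≤ = ℚ.≤-trans
      (∣+∣ {eval n (a ∘ suc) q} (eval-bound n (a≤ ∘ suc) q≤) (∣*∣ {p} p≤ (slope-bound n (a≤ ∘ suc) p≤ q≤)))
      (geometric 0≤A/η)

    eval-lipschitz : ∀ n {a p q d} → (∀ k → ∣ a k ∣ ≤ A) → ∣ p ∣ ≤ ρ → ∣ q ∣ ≤ ρ → ∣ q - p ∣ ≤ d →
                     ∣ eval n a q - eval n a p ∣ ≤ Lip * d
    eval-lipschitz n {a} {p} {q} {d} a≤ p≤ q≤ q-p = subst (λ x → ∣ x ∣ ≤ Lip * d)
      (sym (eval-slope n a p q)) (∣*∣ {slope n a p q} (slope-bound n a≤ p≤ q≤) q-p)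

    -- Later p and q are the end points of a cell and r is its tag: this is the error of replacing a
    -- difference quotient by the derivative at the tag, bounded independently of n and without a
    -- second derivative.
    slope-lipschitz : ∀ n {a p q r d} → (∀ k → ∣ a k ∣ ≤ A) → ∣ p ∣ ≤ ρ → ∣ q ∣ ≤ ρ → ∣ r ∣ ≤ ρ →
                      ∣ p - r ∣ ≤ d → ∣ q - r ∣ ≤ d → ∣ slope n a p q - slope n a r r ∣ ≤ (Lip * d + Lip * d) * η⁻¹
    slope-lipschitz zero {p = p} {r = r} {d} a≤ p≤ q≤ r≤ p-r q-r = *-nonNeg (+-nonNeg 0≤Ld 0≤Ld) 0≤η⁻¹
      where
      0≤Ld : 0ℚ ≤ Lip * d
      0≤Ld = *-nonNeg 0≤Lip (∣∣≤⇒0≤ {p - r} p-r)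
    slope-lipschitz (suc n) {a} {p} {q} {r} {d} a≤ p≤ q≤ r≤ p-r q-r = begin
      ∣ (x + p * s) - (y + r * t) ∣
        ≡⟨ cong ∣_∣ (solve 6 (λ x p s y r t → (x :+ p :* s) :- (y :+ r :* t)
             := (x :- y) :+ t :* (p :- r) :+ p :* (s :- t)) refl x p s y r t) ⟩
      ∣ (x - y) + t * (p - r) + p * (s - t) ∣
        ≤⟨ ∣+∣ {(x - y) + t * (p - r)}
             (∣+∣ {x - y} (eval-lipschitz n (a≤ ∘ suc) r≤ q≤ q-r)
                          (∣*∣ {t} (slope-bound n (a≤ ∘ suc) r≤ r≤) p-r))
             (∣*∣ {p} p≤ (slope-lipschitz n (a≤ ∘ suc) p≤ q≤ r≤ p-r q-r)) ⟩
      (Lip * d + Lip * d) + ρ * ((Lip * d + Lip * d) * η⁻¹)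
        ≤⟨ geometric (+-nonNeg 0≤Ld 0≤Ld) ⟩
      (Lip * d + Lip * d) * η⁻¹ ∎
      where
      open ℚ.≤-Reasoning
      x = eval n (a ∘ suc) q
      y = eval n (a ∘ suc) r
      s = slope n (a ∘ suc) p q
      t = slope n (a ∘ suc) r r
      0≤Ld : 0ℚ ≤ Lip * d
      0≤Ld = *-nonNeg 0≤Lip (∣∣≤⇒0≤ {p - r} p-r)

    -- Splitting off `a 0` leaves one uncancelled term, q x t: the last coefficient of b times the
    -- rest of a. Each of the n steps contributes at most A η⁻¹ B ρⁿ, whence the factor n.
    eval-conv : ∀ n {a b B q} → (∀ k → ∣ a k ∣ ≤ A) → (∀ k → ∣ b k ∣ ≤ B) → ∣ q ∣ ≤ ρ →
                ∣ eval n a q * eval n b q - eval n (conv a b) q ∣ ≤ (A * η⁻¹ * B) * (ι n * ρ ^ n)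
    eval-conv zero    {B = B} a≤ b≤ q≤ = ℚ.≤-reflexive (solve 1 (λ z → con 0ℚ := z :* (con 0ℚ :* con 1ℚ)) refl (A * η⁻¹ * B))
    eval-conv (suc n) {a} {b} {B} {q} a≤ b≤ q≤ = begin
      ∣ (a 0 + q * x) * eval (suc n) b q - (a 0 * b 0 + q * eval n (λ k → a 0 * b (suc k) + conv (a ∘ suc) b k) q) ∣
        ≡⟨ cong ∣_∣ (cong₂ (λ u v → (a 0 + q * x) * u - (a 0 * b 0 + q * v)) (eval-suc n b q)
             (trans (eval-+ n (λ k → a 0 * b (suc k)) (conv (a ∘ suc) b) q)
               (cong (_+ z) (eval-* n (a 0) (b ∘ suc) q)))) ⟩
      ∣ (a 0 + q * x) * (y + t) - (a 0 * b 0 + q * (a 0 * y′ + z)) ∣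
        ≡⟨ cong ∣_∣ (solve 8 (λ a q x y t b y′ z →
             (a :+ q :* x) :* (y :+ t) :- (a :* b :+ q :* (a :* y′ :+ z))
             := a :* ((y :+ t) :- (b :+ q :* y′)) :+ (q :* (x :* y :- z) :+ q :* (x :* t)))
             refl (a 0) q x y t (b 0) y′ z) ⟩
      -- Both inner brackets are the first n + 1 terms of b at q, split at opposite ends.
      ∣ a 0 * ((y + t) - (b 0 + q * y′)) + (q * (x * y - z) + q * (x * t)) ∣
        ≡⟨ cong ∣_∣ (trans (cong (λ d → a 0 * d + (q * (x * y - z) + q * (x * t)))
             (trans (cong (_- (b 0 + q * y′)) (sym (eval-suc n b q))) (ℚ.+-inverseʳ (b 0 + q * y′))))
             (solve 2 (λ a r → a :* con 0ℚ :+ r := r) refl (a 0) _)) ⟩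
      ∣ q * (x * y - z) + q * (x * t) ∣
        ≤⟨ ∣+∣ {q * (x * y - z)}
             (∣*∣ {q} q≤ (eval-conv n {a ∘ suc} (a≤ ∘ suc) b≤ q≤))
             (∣*∣ {q} q≤ (∣*∣ {x} (eval-bound n (a≤ ∘ suc) q≤) (∣*∣ {b n} (b≤ n) (∣^∣ n q≤)))) ⟩
      ρ * (A * η⁻¹ * B * (ι n * ρ ^ n)) + ρ * (A * η⁻¹ * (B * ρ ^ n))
        ≡⟨ solve 5 (λ ρ X B i p → ρ :* (X :* B :* (i :* p)) :+ ρ :* (X :* (B :* p))
             := X :* B :* ((con 1ℚ :+ i) :* (ρ :* p))) refl ρ (A * η⁻¹) B (ι n) (ρ ^ n) ⟩
      A * η⁻¹ * B * (ι (suc n) * (ρ ^ suc n)) ∎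
      where
      open ℚ.≤-Reasoning
      x = eval n (a ∘ suc) q
      y = eval n b q
      t = b n * q ^ n
      y′ = eval n (b ∘ suc) q
      z = eval n (conv (a ∘ suc) b) q

-- The shuffle product of power series

shift : Series → Series
shift a zero    = 0ℚ
shift a (suc k) = a k

sgn : Sign → ℚ
sgn Sign.+ = 1ℚ
sgn Sign.- = - 1ℚ

-- 2σ x(t) / (1 - σt²)
geo : Sign → Series → Series
geo σ x 0             = sgn σ * (x 0 + x 0)
geo σ x 1             = sgn σ * (x 1 + x 1)
geo σ x (suc (suc k)) = sgn σ * (geo σ x k + (x (suc (suc k)) + x (suc (suc k))))

-- The power of t in the numerator of t f(t): t for the superscript -1 and t² for +1.
delay : Sign → Series → Series
delay Sign.- a = shift a
delay Sign.+ a = shift (shift a)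

-- Multiplication by t f(t), where f(t) dt is the letter.
step : Letter → Series → Series
step ω₀      a = a
step (ω σ ε) a = geo σ (delay ε a)

-- The constant term is 0 because an integral from 0 vanishes at 0. Since `e 0` is discarded, this
-- inverts θ only on series without constant term.
θ⁻¹ : Series → Series
θ⁻¹ e zero    = 0ℚ
θ⁻¹ e (suc k) = e (suc k) * 1/suc k

coef : Word → Series
coef []      zero    = 1ℚ
coef []      (suc k) = 0ℚ
coef (x ∷ w)         = θ⁻¹ (step x (coef w))

θ-θ⁻¹-suc : ∀ e k → θ (θ⁻¹ e) (suc k) ≡ e (suc k)
θ-θ⁻¹-suc e k = cancel-1/ (0<ι k) (e (suc k))

ι-cancel : ∀ k {x y} → ι (suc k) * x ≡ ι (suc k) * y → x ≡ y
ι-cancel k {x} {y} eq = ℚ.≤-antisym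
  (*-cancelˡ (ι (suc k)) (0<ι k) (ℚ.≤-reflexive eq))
  (*-cancelˡ (ι (suc k)) (0<ι k) (ℚ.≤-reflexive (sym eq)))

geo-eq : ∀ σ x k → geo σ x k ≡ sgn σ * (shift (shift (geo σ x)) k + (x k + x k))
geo-eq σ x 0             = cong (sgn σ *_) (sym (ℚ.+-identityˡ _))
geo-eq σ x 1             = cong (sgn σ *_) (sym (ℚ.+-identityˡ _))
geo-eq σ x (suc (suc k)) = refl

-- The recursion looks back by two indices and so determines the series. Laws of `geo` are proved by
-- checking that the other side satisfies the same recursion.
geo-unique : ∀ σ {x e} → (∀ k → e k ≡ sgn σ * (shift (shift e) k + (x k + x k))) → ∀ k → e k ≡ geo σ x k
geo-unique σ eq 0             = trans (eq 0) (cong (sgn σ *_) (ℚ.+-identityˡ _))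
geo-unique σ eq 1             = trans (eq 1) (cong (sgn σ *_) (ℚ.+-identityˡ _))
geo-unique σ {x} eq (suc (suc k)) = trans (eq (suc (suc k)))
  (cong (λ y → sgn σ * (y + (x (suc (suc k)) + x (suc (suc k))))) (geo-unique σ eq k))

shift-cong : ∀ {a b : Series} → (∀ k → a k ≡ b k) → ∀ k → shift a k ≡ shift b k
shift-cong a≡b zero    = refl
shift-cong a≡b (suc k) = a≡b k

shift-+ : ∀ (a b : Series) k → shift (λ k → a k + b k) k ≡ shift a k + shift b k
shift-+ a b zero    = refl
shift-+ a b (suc k) = refl

delay-cong : ∀ ε {a b : Series} → (∀ k → a k ≡ b k) → ∀ k → delay ε a k ≡ delay ε b k
delay-cong Sign.- a≡b = shift-cong a≡b
delay-cong Sign.+ a≡b = shift-cong (shift-cong a≡b)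

delay-+ : ∀ ε (a b : Series) k → delay ε (λ k → a k + b k) k ≡ delay ε a k + delay ε b k
delay-+ Sign.- a b k = shift-+ a b k
delay-+ Sign.+ a b k = trans (shift-cong (shift-+ a b) k) (shift-+ (shift a) (shift b) k)

geo-cong : ∀ σ {x y : Series} → (∀ k → x k ≡ y k) → ∀ k → geo σ x k ≡ geo σ y k
geo-cong σ {x} x≡y = geo-unique σ λ k →
  trans (geo-eq σ x k) (cong (λ z → sgn σ * (shift (shift (geo σ x)) k + (z + z))) (x≡y k))

step-cong : ∀ l {a b : Series} → (∀ k → a k ≡ b k) → ∀ k → step l a k ≡ step l b k
step-cong ω₀      a≡b = a≡b
step-cong (ω σ ε) a≡b = geo-cong σ (delay-cong ε a≡b)

geo-+ : ∀ σ (x y : Series) k → geo σ (λ k → x k + y k) k ≡ geo σ x k + geo σ y k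
geo-+ σ x y k = sym (geo-unique σ {e = λ k → geo σ x k + geo σ y k} (λ k → begin
  geo σ x k + geo σ y k
    ≡⟨ cong₂ _+_ (geo-eq σ x k) (geo-eq σ y k) ⟩
  sgn σ * (X k + (x k + x k)) + sgn σ * (Y k + (y k + y k))
    ≡⟨ solve 5 (λ s X x Y y → s :* (X :+ (x :+ x)) :+ s :* (Y :+ (y :+ y))
         := s :* (X :+ Y :+ (x :+ y :+ (x :+ y)))) refl (sgn σ) (X k) (x k) (Y k) (y k) ⟩
  sgn σ * (X k + Y k + (x k + y k + (x k + y k)))
    ≡⟨ cong (λ z → sgn σ * (z + (x k + y k + (x k + y k))))
         (sym (delay-+ Sign.+ (geo σ x) (geo σ y) k)) ⟩
  sgn σ * (shift (shift (λ k → geo σ x k + geo σ y k)) k + (x k + y k + (x k + y k))) ∎) k)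
  where
  open ≡-Reasoning
  X = shift (shift (geo σ x))
  Y = shift (shift (geo σ y))

step-+ : ∀ l (a b : Series) k → step l (λ k → a k + b k) k ≡ step l a k + step l b k
step-+ ω₀      a b k = refl
step-+ (ω σ ε) a b k = trans (geo-cong σ (delay-+ ε a b) k) (geo-+ σ (delay ε a) (delay ε b) k)

step-0 : ∀ l k → step l (λ _ → 0ℚ) k ≡ 0ℚ
step-0 l k = begin
  s              ≡⟨ solve 1 (λ s → s := s :+ s :- s) refl s ⟩
  -- `0ℚ + 0ℚ` computes to `0ℚ`, so additivity says that s = s + s.
  s + s - s      ≡⟨ cong (_- s) (step-+ l (λ _ → 0ℚ) (λ _ → 0ℚ) k) ⟨
  s - s          ≡⟨ ℚ.+-inverseʳ s ⟩
  0ℚ             ∎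
  where
  open ≡-Reasoning
  s = step l (λ _ → 0ℚ) k

-- Linearity over ℚ[t], with `L-shift` as compatibility with t. Such a map commutes with every
-- `step`; both arguments of the Cauchy product are instances.
record IsLinear (L : Series → Series) : Set where
  field
    L-cong  : ∀ {a b} → (∀ k → a k ≡ b k) → ∀ k → L a k ≡ L b k
    L-+     : ∀ a b k → L (λ k → a k + b k) k ≡ L a k + L b k
    L-*     : ∀ c a k → L (λ k → c * a k) k ≡ c * L a k
    L-shift : ∀ a k → L (shift a) k ≡ shift (L a) k

  L-delay : ∀ ε a k → L (delay ε a) k ≡ delay ε (L a) k
  L-delay Sign.- a k = L-shift a k
  L-delay Sign.+ a k = trans (L-shift (shift a) k) (shift-cong (L-shift a) k)

  L-geo : ∀ σ x k → L (geo σ x) k ≡ geo σ (L x) k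
  L-geo σ x = geo-unique σ λ k → begin
    L (geo σ x) k
      ≡⟨ L-cong (geo-eq σ x) k ⟩
    L (λ k → sgn σ * (X k + (x k + x k))) k
      ≡⟨ L-* (sgn σ) _ k ⟩
    sgn σ * L (λ k → X k + (x k + x k)) k
      ≡⟨ cong (sgn σ *_) (trans (L-+ X (λ k → x k + x k) k)
           (cong₂ _+_ (L-delay Sign.+ (geo σ x) k) (L-+ x x k))) ⟩
    sgn σ * (shift (shift (L (geo σ x))) k + (L x k + L x k)) ∎
    where
    open ≡-Reasoning
    X = shift (shift (geo σ x))

  L-step : ∀ l a k → L (step l a) k ≡ step l (L a) k
  L-step ω₀      a k = refl
  L-step (ω σ ε) a k = trans (L-geo σ (delay ε a) k) (geo-cong σ (L-delay ε a) k)

conv-cong : ∀ {a a′ b b′ : Series} → (∀ k → a k ≡ a′ k) → (∀ k → b k ≡ b′ k) → ∀ k → conv a b k ≡ conv a′ b′ k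
conv-cong a≡ b≡ zero    = cong₂ _*_ (a≡ 0) (b≡ 0)
conv-cong a≡ b≡ (suc k) = cong₂ _+_ (cong₂ _*_ (a≡ 0) (b≡ (suc k))) (conv-cong (a≡ ∘ suc) b≡ k)

conv-+ˡ : ∀ (a a′ b : Series) k → conv (λ k → a k + a′ k) b k ≡ conv a b k + conv a′ b k
conv-+ˡ a a′ b zero    = ℚ.*-distribʳ-+ (b 0) (a 0) (a′ 0)
conv-+ˡ a a′ b (suc k) = trans (cong ((a 0 + a′ 0) * b (suc k) +_) (conv-+ˡ (a ∘ suc) (a′ ∘ suc) b k))
  (solve 5 (λ a a′ b x y → (a :+ a′) :* b :+ (x :+ y) := (a :* b :+ x) :+ (a′ :* b :+ y)) refl
    (a 0) (a′ 0) (b (suc k)) (conv (a ∘ suc) b k) (conv (a′ ∘ suc) b k))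

conv-+ʳ : ∀ (a b b′ : Series) k → conv a (λ k → b k + b′ k) k ≡ conv a b k + conv a b′ k
conv-+ʳ a b b′ zero    = ℚ.*-distribˡ-+ (a 0) (b 0) (b′ 0)
conv-+ʳ a b b′ (suc k) = trans (cong (a 0 * (b (suc k) + b′ (suc k)) +_) (conv-+ʳ (a ∘ suc) b b′ k))
  (solve 5 (λ a b b′ x y → a :* (b :+ b′) :+ (x :+ y) := (a :* b :+ x) :+ (a :* b′ :+ y)) refl
    (a 0) (b (suc k)) (b′ (suc k)) (conv (a ∘ suc) b k) (conv (a ∘ suc) b′ k))

conv-*ˡ : ∀ c (a b : Series) k → conv (λ k → c * a k) b k ≡ c * conv a b k
conv-*ˡ c a b zero    = ℚ.*-assoc c (a 0) (b 0)
conv-*ˡ c a b (suc k) = trans (cong (c * a 0 * b (suc k) +_) (conv-*ˡ c (a ∘ suc) b k))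
  (solve 4 (λ c a b x → c :* a :* b :+ c :* x := c :* (a :* b :+ x)) refl c (a 0) (b (suc k)) (conv (a ∘ suc) b k))

conv-*ʳ : ∀ c (a b : Series) k → conv a (λ k → c * b k) k ≡ c * conv a b k
conv-*ʳ c a b zero    = solve 3 (λ c a b → a :* (c :* b) := c :* (a :* b)) refl c (a 0) (b 0)
conv-*ʳ c a b (suc k) = trans (cong (a 0 * (c * b (suc k)) +_) (conv-*ʳ c (a ∘ suc) b k))
  (solve 4 (λ c a b x → a :* (c :* b) :+ c :* x := c :* (a :* b :+ x)) refl c (a 0) (b (suc k)) (conv (a ∘ suc) b k))

conv-0ˡ : ∀ b k → conv (λ _ → 0ℚ) b k ≡ 0ℚ
conv-0ˡ b zero    = ℚ.*-zeroˡ (b 0)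
conv-0ˡ b (suc k) = trans (cong₂ _+_ (ℚ.*-zeroˡ (b (suc k))) (conv-0ˡ b k)) refl

conv-0ʳ : ∀ a k → conv a (λ _ → 0ℚ) k ≡ 0ℚ
conv-0ʳ a zero    = ℚ.*-zeroʳ (a 0)
conv-0ʳ a (suc k) = trans (cong₂ _+_ (ℚ.*-zeroʳ (a 0)) (conv-0ʳ (a ∘ suc) k)) refl

conv-shiftˡ : ∀ a b k → conv (shift a) b k ≡ shift (conv a b) k
conv-shiftˡ a b zero    = ℚ.*-zeroˡ (b 0)
conv-shiftˡ a b (suc k) = trans (cong (_+ conv a b k) (ℚ.*-zeroˡ (b (suc k)))) (ℚ.+-identityˡ _)

conv-shiftʳ : ∀ a b k → conv a (shift b) k ≡ shift (conv a b) k
conv-shiftʳ a b zero          = ℚ.*-zeroʳ (a 0)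
conv-shiftʳ a b (suc zero)    = trans (cong (a 0 * b 0 +_) (ℚ.*-zeroʳ (a 1))) (ℚ.+-identityʳ _)
conv-shiftʳ a b (suc (suc k)) = cong (a 0 * b (suc k) +_) (conv-shiftʳ (a ∘ suc) b (suc k))

conv-isLinearˡ : ∀ b → IsLinear (λ a → conv a b)
conv-isLinearˡ b = record
  { L-cong  = λ a≡ → conv-cong a≡ (λ _ → refl)
  ; L-+     = λ a a′ → conv-+ˡ a a′ b
  ; L-*     = λ c a → conv-*ˡ c a b
  ; L-shift = λ a → conv-shiftˡ a b
  }

conv-isLinearʳ : ∀ a → IsLinear (conv a)
conv-isLinearʳ a = record
  { L-cong  = conv-cong (λ _ → refl)
  ; L-+     = conv-+ʳ a
  ; L-*     = λ c → conv-*ʳ c a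
  ; L-shift = conv-shiftʳ a
  }

conv-identityˡ : ∀ b k → conv (coef []) b k ≡ b k
conv-identityˡ b zero    = ℚ.*-identityˡ (b 0)
conv-identityˡ b (suc k) = trans (cong₂ _+_ (ℚ.*-identityˡ (b (suc k))) (conv-0ˡ b k)) (ℚ.+-identityʳ _)

conv-identityʳ : ∀ a k → conv a (coef []) k ≡ a k
conv-identityʳ a zero    = ℚ.*-identityʳ (a 0)
conv-identityʳ a (suc k) = trans (cong₂ _+_ (ℚ.*-zeroʳ (a 0)) (conv-identityʳ (a ∘ suc) k)) (ℚ.+-identityˡ _)

θ-suc : ∀ a k → θ a (suc k) ≡ a (suc k) + θ (a ∘ suc) k
θ-suc a k = solve 2 (λ i a → (con 1ℚ :+ i) :* a := a :+ i :* a) refl (ι k) (a (suc k))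

θ-conv : ∀ a b k → θ (conv a b) k ≡ conv (θ a) b k + conv a (θ b) k
θ-conv a b zero    = solve 2 (λ a b → con 0ℚ :* (a :* b) := con 0ℚ :* a :* b :+ a :* (con 0ℚ :* b)) refl (a 0) (b 0)
θ-conv a b (suc k) = begin
  (1ℚ + ι k) * (a 0 * b (suc k) + x)
    ≡⟨ solve 4 (λ i a b x → (con 1ℚ :+ i) :* (a :* b :+ x) := a :* ((con 1ℚ :+ i) :* b) :+ (x :+ i :* x))
         refl (ι k) (a 0) (b (suc k)) x ⟩
  y + (x + ι k * x)
    ≡⟨ cong (λ z → y + (x + z)) (θ-conv (a ∘ suc) b k) ⟩
  y + (x + (u + v))
    ≡⟨ solve 6 (λ a b y x u v → y :+ (x :+ (u :+ v)) := con 0ℚ :* a :* b :+ (x :+ u) :+ (y :+ v))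
         refl (a 0) (b (suc k)) y x u v ⟩
  0ℚ * a 0 * b (suc k) + (x + u) + (y + v)
    ≡⟨ cong (λ z → 0ℚ * a 0 * b (suc k) + z + (y + v))
         (trans (sym (conv-+ˡ (a ∘ suc) (θ (a ∘ suc)) b k)) (conv-cong (sym ∘ θ-suc a) (λ _ → refl) k)) ⟩
  conv (θ a) b (suc k) + conv a (θ b) (suc k) ∎
  where
  open ≡-Reasoning
  x = conv (a ∘ suc) b k
  y = a 0 * θ b (suc k)
  u = conv (θ (a ∘ suc)) b k
  v = conv (a ∘ suc) (θ b) k

delay-0 : ∀ ε a → delay ε a 0 ≡ 0ℚ
delay-0 Sign.- a = refl
delay-0 Sign.+ a = refl

-- Only index 0 needs an argument. There the word ω₀ alone would fail, with 0 against 1: this is the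
-- divergence of ∫ dt/t at 0, and `Ends` excludes it. For the other letters `delay` removes the
-- constant term.
θ-coef : ∀ l w → Ends (l ∷ w) → ∀ k → θ (coef (l ∷ w)) k ≡ step l (coef w) k
θ-coef l         w       ends (suc k) = θ-θ⁻¹-suc (step l (coef w)) k
θ-coef ω₀        []      ends zero    = contradiction refl (ends [])
θ-coef ω₀        (_ ∷ _) ends zero    = refl
θ-coef (ω σ ε)   w       ends zero    =
  sym (trans (cong (λ x → sgn σ * (x + x)) (delay-0 ε (coef w))) (ℚ.*-zeroʳ (sgn σ)))

coefs : List Word → Series
coefs []       k = 0ℚ
coefs (w ∷ ws) k = coef w k + coefs ws k

coefs-++ : ∀ us vs k → coefs (us ++ vs) k ≡ coefs us k + coefs vs k
coefs-++ []       vs k = sym (ℚ.+-identityˡ _)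
coefs-++ (u ∷ us) vs k = trans (cong (coef u k +_) (coefs-++ us vs k)) (sym (ℚ.+-assoc (coef u k) _ _))

coefs-map-0 : ∀ l ws → coefs (map (l ∷_) ws) 0 ≡ 0ℚ
coefs-map-0 l []       = refl
coefs-map-0 l (w ∷ ws) = trans (ℚ.+-identityˡ _) (coefs-map-0 l ws)

θ-coefs-map : ∀ l ws k → θ (coefs (map (l ∷_) ws)) (suc k) ≡ step l (coefs ws) (suc k)
θ-coefs-map l []       k = trans (ℚ.*-zeroʳ (ι (suc k))) (sym (step-0 l (suc k)))
θ-coefs-map l (w ∷ ws) k = begin
  ι (suc k) * (coef (l ∷ w) (suc k) + coefs (map (l ∷_) ws) (suc k))
    ≡⟨ ℚ.*-distribˡ-+ (ι (suc k)) _ _ ⟩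
  θ (coef (l ∷ w)) (suc k) + θ (coefs (map (l ∷_) ws)) (suc k)
    ≡⟨ cong₂ _+_ (θ-θ⁻¹-suc (step l (coef w)) k) (θ-coefs-map l ws k) ⟩
  step l (coef w) (suc k) + step l (coefs ws) (suc k)
    ≡⟨ step-+ l (coef w) (coefs ws) (suc k) ⟨
  step l (coefs (w ∷ ws)) (suc k) ∎
  where open ≡-Reasoning

conv-coef : ∀ u v → Ends u → Ends v → ∀ k → conv (coef u) (coef v) k ≡ coefs (u ⧢ʷ v) k
conv-coef []      v       eu ev k    = trans (conv-identityˡ (coef v) k) (sym (ℚ.+-identityʳ _))
conv-coef (a ∷ u) []      eu ev k    = trans (conv-identityʳ (coef (a ∷ u)) k) (sym (ℚ.+-identityʳ _))
-- θ kills constant terms, so index 0 is compared separately: nonempty words have constant term 0.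
-- At `suc k` the positive factor introduced by θ is cancelled.
conv-coef (a ∷ u) (b ∷ v) eu ev zero = sym (trans (coefs-++ (map (a ∷_) (u ⧢ʷ (b ∷ v))) _ 0)
  (cong₂ _+_ (coefs-map-0 a (u ⧢ʷ (b ∷ v))) (coefs-map-0 b ((a ∷ u) ⧢ʷ v))))
conv-coef (a ∷ u) (b ∷ v) eu ev (suc k) = ι-cancel k (begin
  θ (conv (coef (a ∷ u)) (coef (b ∷ v))) (suc k)
    ≡⟨ θ-conv (coef (a ∷ u)) (coef (b ∷ v)) (suc k) ⟩
  conv (θ (coef (a ∷ u))) (coef (b ∷ v)) (suc k) + conv (coef (a ∷ u)) (θ (coef (b ∷ v))) (suc k)
    ≡⟨ cong₂ _+_ (conv-cong (θ-coef a u eu) (λ _ → refl) (suc k))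
                 (conv-cong {coef (a ∷ u)} (λ _ → refl) (θ-coef b v ev) (suc k)) ⟩
  conv (step a (coef u)) (coef (b ∷ v)) (suc k) + conv (coef (a ∷ u)) (step b (coef v)) (suc k)
    ≡⟨ cong₂ _+_ (IsLinear.L-step (conv-isLinearˡ (coef (b ∷ v))) a (coef u) (suc k))
                 (IsLinear.L-step (conv-isLinearʳ (coef (a ∷ u))) b (coef v) (suc k)) ⟩
  step a (conv (coef u) (coef (b ∷ v))) (suc k) + step b (conv (coef (a ∷ u)) (coef v)) (suc k)
    ≡⟨ cong₂ _+_ (step-cong a (conv-coef u (b ∷ v) (ends-tail a u eu) ev) (suc k))
                 (step-cong b (conv-coef (a ∷ u) v eu (ends-tail b v ev)) (suc k)) ⟩
  step a (coefs (u ⧢ʷ (b ∷ v))) (suc k) + step b (coefs ((a ∷ u) ⧢ʷ v)) (suc k)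
    ≡⟨ cong₂ _+_ (θ-coefs-map a (u ⧢ʷ (b ∷ v)) k) (θ-coefs-map b ((a ∷ u) ⧢ʷ v) k) ⟨
  θ (coefs us) (suc k) + θ (coefs vs) (suc k)
    ≡⟨ ℚ.*-distribˡ-+ (ι (suc k)) _ _ ⟨
  ι (suc k) * (coefs us (suc k) + coefs vs (suc k))
    ≡⟨ cong (ι (suc k) *_) (coefs-++ us vs (suc k)) ⟨
  ι (suc k) * coefs (us ++ vs) (suc k) ∎)
  where
  open ≡-Reasoning
  us = map (a ∷_) (u ⧢ʷ (b ∷ v))
  vs = map (b ∷_) ((a ∷ u) ⧢ʷ v)

-- Growth of the coefficients

-- The central binomial weights C(2k,k)/4ᵏ, the coefficients of 1/√(1-t): they dominate the
-- powers of log k / k occurring in iterated integrals, and ∑_{j<k} βⱼ = 2k βₖ.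
β : Series
β zero    = 1ℚ
β (suc k) = β k * (1ℚ - ½ * 1/suc k)

1/suc≤1 : ∀ k → 1/suc k ≤ 1ℚ
1/suc≤1 k = begin
  x            ≡⟨ ℚ.*-identityˡ x ⟨
  1ℚ * x       ≤⟨ *-monoʳ {1ℚ} {ι (suc k)} x (0≤1/suc k) (≤-slack (ι k) (0≤ι k) refl) ⟩
  ι (suc k) * x ≡⟨ ι*1/suc k ⟩
  1ℚ           ∎
  where
  open ℚ.≤-Reasoning
  x = 1/suc k

0≤½ : 0ℚ ≤ ½
0≤½ = ℚ.nonNegative⁻¹ ½

0≤β : ∀ k → 0ℚ ≤ β k
0≤β zero    = 0≤1
0≤β (suc k) = *-nonNeg (0≤β k) (subst (0ℚ ≤_)
  (solve 1 (λ x → con ½ :+ con ½ :* (con 1ℚ :- x) := con 1ℚ :- con ½ :* x) refl (1/suc k))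
  (+-nonNeg 0≤½ (*-nonNeg 0≤½ (slack (1/suc≤1 k)))))

β-step : ∀ k → β k ≡ β (suc k) + β k * (½ * 1/suc k)
β-step k = solve 2 (λ b x → b := b :* (con 1ℚ :- con ½ :* x) :+ b :* (con ½ :* x)) refl (β k) (1/suc k)

β-suc≤ : ∀ k → β (suc k) ≤ β k
β-suc≤ k = ≤-slack _ (*-nonNeg (0≤β k) (*-nonNeg 0≤½ (0≤1/suc k))) (β-step k)

β-antitone : ∀ {m n} → m ℕ.≤ n → β n ≤ β m
β-antitone {m} {n} m≤n = subst (λ i → β i ≤ β m) (ℕ.m+[n∸m]≡n m≤n) (go (n ℕ.∸ m))
  where
  go : ∀ j → β (m ℕ.+ j) ≤ β m
  go zero    = ℚ.≤-reflexive (cong β (ℕ.+-identityʳ m))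
  go (suc j) = subst (λ i → β i ≤ β m) (sym (ℕ.+-suc m j)) (ℚ.≤-trans (β-suc≤ (m ℕ.+ j)) (go j))

β≤1 : ∀ k → β k ≤ 1ℚ
β≤1 k = β-antitone {0} {k} ℕ.z≤n

∑β : ℕ → ℚ
∑β zero    = 0ℚ
∑β (suc k) = ∑β k + β k

-- Induction from (k+1) βₖ₊₁ = (k + ½) βₖ. This identity is the reason for choosing β: the factor 2k
-- gained by summation is undone by the division by k in θ⁻¹.
∑β-closed : ∀ k → ∑β k ≡ ι k * (β k + β k)
∑β-closed zero    = refl
∑β-closed (suc k) = begin
  ∑β k + β k
    ≡⟨ cong (_+ β k) (∑β-closed k) ⟩
  ι k * (β k + β k) + β k
    ≡⟨ solve 3 (λ i b x → i :* (b :+ b) :+ b :=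
         (con 1ℚ :+ i) :* (b :* (con 1ℚ :- con ½ :* x) :+ b :* (con 1ℚ :- con ½ :* x))
           :+ b :* ((con 1ℚ :+ i) :* x :- con 1ℚ)) refl (ι k) (β k) (1/suc k) ⟩
  ι (suc k) * (β (suc k) + β (suc k)) + β k * (ι (suc k) * 1/suc k - 1ℚ)
    ≡⟨ cong (λ y → ι (suc k) * (β (suc k) + β (suc k)) + β k * (y - 1ℚ)) (ι*1/suc k) ⟩
  ι (suc k) * (β (suc k) + β (suc k)) + β k * (1ℚ - 1ℚ)
    ≡⟨ solve 2 (λ u b → u :+ b :* (con 1ℚ :- con 1ℚ) := u) refl (ι (suc k) * (β (suc k) + β (suc k))) (β k) ⟩
  ι (suc k) * (β (suc k) + β (suc k)) ∎
  where open ≡-Reasoning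

-- Passing from k to k+1 multiplies the left side by (2k+1)(2k+3)/(2k+2)² = 1 - 1/(2k+2)², as in
-- Wallis' product. This gives βₖ → 0 without square roots.
β²-bound : ∀ k → (1ℚ + (ι k + ι k)) * (β k * β k) ≤ 1ℚ
β²-bound zero    = ℚ.≤-reflexive refl
β²-bound (suc k) = ℚ.≤-trans (≤-slack d 0≤d eq) (β²-bound k)
  where
  x = 1/suc k
  d = (1ℚ + (ι k + ι k)) * (β k * β k) * (½ * x * (½ * x))
  0≤d : 0ℚ ≤ d
  0≤d = *-nonNeg (*-nonNeg (+-nonNeg 0≤1 (+-nonNeg (0≤ι k) (0≤ι k))) (*-nonNeg (0≤β k) (0≤β k)))
    (*-nonNeg (*-nonNeg 0≤½ (0≤1/suc k)) (*-nonNeg 0≤½ (0≤1/suc k)))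
  open ≡-Reasoning
  eq : (1ℚ + (ι k + ι k)) * (β k * β k) ≡ (1ℚ + (ι (suc k) + ι (suc k))) * (β (suc k) * β (suc k)) + d
  eq = begin
    (1ℚ + (ι k + ι k)) * (β k * β k)
      ≡⟨ solve 3 (λ i b x → (con 1ℚ :+ (i :+ i)) :* (b :* b) :=
           ((con 1ℚ :+ ((con 1ℚ :+ i) :+ (con 1ℚ :+ i)))
             :* (b :* (con 1ℚ :- con ½ :* x) :* (b :* (con 1ℚ :- con ½ :* x)))
             :+ (con 1ℚ :+ (i :+ i)) :* (b :* b) :* (con ½ :* x :* (con ½ :* x)))
           :+ ((con 1ℚ :+ i) :* x :- con 1ℚ) :* (b :* b :* (con 1ℚ :+ con 1ℚ :- x))) refl (ι k) (β k) x ⟩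
    (1ℚ + (ι (suc k) + ι (suc k))) * (β (suc k) * β (suc k)) + d + (ι (suc k) * x - 1ℚ) * (β k * β k * (1ℚ + 1ℚ - x))
      ≡⟨ cong (λ y → (1ℚ + (ι (suc k) + ι (suc k))) * (β (suc k) * β (suc k)) + d + (y - 1ℚ) * (β k * β k * (1ℚ + 1ℚ - x)))
           (ι*1/suc k) ⟩
    (1ℚ + (ι (suc k) + ι (suc k))) * (β (suc k) * β (suc k)) + d + (1ℚ - 1ℚ) * (β k * β k * (1ℚ + 1ℚ - x))
      ≡⟨ solve 2 (λ u v → u :+ (con 1ℚ :- con 1ℚ) :* v := u) refl
           ((1ℚ + (ι (suc k) + ι (suc k))) * (β (suc k) * β (suc k)) + d) (β k * β k * (1ℚ + 1ℚ - x)) ⟩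
    (1ℚ + (ι (suc k) + ι (suc k))) * (β (suc k) * β (suc k)) + d ∎

square-cancel-≤ : ∀ {a b} → 0ℚ < b → a * a ≤ b * b → a ≤ b
square-cancel-≤ {a} {b} 0<b aa≤bb with ℚ.≤-total a b
... | inj₁ a≤b = a≤b
... | inj₂ b≤a = *-cancelˡ b 0<b (ℚ.≤-trans
  (*-monoʳ a (ℚ.≤-trans (ℚ.<⇒≤ 0<b) b≤a) b≤a) aa≤bb)

β-small : ∀ {ε C} → 0ℚ < ε → 0ℚ ≤ C → ∃[ K ] C * β K ≤ ε
β-small {ε} {C} 0<ε 0≤C =
  let δ , 0<δ , Cδ≤ε = divide 0<ε 0≤C
      N , 1≤ = archimedean (*-pos 0<δ 0<δ)
      n = suc N
      β≤δ = square-cancel-≤ {β n} 0<δ (*-cancelˡ (ι n) (0<ι N) (begin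
        ι n * (β n * β n)                   ≤⟨ *-monoʳ {ι n} {1ℚ + (ι n + ι n)} _ (*-nonNeg (0≤β n) (0≤β n))
                                                 (≤-slack (1ℚ + ι n) (+-nonNeg 0≤1 (0≤ι n))
                                                   (solve 1 (λ i → con 1ℚ :+ (i :+ i) := i :+ (con 1ℚ :+ i)) refl (ι n))) ⟩
        (1ℚ + (ι n + ι n)) * (β n * β n)    ≤⟨ β²-bound n ⟩
        1ℚ                                  ≤⟨ 1≤ ⟩
        ι n * (δ * δ)                       ∎))
  in n , ℚ.≤-trans (*-monoˡ C 0≤C β≤δ) Cδ≤ε
  where open ℚ.≤-Reasoning

Dominated : ℚ → Series → Set
Dominated A a = ∀ k → ∣ a k ∣ ≤ A * β k

∣sgn∣≤1 : ∀ σ → ∣ sgn σ ∣ ≤ 1ℚ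
∣sgn∣≤1 Sign.+ = ℚ.≤-refl
∣sgn∣≤1 Sign.- = ℚ.≤-refl

module _ {A a} (0≤A : 0ℚ ≤ A) (a≤ : Dominated A a) where
  delay-dominated : ∀ ε k → ∣ delay ε a (suc (suc k)) ∣ ≤ A * β k
  delay-dominated Sign.- k = ℚ.≤-trans (a≤ (suc k)) (*-monoˡ A 0≤A (β-suc≤ k))
  delay-dominated Sign.+ k = a≤ k

  delay-1 : ∀ ε → ∣ delay ε a 1 ∣ ≤ A
  delay-1 Sign.- = ℚ.≤-trans (a≤ 0) (ℚ.≤-reflexive (ℚ.*-identityʳ A))
  delay-1 Sign.+ = 0≤A

  -- The recursion of `geo` advances by two indices and adds at most 2A βₖ at k+2, because `delay`
  -- moves the coefficients up by at least one place. The summand β (suc k) of the bound is pure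
  -- slack.
  geo-dominated : ∀ σ ε k → ∣ geo σ (delay ε a) k ∣ ≤ (A + A) * ∑β k
  geo-dominated σ ε zero = ℚ.≤-reflexive (trans
    (cong ∣_∣ (trans (cong (λ x → sgn σ * (x + x)) (delay-0 ε a)) (ℚ.*-zeroʳ (sgn σ))))
    (sym (ℚ.*-zeroʳ (A + A))))
  geo-dominated σ ε (suc zero) = ℚ.≤-trans
    (∣*∣ {sgn σ} (∣sgn∣≤1 σ) (∣+∣ {delay ε a 1} (delay-1 ε) (delay-1 ε)))
    (ℚ.≤-reflexive (solve 1 (λ A → con 1ℚ :* (A :+ A) := (A :+ A) :* (con 0ℚ :+ con 1ℚ)) refl A))
  geo-dominated σ ε (suc (suc k)) = ℚ.≤-trans
    (∣*∣ {sgn σ} (∣sgn∣≤1 σ) (∣+∣ {geo σ (delay ε a) k} (geo-dominated σ ε k)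
      (∣+∣ {delay ε a (suc (suc k))} (delay-dominated ε k) (delay-dominated ε k))))
    (≤-slack ((A + A) * β (suc k)) (*-nonNeg (+-nonNeg 0≤A 0≤A) (0≤β (suc k)))
      (solve 4 (λ A s b b′ → (A :+ A) :* (s :+ b :+ b′) :=
        con 1ℚ :* ((A :+ A) :* s :+ (A :* b :+ A :* b)) :+ (A :+ A) :* b′) refl A (∑β k) (β k) (β (suc k))))

  -- By `∑β-closed`, 2A (∑_{j<k} βⱼ) / k = 4A βₖ: a letter costs a factor 4 and leaves the weight
  -- unchanged. For ω₀ the factor is generous, so that all letters share one bound.
  θ⁻¹-step-dominated : ∀ l → Dominated (A + A + (A + A)) (θ⁻¹ (step l a))
  θ⁻¹-step-dominated l zero =
    *-nonNeg (+-nonNeg (+-nonNeg 0≤A 0≤A) (+-nonNeg 0≤A 0≤A)) (0≤β 0)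
  θ⁻¹-step-dominated ω₀ (suc k) = ℚ.≤-trans
    (∣*∣ {a (suc k)} (a≤ (suc k)) (∣∣-nonNeg (0≤1/suc k) (1/suc≤1 k)))
    (≤-slack ((A + (A + A)) * β (suc k)) (*-nonNeg (+-nonNeg 0≤A (+-nonNeg 0≤A 0≤A)) (0≤β (suc k)))
      (solve 2 (λ A b → (A :+ A :+ (A :+ A)) :* b := A :* b :* con 1ℚ :+ (A :+ (A :+ A)) :* b) refl A (β (suc k))))
  θ⁻¹-step-dominated (ω σ ε) (suc k) = ℚ.≤-trans
    (∣*∣ {geo σ (delay ε a) (suc k)} (geo-dominated σ ε (suc k)) (∣∣-nonNeg (0≤1/suc k) ℚ.≤-refl))
    (ℚ.≤-reflexive (begin
      (A + A) * ∑β (suc k) * 1/suc k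
        ≡⟨ cong (λ s → (A + A) * s * 1/suc k) (∑β-closed (suc k)) ⟩
      (A + A) * (ι (suc k) * (b + b)) * 1/suc k
        ≡⟨ solve 4 (λ A i b x → (A :+ A) :* (i :* (b :+ b)) :* x := (A :+ A :+ (A :+ A)) :* b :* (i :* x))
             refl A (ι (suc k)) b (1/suc k) ⟩
      (A + A + (A + A)) * b * (ι (suc k) * 1/suc k)
        ≡⟨ trans (cong ((A + A + (A + A)) * b *_) (ι*1/suc k)) (ℚ.*-identityʳ _) ⟩
      (A + A + (A + A)) * b ∎))
    where
    open ≡-Reasoning
    b = β (suc k)

size : Word → ℚ
size []      = 1ℚ
size (l ∷ w) = size w + size w + (size w + size w)

0≤size : ∀ w → 0ℚ ≤ size w
0≤size []      = 0≤1
0≤size (l ∷ w) = +-nonNeg (+-nonNeg (0≤size w) (0≤size w)) (+-nonNeg (0≤size w) (0≤size w))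

coef-dominated : ∀ w → Dominated (size w) (coef w)
coef-dominated []      zero    = ℚ.≤-refl
coef-dominated []      (suc k) = *-nonNeg 0≤1 (0≤β (suc k))
coef-dominated (l ∷ w)         = θ⁻¹-step-dominated (0≤size w) (coef-dominated w) l

dominated⇒bounded : ∀ {A a} → 0ℚ ≤ A → Dominated A a → ∀ k → ∣ a k ∣ ≤ A
dominated⇒bounded {A} 0≤A a≤ k = ℚ.≤-trans (a≤ k)
  (ℚ.≤-trans (*-monoˡ A 0≤A (β≤1 k)) (ℚ.≤-reflexive (ℚ.*-identityʳ A)))

-- Although a itself need not be absolutely summable, (1 + t²) a(t) has coefficients O(βₖ / k).
record Regular (a : Series) : Set where
  field
    A C : ℚ
    0≤A : 0ℚ ≤ A
    0≤C : 0ℚ ≤ C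
    a≤  : Dominated A a
    h≤  : ∀ k → ∣ ι (suc (suc k)) * (a (suc (suc k)) + a k) ∣ ≤ C * β k

regular-cong : ∀ {a b} → (∀ k → a k ≡ b k) → Regular a → Regular b
regular-cong {a} {b} a≡b ra = record
  { A = A ; C = C ; 0≤A = 0≤A ; 0≤C = 0≤C
  ; a≤ = λ k → subst (λ x → ∣ x ∣ ≤ A * β k) (a≡b k) (a≤ k)
  ; h≤ = λ k → subst₂ (λ x y → ∣ ι (suc (suc k)) * (x + y) ∣ ≤ C * β k) (a≡b (suc (suc k))) (a≡b k) (h≤ k)
  }
  where open Regular ra

regular-0 : Regular (λ _ → 0ℚ)
regular-0 = record
  { A = 0ℚ ; C = 0ℚ ; 0≤A = ℚ.≤-refl ; 0≤C = ℚ.≤-refl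
  ; a≤ = λ k → ℚ.≤-reflexive (sym (ℚ.*-zeroˡ (β k)))
  ; h≤ = λ k → ℚ.≤-reflexive (trans (cong ∣_∣ (ℚ.*-zeroʳ (ι (suc (suc k))))) (sym (ℚ.*-zeroˡ (β k))))
  }

regular-+ : ∀ {a b} → Regular a → Regular b → Regular (λ k → a k + b k)
regular-+ {a} {b} ra rb = record
  { A = A ra + A rb ; C = C ra + C rb
  ; 0≤A = +-nonNeg (0≤A ra) (0≤A rb) ; 0≤C = +-nonNeg (0≤C ra) (0≤C rb)
  ; a≤ = λ k → ℚ.≤-trans (∣+∣ {a k} (a≤ ra k) (a≤ rb k)) (ℚ.≤-reflexive (sym (ℚ.*-distribʳ-+ (β k) (A ra) (A rb))))
  ; h≤ = λ k → subst₂ _≤_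
      (cong ∣_∣ (solve 5 (λ i a a′ b b′ → i :* (a :+ a′) :+ i :* (b :+ b′) := i :* (a :+ b :+ (a′ :+ b′)))
        refl (ι (suc (suc k))) (a (suc (suc k))) (a k) (b (suc (suc k))) (b k)))
      (sym (ℚ.*-distribʳ-+ (β k) (C ra) (C rb)))
      (∣+∣ {ι (suc (suc k)) * (a (suc (suc k)) + a k)} (h≤ ra k) (h≤ rb k))
  }
  where open Regular

regular-* : ∀ c {a} → Regular a → Regular (λ k → c * a k)
regular-* c {a} ra = record
  { A = ∣ c ∣ * A ; C = ∣ c ∣ * C
  ; 0≤A = *-nonNeg (ℚ.0≤∣p∣ c) 0≤A ; 0≤C = *-nonNeg (ℚ.0≤∣p∣ c) 0≤C
  ; a≤ = λ k → ℚ.≤-trans (∣*∣ {c} ℚ.≤-refl (a≤ k)) (ℚ.≤-reflexive (sym (ℚ.*-assoc ∣ c ∣ A (β k))))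
  ; h≤ = λ k → subst₂ _≤_
      (cong ∣_∣ (solve 4 (λ c i a a′ → c :* (i :* (a :+ a′)) := i :* (c :* a :+ c :* a′))
        refl c (ι (suc (suc k))) (a (suc (suc k))) (a k)))
      (sym (ℚ.*-assoc ∣ c ∣ C (β k)))
      (∣*∣ {c} ℚ.≤-refl (h≤ k))
  }
  where open Regular ra

-- With e = θb one has (k+2)(bₖ₊₂ + bₖ) = eₖ₊₂ + eₖ + 2bₖ, so it suffices to bound eₖ₊₂ + eₖ by
-- O(βₖ). For ω₀ each summand is small; for σ = -1 the two nearly cancel; for σ = +1 they would add
-- up, and `Starts` excludes this case.
regular-coef : ∀ w → Admissible w → Regular (coef w)
regular-coef [] _ = record
  -- 2 is the only nonzero value of (k+2)(aₖ₊₂ + aₖ), taken at k = 0.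
  { A = 1ℚ ; C = ι 2 ; 0≤A = 0≤1 ; 0≤C = 0≤ι 2
  ; a≤ = coef-dominated []
  ; h≤ = λ { zero    → ℚ.≤-refl
           ; (suc k) → subst (λ x → ∣ x ∣ ≤ ι 2 * β (suc k)) (sym (ℚ.*-zeroʳ (ι (suc (suc (suc k))))))
                         (*-nonNeg (0≤ι 2) (0≤β (suc k))) }
  }
regular-coef (l ∷ w) (starts , ends) = record
  { A = A′ ; C = A + A + (A′ + A′) ; 0≤A = 0≤A′ ; 0≤C = +-nonNeg (+-nonNeg (0≤size w) (0≤size w)) (+-nonNeg 0≤A′ 0≤A′)
  ; a≤ = coef-dominated (l ∷ w)
  ; h≤ = h≤
  }
  where
  A = size w
  A′ = size (l ∷ w)
  0≤A′ = 0≤size (l ∷ w)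
  a = coef w
  b = coef (l ∷ w)
  e = step l a

  e≤ : ∀ l → Starts (l ∷ w) → ∀ k → ∣ step l a (suc (suc k)) + step l a k ∣ ≤ A * β k + A * β k
  e≤ ω₀           s k = ∣+∣ {a (suc (suc k))} (ℚ.≤-trans (coef-dominated w (suc (suc k)))
    (*-monoˡ A (0≤size w) (β-antitone (ℕ.m≤n+m k 2)))) (coef-dominated w k)
  e≤ (ω Sign.+ ε) s k = contradiction refl (s ε w)
  -- For σ = -1 the recursion of `geo` reads eₖ₊₂ + eₖ = -2xₖ₊₂: multiplication by 1 + t² clears the
  -- denominator.
  e≤ (ω Sign.- ε) s k = subst (λ y → ∣ y ∣ ≤ A * β k + A * β k)
    (solve 2 (λ x g → (:- x) :- x := (:- (con 1ℚ)) :* (g :+ (x :+ x)) :+ g) refl x (geo Sign.- (delay ε a) k))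
    (∣-∣ { - x} (subst (_≤ A * β k) (sym (ℚ.∣-p∣≡∣p∣ x)) x≤) x≤)
    where
    x  = delay ε a (suc (suc k))
    x≤ = delay-dominated (0≤size w) (coef-dominated w) ε k

  h≤ : ∀ k → ∣ ι (suc (suc k)) * (b (suc (suc k)) + b k) ∣ ≤ (A + A + (A′ + A′)) * β k
  h≤ k = subst₂ (λ x y → ∣ x ∣ ≤ y) (sym eq)
    (solve 3 (λ A A′ b → A :* b :+ A :* b :+ (A′ :* b :+ A′ :* b) := (A :+ A :+ (A′ :+ A′)) :* b) refl A A′ (β k))
    (∣+∣ {e (suc (suc k)) + e k} (e≤ l starts k) (∣+∣ {b k} (coef-dominated (l ∷ w) k) (coef-dominated (l ∷ w) k)))
    where
    open ≡-Reasoning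
    eq : ι (suc (suc k)) * (b (suc (suc k)) + b k) ≡ e (suc (suc k)) + e k + (b k + b k)
    eq = begin
      ι (suc (suc k)) * (b (suc (suc k)) + b k)
        ≡⟨ solve 3 (λ i x y → (con 1ℚ :+ (con 1ℚ :+ i)) :* (x :+ y) :=
             (con 1ℚ :+ (con 1ℚ :+ i)) :* x :+ i :* y :+ (y :+ y)) refl (ι k) (b (suc (suc k))) (b k) ⟩
      θ b (suc (suc k)) + θ b k + (b k + b k)
        ≡⟨ cong₂ (λ x y → x + y + (b k + b k)) (θ-coef l w ends (suc (suc k))) (θ-coef l w ends k) ⟩
      e (suc (suc k)) + e k + (b k + b k) ∎

-- Convergence at t = 1

≤-elim : ∀ {P : ℕ → Set} m → (∀ j → P (m ℕ.+ j)) → ∀ n → m ℕ.≤ n → P n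
≤-elim {P} m p n m≤n = subst P (ℕ.m+[n∸m]≡n m≤n) (p (n ℕ.∸ m))

∣∣-expand : ∀ {c x y} → 1ℚ ≤ c → ∣ c * x ∣ ≤ y → ∣ x ∣ ≤ y
∣∣-expand {c} {x} {y} 1≤c cx≤y = begin
  ∣ x ∣          ≡⟨ ℚ.*-identityˡ ∣ x ∣ ⟨
  1ℚ * ∣ x ∣     ≤⟨ *-monoʳ ∣ x ∣ (ℚ.0≤∣p∣ x) 1≤c ⟩
  c * ∣ x ∣      ≡⟨ cong (_* ∣ x ∣) (ℚ.0≤p⇒∣p∣≡p (ℚ.≤-trans 0≤1 1≤c)) ⟨
  ∣ c ∣ * ∣ x ∣  ≡⟨ ℚ.∣p*q∣≡∣p∣*∣q∣ c x ⟨
  ∣ c * x ∣      ≤⟨ cx≤y ⟩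
  y              ∎
  where open ℚ.≤-Reasoning

0≤q² : ∀ q → 0ℚ ≤ q * q
0≤q² q with ℚ.≤-total 0ℚ q
... | inj₁ 0≤q = *-nonNeg 0≤q 0≤q
... | inj₂ q≤0 = subst (0ℚ ≤_) (solve 1 (λ q → (:- q) :* (:- q) := q :* q) refl q)
  (*-nonNeg (ℚ.neg-antimono-≤ q≤0) (ℚ.neg-antimono-≤ q≤0))

1≤1+q² : ∀ q → 1ℚ ≤ 1ℚ + q * q
1≤1+q² q = ≤-slack (q * q) (0≤q² q) refl

-- Unlike the bounds on a smaller disc, this one depends on n. It serves for a fixed truncation
-- only, and there it reaches up to ∣ q ∣ = 1.
eval-bounded : ∀ n a → ∃[ B ] ∀ q → ∣ q ∣ ≤ 1ℚ → ∣ eval n a q ∣ ≤ B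
eval-bounded zero    a = 0ℚ , λ _ _ → ℚ.≤-refl
eval-bounded (suc n) a =
  let B , b = eval-bounded n (a ∘ suc)
  in ∣ a 0 ∣ + 1ℚ * B , λ q q≤ → ∣+∣ {a 0} ℚ.≤-refl (∣*∣ {q} q≤ (b q q≤))

slope-bounded : ∀ n a → ∃[ B ] ∀ p q → ∣ p ∣ ≤ 1ℚ → ∣ q ∣ ≤ 1ℚ → ∣ slope n a p q ∣ ≤ B
slope-bounded zero    a = 0ℚ , λ _ _ _ _ → ℚ.≤-refl
slope-bounded (suc n) a =
  let A , b = eval-bounded n (a ∘ suc)
      B , s = slope-bounded n (a ∘ suc)
  in A + 1ℚ * B , λ p q p≤ q≤ → ∣+∣ {eval n (a ∘ suc) q} (b q q≤) (∣*∣ {p} p≤ (s p q p≤ q≤))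

eval-telescope : ∀ n {c q} (g : ℕ → ℚ) → (∀ k → ∣ c k ∣ ≤ g k - g (suc k)) → ∣ q ∣ ≤ 1ℚ →
                 ∣ eval n c q ∣ ≤ g 0 - g n
eval-telescope zero            g c≤ q≤ = ℚ.≤-reflexive (sym (ℚ.+-inverseʳ (g 0)))
eval-telescope (suc n) {c} {q} g c≤ q≤ = ℚ.≤-trans
  (∣+∣ {c 0} (c≤ 0) (∣*∣ {q} q≤ (eval-telescope n (g ∘ suc) (c≤ ∘ suc) q≤)))
  (ℚ.≤-reflexive (solve 3 (λ x y z → (x :- y) :+ con 1ℚ :* (y :- z) := x :- z) refl (g 0) (g 1) (g (suc n))))

∣^∣≤1 : ∀ {q} n → ∣ q ∣ ≤ 1ℚ → ∣ q ^ n ∣ ≤ 1ℚ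
∣^∣≤1 n q≤ = ℚ.≤-trans (∣^∣ n q≤) (ℚ.≤-reflexive (1^ n))

∣1∣≤1 : ∣ 1ℚ ∣ ≤ 1ℚ
∣1∣≤1 = ℚ.≤-refl

module _ {a} (ra : Regular a) where
  open Regular ra

  private
    h : Series
    h k = a k + shift (shift a) k

    D : ℚ
    D = A + A + (C + C)

    0≤D : 0ℚ ≤ D
    0≤D = +-nonNeg (+-nonNeg 0≤A 0≤A) (+-nonNeg 0≤C 0≤C)

    eval-h : ∀ n q → eval (2 ℕ.+ n) h q ≡ eval (2 ℕ.+ n) a q + q * (q * eval n a q)
    eval-h n q = trans (eval-+ (2 ℕ.+ n) a (shift (shift a)) q)
      (cong (eval (2 ℕ.+ n) a q +_)
        (solve 2 (λ q x → con 0ℚ :+ q :* (con 0ℚ :+ q :* x) := q :* (q :* x)) refl q (eval n a q)))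

    -- Truncation does not commute with multiplication by 1 + t²: q² times the last two terms of a
    -- is left over. They need not be summable, but they tend to 0 like βₙ.
    residual : ∀ n {q} → ∣ q ∣ ≤ 1ℚ →
               ∣ (1ℚ + q * q) * eval (2 ℕ.+ n) a q - eval (2 ℕ.+ n) h q ∣ ≤ (A + A) * β n
    residual n {q} q≤ = begin
      ∣ (1ℚ + q * q) * E₂ - eval (2 ℕ.+ n) h q ∣
        ≡⟨ cong (λ x → ∣ (1ℚ + q * q) * E₂ - x ∣) (eval-h n q) ⟩
      ∣ (1ℚ + q * q) * E₂ - (E₂ + q * (q * E)) ∣
        ≡⟨ cong ∣_∣ (solve 3 (λ q x y → (con 1ℚ :+ q :* q) :* x :- (x :+ q :* (q :* y))
             := q :* (q :* (x :- y))) refl q E₂ E) ⟩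
      ∣ q * (q * (E₂ - E)) ∣
        ≡⟨ cong (λ x → ∣ q * (q * (x - E)) ∣)
             (trans (eval-suc (suc n) a q) (cong (_+ u′) (eval-suc n a q))) ⟩
      ∣ q * (q * (E + u + u′ - E)) ∣
        ≡⟨ cong (λ x → ∣ q * (q * x) ∣) (solve 3 (λ E u v → E :+ u :+ v :- E := u :+ v) refl E u u′) ⟩
      ∣ q * (q * (u + u′)) ∣
        ≤⟨ ∣*∣ {q} q≤ (∣*∣ {q} q≤ (∣+∣ {u}
             (∣*∣ {a n} (a≤ n) (∣^∣≤1 n q≤))
             (∣*∣ {a (suc n)} (ℚ.≤-trans (a≤ (suc n)) (*-monoˡ A 0≤A (β-suc≤ n))) (∣^∣≤1 (suc n) q≤)))) ⟩
      1ℚ * (1ℚ * (A * β n * 1ℚ + A * β n * 1ℚ))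
        ≡⟨ solve 2 (λ A b → con 1ℚ :* (con 1ℚ :* (A :* b :* con 1ℚ :+ A :* b :* con 1ℚ))
             := (A :+ A) :* b) refl A (β n) ⟩
      (A + A) * β n ∎
      where
      open ℚ.≤-Reasoning
      E₂ = eval (2 ℕ.+ n) a q
      E = eval n a q
      u = a n * q ^ n
      u′ = a (suc n) * q ^ suc n

    -- Since βₖ - βₖ₊₁ = βₖ / (2(k+1)), a bound O(βₖ / k) telescopes. So h is absolutely summable,
    -- with an explicit tail.
    h-bound : ∀ k → ∣ h (2 ℕ.+ k) ∣ ≤ (C + C) * β k - (C + C) * β (suc k)
    h-bound k = begin
      ∣ y ∣
        ≤⟨ *-1/-≤ (0<ι k) (begin
             ι (suc k) * ∣ y ∣        ≤⟨ *-monoʳ {ι (suc k)} {ι (2 ℕ.+ k)} ∣ y ∣ (ℚ.0≤∣p∣ y) (ι-mono (ℕ.n≤1+n (suc k))) ⟩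
             ι (2 ℕ.+ k) * ∣ y ∣      ≡⟨ cong (_* ∣ y ∣) (ℚ.0≤p⇒∣p∣≡p (0≤ι (2 ℕ.+ k))) ⟨
             ∣ ι (2 ℕ.+ k) ∣ * ∣ y ∣  ≡⟨ ℚ.∣p*q∣≡∣p∣*∣q∣ (ι (2 ℕ.+ k)) y ⟨
             ∣ ι (2 ℕ.+ k) * y ∣      ≤⟨ h≤ k ⟩
             C * β k                  ∎) ⟩
      C * β k * 1/suc k
        ≡⟨ solve 3 (λ C b x → C :* b :* x := (C :+ C) :* b :- (C :+ C) :* (b :* (con 1ℚ :- con ½ :* x)))
             refl C (β k) (1/suc k) ⟩
      (C + C) * β k - (C + C) * β (suc k) ∎
      where
      open ℚ.≤-Reasoning
      y = h (2 ℕ.+ k)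

    h-tail : ∀ K n {q} → ∣ q ∣ ≤ 1ℚ → ∣ eval (2 ℕ.+ K ℕ.+ n) h q - eval (2 ℕ.+ K) h q ∣ ≤ (C + C) * β K
    h-tail K n {q} q≤ = begin
      ∣ eval (2 ℕ.+ K ℕ.+ n) h q - x ∣
        ≡⟨ cong ∣_∣ (trans (cong (_- x) (eval-split (2 ℕ.+ K) n h q))
             (solve 2 (λ x y → x :+ y :- x := y) refl x _)) ⟩
      ∣ q ^ (2 ℕ.+ K) * eval n (h ∘ (2 ℕ.+ K ℕ.+_)) q ∣
        ≤⟨ ∣*∣ {q ^ (2 ℕ.+ K)} (∣^∣≤1 (2 ℕ.+ K) q≤) (eval-telescope n g
             (λ j → subst (λ i → ∣ h (2 ℕ.+ (K ℕ.+ j)) ∣ ≤ g j - (C + C) * β i) (sym (ℕ.+-suc K j)) (h-bound (K ℕ.+ j))) q≤) ⟩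
      1ℚ * (g 0 - g n)
        ≤⟨ ≤-slack (g n) (*-nonNeg (+-nonNeg 0≤C 0≤C) (0≤β (K ℕ.+ n)))
             (solve 2 (λ x y → x := con 1ℚ :* (x :- y) :+ y) refl (g 0) (g n)) ⟩
      g 0
        ≡⟨ cong (λ i → (C + C) * β i) (ℕ.+-identityʳ K) ⟩
      (C + C) * β K ∎
      where
      open ℚ.≤-Reasoning
      x = eval (2 ℕ.+ K) h q
      g = λ j → (C + C) * β (K ℕ.+ j)

    -- One fixed polynomial, the truncation of h, approximates (1 + q²) a(q) with an error
    -- independent of both n and q, up to and including q = 1. Convergence at 1 and Abel's theorem
    -- both follow from this.
    eval≈h : ∀ K n {q} → 2 ℕ.+ K ℕ.≤ n → ∣ q ∣ ≤ 1ℚ →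
             ∣ (1ℚ + q * q) * eval n a q - eval (2 ℕ.+ K) h q ∣ ≤ D * β K
    eval≈h K n {q} K≤n q≤ = ≤-elim
      {λ n → ∣ (1ℚ + q * q) * eval n a q - eval (2 ℕ.+ K) h q ∣ ≤ D * β K} (2 ℕ.+ K)
      (λ j → ℚ.≤-trans
        (∣-∣-trans ((1ℚ + q * q) * eval (2 ℕ.+ K ℕ.+ j) a q) (eval (2 ℕ.+ K ℕ.+ j) h q) (eval (2 ℕ.+ K) h q)
          (ℚ.≤-trans (residual (K ℕ.+ j) q≤) (*-monoˡ (A + A) (+-nonNeg 0≤A 0≤A) (β-antitone (ℕ.m≤m+n K j))))
          (h-tail K j q≤))
        (ℚ.≤-reflexive (sym (ℚ.*-distribʳ-+ (β K) (A + A) (C + C)))))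
      n K≤n

  value-cauchy : IsCauchy (λ n → eval n a 1ℚ)
  value-cauchy ε 0<ε =
    let K , small = β-small (half>0 0<ε) 0≤D
        H = eval (2 ℕ.+ K) h 1ℚ
    in 2 ℕ.+ K , λ m n lm ln → let x = eval m a 1ℚ ; y = eval n a 1ℚ in
       ∣∣-expand {1ℚ + 1ℚ} (≤-slack 1ℚ 0≤1 refl) (ℚ.≤-trans
         (subst (λ z → ∣ z ∣ ≤ D * β K + D * β K)
           (solve 2 (λ x y → (con 1ℚ :+ con 1ℚ) :* x :- (con 1ℚ :+ con 1ℚ) :* y := (con 1ℚ :+ con 1ℚ) :* (x :- y)) refl x y)
           (∣-∣-trans ((1ℚ + 1ℚ) * x) H ((1ℚ + 1ℚ) * y) (eval≈h K m {1ℚ} lm ∣1∣≤1)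
             (∣-∣-sym ((1ℚ + 1ℚ) * y) H (eval≈h K n {1ℚ} ln ∣1∣≤1))))
         (ℚ.≤-trans (ℚ.+-mono-≤ small small) (ℚ.≤-reflexive (half+half ε))))

  value : ℝ
  value = (λ n → eval n a 1ℚ) , value-cauchy

  -- The threshold for n is chosen before q. This order is needed because q will be the n-th
  -- approximation to a real number and so varies with n.
  abel : ∀ ε → 0ℚ < ε → ∃[ δ ] 0ℚ < δ × Eventually λ n →
         ∀ q → ∣ q ∣ ≤ 1ℚ → ∣ q - 1ℚ ∣ ≤ δ → ∣ eval n a q - eval n a 1ℚ ∣ ≤ ε
  abel ε 0<ε =
    -- Replacing a by the polynomial H costs ε/4 at q and ε/4 at 1. The remaining ε/2 pays for the
    -- change of H, at most Lδ, and for the change of the factor 1 + q², at most 2Bδ.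
    let K , small = β-small (half>0 (half>0 0<ε)) 0≤D
        L , s     = slope-bounded (2 ℕ.+ K) h
        B , 0<B , e-bound = bound {λ n → eval n a 1ℚ} value-cauchy
        0≤L       = ∣∣≤⇒0≤ {slope (2 ℕ.+ K) h 1ℚ 1ℚ} (s 1ℚ 1ℚ ∣1∣≤1 ∣1∣≤1)
        δ , 0<δ , Lδ≤ = divide (half>0 0<ε) (+-nonNeg 0≤L (ℚ.<⇒≤ (ℚ.+-mono-< 0<B 0<B)))
    in δ , 0<δ , eventually₂
      (λ n K≤n x≤B q q≤ q-1 →
        let x  = eval n a 1ℚ
            y  = eval n a q
            H₁ = eval (2 ℕ.+ K) h 1ℚ
            Hq = eval (2 ℕ.+ K) h q
        in ∣∣-expand {1ℚ + q * q} (1≤1+q² q) (begin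
          ∣ (1ℚ + q * q) * (y - x) ∣
            ≡⟨ cong ∣_∣ (solve 5 (λ q x y u v → (con 1ℚ :+ q :* q) :* (y :- x)
                 := ((con 1ℚ :+ q :* q) :* y :- v) :+ (v :- u)
                      :- ((con 1ℚ :+ con 1ℚ) :* x :- u) :- (q :- con 1ℚ) :* ((q :+ con 1ℚ) :* x)) refl q x y H₁ Hq) ⟩
          ∣ ((1ℚ + q * q) * y - Hq) + (Hq - H₁) - ((1ℚ + 1ℚ) * x - H₁) - (q - 1ℚ) * ((q + 1ℚ) * x) ∣
            ≤⟨ ∣-∣ {((1ℚ + q * q) * y - Hq) + (Hq - H₁) - ((1ℚ + 1ℚ) * x - H₁)}
                 (∣-∣ {((1ℚ + q * q) * y - Hq) + (Hq - H₁)}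
                   (∣+∣ {(1ℚ + q * q) * y - Hq}
                     (ℚ.≤-trans (eval≈h K n K≤n q≤) small)
                     (subst (λ z → ∣ z ∣ ≤ L * δ) (sym (eval-slope (2 ℕ.+ K) h 1ℚ q))
                       (∣*∣ {slope (2 ℕ.+ K) h 1ℚ q} (s 1ℚ q ∣1∣≤1 q≤) q-1)))
                   (ℚ.≤-trans (eval≈h K n {1ℚ} K≤n ∣1∣≤1) small))
                 (∣*∣ {q - 1ℚ} q-1 (∣*∣ {q + 1ℚ} (∣+∣ {q} q≤ ∣1∣≤1) x≤B)) ⟩
          ε * ½ * ½ + L * δ + ε * ½ * ½ + δ * ((1ℚ + 1ℚ) * B)
            ≡⟨ solve 4 (λ e L δ B → e :+ L :* δ :+ e :+ δ :* ((con 1ℚ :+ con 1ℚ) :* B)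
                 := (e :+ e) :+ (L :+ (B :+ B)) :* δ) refl (ε * ½ * ½) L δ B ⟩
          (ε * ½ * ½ + ε * ½ * ½) + (L + (B + B)) * δ
            ≤⟨ ℚ.+-mono-≤ (ℚ.≤-reflexive (half+half (ε * ½))) Lδ≤ ⟩
          ε * ½ + ε * ½
            ≡⟨ half+half ε ⟩
          ε ∎))
      (2 ℕ.+ K , λ n K≤n → K≤n) e-bound
    where open ℚ.≤-Reasoning

-- Values on ]0 , 1[ and their derivatives

private
  variable
    f g h k : ℕ → ℚ

infix 4 _≲_

-- The order of the reals, read on arbitrary rational sequences: absolute values of differences can
-- be compared without first proving them Cauchy. As a record it lets f and g be inferred.
record _≲_ (f g : ℕ → ℚ) : Set where
  constructor ≲-intro
  field
    at : ∀ ε → 0ℚ < ε → Eventually λ n → f n ≤ g n + ε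

open _≲_

eventually⇒≲ : (Eventually λ n → f n ≤ g n) → f ≲ g
eventually⇒≲ {g = g} e = ≲-intro λ ε 0<ε → eventually-map (λ n f≤g → ℚ.≤-trans f≤g (≤-slack {g n} ε (ℚ.<⇒≤ 0<ε) refl)) e

null⇒≲ : ∀ {x} → Null x → (λ n → ∣ x n ∣) ≲ (λ _ → 0ℚ)
null⇒≲ nx = ≲-intro λ ε 0<ε → eventually-map (λ n p → ℚ.≤-trans p (ℚ.≤-reflexive (sym (ℚ.+-identityˡ ε)))) (nx ε 0<ε)

≲-trans : f ≲ g → g ≲ h → f ≲ h
≲-trans {f} {g} {h} p q = ≲-intro λ ε 0<ε → eventually₂
  (λ n a b → ℚ.≤-trans a
  (ℚ.≤-trans (ℚ.+-monoˡ-≤ (ε * ½) b) (ℚ.≤-reflexive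
    (trans (ℚ.+-assoc (h n) _ _) (cong (h n +_) (half+half ε))))))
  (at p _ (half>0 0<ε)) (at q _ (half>0 0<ε))

≲-+ : f ≲ g → h ≲ k → (λ n → f n + h n) ≲ (λ n → g n + k n)
≲-+ {f} {g} {h} {k} p q = ≲-intro λ ε 0<ε → eventually₂
  (λ n a b → ℚ.≤-trans (ℚ.+-mono-≤ a b)
  (ℚ.≤-reflexive (trans
    (solve 3 (λ x y e → x :+ e :+ (y :+ e) := x :+ y :+ (e :+ e)) refl (g n) (k n) (ε * ½))
    (cong (g n + k n +_) (half+half ε)))))
  (at p _ (half>0 0<ε)) (at q _ (half>0 0<ε))

≲-* : ∀ {c} → 0ℚ ≤ c → f ≲ g → (λ n → c * f n) ≲ (λ n → c * g n)
≲-* {f} {g} {c} 0≤c p = ≲-intro λ ε 0<ε →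
  let δ , 0<δ , cδ≤ε = divide 0<ε 0≤c
  in eventually-map (λ n a → ℚ.≤-trans (*-monoˡ c 0≤c a)
       (ℚ.≤-trans (ℚ.≤-reflexive (ℚ.*-distribˡ-+ c (g n) δ)) (ℚ.+-monoʳ-≤ (c * g n) cδ≤ε))) (at p δ 0<δ)

Below : ℚ → 𝕀 → Set
Below ρ t = Eventually λ n → 0ℚ ≤ seq (pt t) n × seq (pt t) n ≤ ρ

eventually-pos : ∀ t → Eventually λ n → 0ℚ ≤ seq (pt t) n
eventually-pos t with 0<pt t
... | ε , 0<ε , e = eventually-map (λ n le → ℚ.≤-trans (ℚ.≤-trans (ℚ.<⇒≤ 0<ε) (ℚ.≤-reflexive (sym (ℚ.+-identityˡ ε)))) le) e

∣∣-below : ∀ {x ρ} → 0ℚ ≤ x × x ≤ ρ → ∣ x ∣ ≤ ρ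
∣∣-below (0≤x , x≤ρ) = ∣∣-nonNeg 0≤x x≤ρ

record Radius (t : 𝕀) : Set where
  field
    {ρ η} : ℚ
    0≤ρ   : 0ℚ ≤ ρ
    0<η   : 0ℚ < η
    ρ+η≤1 : ρ + η ≤ 1ℚ
    below : ∀ s → pt s Real.≤ pt t → Below ρ s

≤ᴿ-refl : ∀ x → x Real.≤ x
≤ᴿ-refl x ε 0<ε = always λ n → ≤-slack {seq x n} ε (ℚ.<⇒≤ 0<ε) refl

radius : ∀ t → Radius t
radius t with pt<1 t
... | η , 0<η , t+η≤1 = record
  { 0≤ρ   = 0≤ρ
  ; 0<η   = half>0 0<η
  ; ρ+η≤1 = ℚ.≤-reflexive (solve 1 (λ h → con 1ℚ :- h :+ h := con 1ℚ) refl (η * ½))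
  ; below = below
  }
  where
  -- Half of the gap η absorbs the error in s ≤ t, which holds only approximately at each index; the
  -- other half keeps ρ below 1.
  ρ = 1ℚ - η * ½
  below : ∀ s → pt s Real.≤ pt t → Below ρ s
  below s s≤t = eventually₂ (λ n → _,_) (eventually-pos s) (eventually₂
    {P = λ n → seq (pt s) n ≤ seq (pt t) n + η * ½}
    (λ n s≤ t≤ → ℚ.≤-trans s≤ (≤-slack (1ℚ - (seq (pt t) n + η)) (slack t≤)
      (solve 2 (λ t η → con 1ℚ :- η :* con ½ := t :+ η :* con ½ :+ (con 1ℚ :- (t :+ η))) refl (seq (pt t) n) η)))
    (s≤t (η * ½) (half>0 0<η)) t+η≤1)
  0≤ρ : 0ℚ ≤ ρ
  0≤ρ = eventually-const (eventually-map (λ n b → ℚ.≤-trans (proj₁ b) (proj₂ b)) (below t (≤ᴿ-refl (pt t))))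

below-self : ∀ {t} (r : Radius t) → Below (Radius.ρ r) t
below-self {t} r = Radius.below r t (≤ᴿ-refl (pt t))

-- On the diagonal both the number of terms and the argument move. Comparison with the fixed
-- truncation `N₁` separates them: two geometric tails of ε/4 each, and ε/2 for Lipschitz continuity
-- of one polynomial.
eval-cauchy : ∀ {a A} → 0ℚ ≤ A → (∀ k → ∣ a k ∣ ≤ A) → ∀ t → IsCauchy (λ n → eval n a (seq (pt t) n))
eval-cauchy {a} {A} 0≤A a≤ t ε 0<ε =
  let r = radius t
      open Radius r
      open Disc 0≤ρ 0<η ρ+η≤1
      q = seq (pt t)
      δ₁ , 0<δ₁ , small₁ = divide (half>0 (half>0 0<ε)) (0≤A/η 0≤A)
      δ₂ , 0<δ₂ , small₂ = divide (half>0 0<ε) (0≤Lip 0≤A)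
      N₁ , tail = ^-null 0≤ρ 0<η ρ+η≤1 δ₁ 0<δ₁
      N₂ , close = cauchy (pt t) δ₂ 0<δ₂
      N₃ , q≤ρ = below-self r
      N = N₁ ℕ.⊔ (N₂ ℕ.⊔ N₃)
      N₁≤ = λ {i} (le : N ℕ.≤ i) → ℕ.≤-trans (ℕ.m≤m⊔n N₁ (N₂ ℕ.⊔ N₃)) le
      N₂≤ = λ {i} (le : N ℕ.≤ i) → ℕ.≤-trans (ℕ.m≤m⊔n N₂ N₃) (ℕ.≤-trans (ℕ.m≤n⊔m N₁ (N₂ ℕ.⊔ N₃)) le)
      N₃≤ = λ {i} (le : N ℕ.≤ i) → ℕ.≤-trans (ℕ.m≤n⊔m N₂ N₃) (ℕ.≤-trans (ℕ.m≤n⊔m N₁ (N₂ ℕ.⊔ N₃)) le)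
      near = λ i (le : N ℕ.≤ i) → ≤-elim {λ m → ∣ eval m a (q i) - eval N₁ a (q i) ∣ ≤ ε * ½ * ½} N₁
        (λ j → ℚ.≤-trans (eval-tail 0≤A N₁ j a≤ (∣∣-below (q≤ρ i (N₃≤ le))))
          (ℚ.≤-trans (ℚ.≤-reflexive (ℚ.*-comm (ρ ^ N₁) (A * η⁻¹)))
            (ℚ.≤-trans (*-monoˡ (A * η⁻¹) (0≤A/η 0≤A) (ℚ.≤-trans (x≤∣x∣ (ρ ^ N₁)) (tail N₁ ℕ.≤-refl))) small₁)))
        i (N₁≤ le)
  in N , λ m n lm ln → ℚ.≤-trans
    (∣-∣-trans (eval m a (q m)) (eval N₁ a (q m)) (eval n a (q n)) (near m lm)
      (∣-∣-trans (eval N₁ a (q m)) (eval N₁ a (q n)) (eval n a (q n))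
        (ℚ.≤-trans (eval-lipschitz 0≤A N₁ a≤ (∣∣-below (q≤ρ n (N₃≤ ln))) (∣∣-below (q≤ρ m (N₃≤ lm)))
          (close m n (N₂≤ lm) (N₂≤ ln))) small₂)
        (∣-∣-sym (eval n a (q n)) (eval N₁ a (q n)) (near n ln))))
    (ℚ.≤-reflexive (trans (solve 1 (λ e → e :* con ½ :+ (e :+ e :* con ½) := (e :* con ½ :+ e :* con ½) :+ e) refl (ε * ½))
      (trans (cong (_+ ε * ½) (half+half (ε * ½))) (half+half ε))))

antiderivative : Word → 𝕀 → ℝ
antiderivative w t = (λ n → eval n (coef w) (seq (pt t) n))
  , eval-cauchy (0≤size w) (dominated⇒bounded (0≤size w) (coef-dominated w)) t

recip-inverse : ∀ x (0<x : 0ℝ Real.< x) → Eventually λ n → seq x n * seq (recip x 0<x) n ≡ 1ℚ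
recip-inverse x (ε , 0<ε , e) = eventually-map (λ n ε≤x → trans
  (cong (_* 1/[ clamp>0 0<ε (seq x n) ])
    (sym (ℚ.p≥q⇒p⊔q≡p (ℚ.≤-trans (ℚ.≤-reflexive (sym (ℚ.+-identityˡ ε))) ε≤x))))
  (*-1/ (clamp>0 0<ε (seq x n)))) e

-- t f(t) = numerator / cofactor. Stating facts about the density in multiplied-out form avoids
-- `recip`, which is a true inverse only from some index on.
cofactor numerator : Letter → ℚ → ℚ
cofactor ω₀      q = 1ℚ
cofactor (ω σ ε) q = 1ℚ - sgn σ * (q * q)
numerator ω₀           q = 1ℚ
numerator (ω σ Sign.-) q = sgn σ * ((1ℚ + 1ℚ) * q)
numerator (ω σ Sign.+) q = sgn σ * ((1ℚ + 1ℚ) * (q * q))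

density-spec : ∀ l t → Eventually λ n → let q = seq (pt t) n in
               q * cofactor l q * seq (density l t) n ≡ numerator l q
density-spec ω₀ t = eventually-map (λ n eq → trans (cong (_* seq (density ω₀ t) n) (ℚ.*-identityʳ (seq (pt t) n))) eq) (recip-inverse (pt t) (0<pt t))
density-spec (ω Sign.+ Sign.-) t = eventually-map (λ n eq → trans
  (solve 2 (λ q r → q :* (con 1ℚ :- con 1ℚ :* (q :* q)) :* ((con 1ℚ :+ con 1ℚ) :* r)
    := (con 1ℚ :+ con 1ℚ) :* q :* ((con 1ℚ :- q :* q) :* r)) refl (seq (pt t) n) _)
  (trans (cong ((1ℚ + 1ℚ) * seq (pt t) n *_) eq) (solve 1 (λ q → q :* con 1ℚ := con 1ℚ :* q) refl ((1ℚ + 1ℚ) * seq (pt t) n))))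
  (recip-inverse (1ℝ -ᴿ pt t Real.* pt t) (1-t²>0 t))
density-spec (ω Sign.- Sign.-) t = eventually-map (λ n eq → trans
  (solve 2 (λ q r → q :* (con 1ℚ :- (:- con 1ℚ) :* (q :* q)) :* ((:- (con 1ℚ :+ con 1ℚ)) :* r)
    := (:- (con 1ℚ :+ con 1ℚ)) :* q :* ((con 1ℚ :+ q :* q) :* r)) refl (seq (pt t) n) _)
  (trans (cong ((- (1ℚ + 1ℚ)) * seq (pt t) n *_) eq)
    (solve 1 (λ q → (:- (con 1ℚ :+ con 1ℚ)) :* q :* con 1ℚ := (:- con 1ℚ) :* ((con 1ℚ :+ con 1ℚ) :* q)) refl (seq (pt t) n))))
  (recip-inverse (1ℝ +ᴿ pt t Real.* pt t) (1+t²>0 t))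
density-spec (ω Sign.+ Sign.+) t = eventually-map (λ n eq → trans
  (solve 2 (λ q r → q :* (con 1ℚ :- con 1ℚ :* (q :* q)) :* ((con 1ℚ :+ con 1ℚ) :* q :* r)
    := (con 1ℚ :+ con 1ℚ) :* (q :* q) :* ((con 1ℚ :- q :* q) :* r)) refl (seq (pt t) n) _)
  (trans (cong ((1ℚ + 1ℚ) * (seq (pt t) n * seq (pt t) n) *_) eq)
    (solve 1 (λ q → q :* con 1ℚ := con 1ℚ :* q) refl ((1ℚ + 1ℚ) * (seq (pt t) n * seq (pt t) n)))))
  (recip-inverse (1ℝ -ᴿ pt t Real.* pt t) (1-t²>0 t))
density-spec (ω Sign.- Sign.+) t = eventually-map (λ n eq → trans
  (solve 2 (λ q r → q :* (con 1ℚ :- (:- con 1ℚ) :* (q :* q)) :* ((:- (con 1ℚ :+ con 1ℚ)) :* q :* r)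
    := (:- (con 1ℚ :+ con 1ℚ)) :* (q :* q) :* ((con 1ℚ :+ q :* q) :* r)) refl (seq (pt t) n) _)
  (trans (cong ((- (1ℚ + 1ℚ)) * (seq (pt t) n * seq (pt t) n) *_) eq)
    (solve 1 (λ q → (:- (con 1ℚ :+ con 1ℚ)) :* q :* con 1ℚ := (:- con 1ℚ) :* ((con 1ℚ :+ con 1ℚ) :* q)) refl (seq (pt t) n * seq (pt t) n))))
  (recip-inverse (1ℝ +ᴿ pt t Real.* pt t) (1+t²>0 t))

cofactor>0 : ∀ l t → ∃[ c ] 0ℚ < c × Eventually λ n → c ≤ cofactor l (seq (pt t) n)
cofactor>0 ω₀ t = 1ℚ , 0<1 , always λ _ → ℚ.≤-refl
cofactor>0 (ω Sign.+ ε) t =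
  let c , 0<c , e = 1-t²>0 t
  in c , 0<c , eventually-map (λ n le → subst₂ _≤_ (ℚ.+-identityˡ c)
       (solve 1 (λ q → con 1ℚ :- q :* q := con 1ℚ :- con 1ℚ :* (q :* q)) refl (seq (pt t) n)) le) e
cofactor>0 (ω Sign.- ε) t =
  let c , 0<c , e = 1+t²>0 t
  in c , 0<c , eventually-map (λ n le → subst₂ _≤_ (ℚ.+-identityˡ c)
       (solve 1 (λ q → con 1ℚ :+ q :* q := con 1ℚ :- (:- con 1ℚ) :* (q :* q)) refl (seq (pt t) n)) le) e

null-cancel : ∀ {c} {d x : ℕ → ℚ} → 0ℚ < c → (Eventually λ n → c ≤ d n) → Null (λ n → d n * x n) → Null x
null-cancel {c} {d} {x} 0<c c≤d ndx ε 0<ε = eventually₂ {P = λ n → c ≤ d n} {Q = λ n → ∣ d n * x n ∣ ≤ c * ε}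
  (λ n c≤ dx → *-cancelˡ c 0<c (begin
    c * ∣ x n ∣          ≤⟨ *-monoʳ ∣ x n ∣ (ℚ.0≤∣p∣ (x n)) c≤ ⟩
    d n * ∣ x n ∣        ≡⟨ cong (_* ∣ x n ∣) (ℚ.0≤p⇒∣p∣≡p (ℚ.≤-trans (ℚ.<⇒≤ 0<c) c≤)) ⟨
    ∣ d n ∣ * ∣ x n ∣    ≡⟨ ℚ.∣p*q∣≡∣p∣*∣q∣ (d n) (x n) ⟨
    ∣ d n * x n ∣        ≤⟨ dx ⟩
    c * ε                ∎))
  c≤d (ndx (c * ε) (*-pos 0<c 0<ε))
  where open ℚ.≤-Reasoning

eval-suc-suc : ∀ n (a : Series) q → eval (2 ℕ.+ n) a q - eval n a q ≡ a n * q ^ n + a (suc n) * q ^ suc n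
eval-suc-suc n a q = trans (cong (_- eval n a q) (trans (eval-suc (suc n) a q)
  (cong (_+ a (suc n) * q ^ suc n) (eval-suc n a q))))
  (solve 3 (λ x u v → x :+ u :+ v :- x := u :+ v) refl (eval n a q) (a n * q ^ n) (a (suc n) * q ^ suc n))

∑β≤ι : ∀ k → ∑β k ≤ ι k
∑β≤ι zero    = ℚ.≤-refl
∑β≤ι (suc k) = ℚ.≤-trans (ℚ.+-mono-≤ (∑β≤ι k) (β≤1 k)) (ℚ.≤-reflexive (ℚ.+-comm (ι k) 1ℚ))

module _ {a A ρ} (0≤A : 0ℚ ≤ A) (a≤ : Dominated A a) (0≤ρ : 0ℚ ≤ ρ) (ρ≤1 : ρ ≤ 1ℚ) where
  private
    T : ℕ → ℚ
    T n = ι (suc n) * ρ ^ n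

    0≤T : ∀ n → 0ℚ ≤ T n
    0≤T n = *-nonNeg (0≤ι (suc n)) (^-nonNeg n 0≤ρ)

    last-terms : ∀ {b : Series} {B q} → (∀ k → ∣ b k ∣ ≤ B * ι (suc k)) → ∣ q ∣ ≤ ρ → ∀ n →
                 ∣ b n * q ^ n + b (suc n) * q ^ suc n ∣ ≤ B * (T n + T (suc n))
    last-terms {b} {B} {q} b≤ q≤ n = ℚ.≤-trans
      (∣+∣ {b n * q ^ n} (∣*∣ {b n} (b≤ n) (∣^∣ n q≤)) (∣*∣ {b (suc n)} (b≤ (suc n)) (∣^∣ (suc n) q≤)))
      (ℚ.≤-reflexive (solve 5 (λ B i j p r → B :* i :* p :+ B :* j :* r := B :* (i :* p :+ j :* r))
        refl B (ι (suc n)) (ι (suc (suc n))) (ρ ^ n) (ρ ^ suc n)))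

    a-linear : ∀ k → ∣ a k ∣ ≤ A * ι (suc k)
    a-linear k = ℚ.≤-trans (a≤ k) (*-monoˡ A 0≤A (ℚ.≤-trans (β≤1 k) (≤-slack (ι k) (0≤ι k) refl)))

    -- Inside the disc the decay of n ρⁿ is enough, so the weights β are given up for linear growth.
    geo-linear : ∀ σ ε k → ∣ geo σ (delay ε a) k ∣ ≤ (A + A) * ι (suc k)
    geo-linear σ ε k = ℚ.≤-trans (geo-dominated 0≤A a≤ σ ε k) (*-monoˡ (A + A) (+-nonNeg 0≤A 0≤A)
      (ℚ.≤-trans (∑β≤ι k) (≤-slack 1ℚ 0≤1 (ℚ.+-comm 1ℚ (ι k)))))

    monomial : Sign → ℚ → ℚ
    monomial Sign.- q = q
    monomial Sign.+ q = q * q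

    module _ {q} (q≤ : ∣ q ∣ ≤ ρ) (n : ℕ) where
      ∣q∣≤1 : ∣ q ∣ ≤ 1ℚ
      ∣q∣≤1 = ℚ.≤-trans q≤ ρ≤1

      τ : ℚ
      τ = T n + T (suc n)

      delay-error : ∀ ε → ∣ eval (2 ℕ.+ n) (delay ε a) q - monomial ε q * eval (2 ℕ.+ n) a q ∣ ≤ A * τ
      delay-error Sign.- = begin
        ∣ 0ℚ + q * eval (suc n) a q - q * eval (2 ℕ.+ n) a q ∣
          ≡⟨ cong (λ x → ∣ 0ℚ + q * eval (suc n) a q - q * x ∣) (eval-suc (suc n) a q) ⟩
        ∣ 0ℚ + q * x - q * (x + u) ∣
          ≡⟨ trans (cong ∣_∣ (solve 3 (λ q x u → con 0ℚ :+ q :* x :- q :* (x :+ u) := :- (q :* u)) refl q x u)) (ℚ.∣-p∣≡∣p∣ (q * u)) ⟩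
        ∣ q * u ∣
          ≤⟨ ∣*∣ {q} ∣q∣≤1 (∣*∣ {a (suc n)} (a-linear (suc n)) (∣^∣ (suc n) q≤)) ⟩
        1ℚ * (A * ι (suc (suc n)) * ρ ^ suc n)
          ≤⟨ ≤-slack (A * T n) (*-nonNeg 0≤A (0≤T n))
               (solve 4 (λ A t i p → A :* (t :+ i :* p) := con 1ℚ :* (A :* i :* p) :+ A :* t)
                 refl A (T n) (ι (suc (suc n))) (ρ ^ suc n)) ⟩
        A * τ ∎
        where
        open ℚ.≤-Reasoning
        x = eval (suc n) a q
        u = a (suc n) * q ^ suc n
      delay-error Sign.+ = begin
        ∣ 0ℚ + q * (0ℚ + q * eval n a q) - q * q * eval (2 ℕ.+ n) a q ∣
          ≡⟨ trans (cong ∣_∣ (solve 3 (λ q x y → con 0ℚ :+ q :* (con 0ℚ :+ q :* x) :- q :* q :* y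
               := :- (q :* (q :* (y :- x)))) refl q (eval n a q) (eval (2 ℕ.+ n) a q))) (ℚ.∣-p∣≡∣p∣ _) ⟩
        ∣ q * (q * (eval (2 ℕ.+ n) a q - eval n a q)) ∣
          ≤⟨ ∣*∣ {q} ∣q∣≤1 (∣*∣ {q} ∣q∣≤1 (subst (λ x → ∣ x ∣ ≤ A * τ) (sym (eval-suc-suc n a q)) (last-terms {B = A} a-linear q≤ n))) ⟩
        1ℚ * (1ℚ * (A * τ))
          ≡⟨ trans (ℚ.*-identityˡ _) (ℚ.*-identityˡ _) ⟩
        A * τ ∎
        where open ℚ.≤-Reasoning

      -- As power series, cofactor · step(a) and numerator · a agree. Truncation leaves only top
      -- terms: 2Aτ from the two copies of the delayed series and 2Aτ from q² (E₂ - E).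
      step-error : ∀ l → ∣ cofactor l q * eval (2 ℕ.+ n) (step l a) q - numerator l q * eval (2 ℕ.+ n) a q ∣
                         ≤ (A + A + (A + A)) * τ
      step-error ω₀ = ℚ.≤-trans (ℚ.≤-reflexive (cong ∣_∣ (ℚ.+-inverseʳ (1ℚ * eval (2 ℕ.+ n) a q))))
        (*-nonNeg (+-nonNeg (+-nonNeg 0≤A 0≤A) (+-nonNeg 0≤A 0≤A)) (+-nonNeg (0≤T n) (0≤T (suc n))))
      step-error (ω σ ε) = begin
        ∣ (1ℚ - s * (q * q)) * E₂ - numerator (ω σ ε) q * Y ∣
          ≡⟨ cong₂ (λ x y → ∣ x - y * Y ∣)
               (trans (solve 3 (λ s q e → (con 1ℚ :- s :* (q :* q)) :* e := e :- s :* (q :* q) :* e) refl s q E₂)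
                 (cong (_- s * (q * q) * E₂) E₂-eq)) (numerator-eq ε) ⟩
        ∣ s * (q * (q * E) + (X + X)) - s * (q * q) * E₂ - s * ((1ℚ + 1ℚ) * monomial ε q) * Y ∣
          ≡⟨ cong ∣_∣ (solve 7 (λ s q e x e₂ m y → s :* (q :* (q :* e) :+ (x :+ x)) :- s :* (q :* q) :* e₂
               :- s :* ((con 1ℚ :+ con 1ℚ) :* m) :* y
               := s :* (((x :- m :* y) :+ (x :- m :* y)) :- q :* (q :* (e₂ :- e)))) refl s q E X E₂ (monomial ε q) Y) ⟩
        ∣ s * (((X - monomial ε q * Y) + (X - monomial ε q * Y)) - q * (q * (E₂ - E))) ∣
          ≤⟨ ∣*∣ {s} (∣sgn∣≤1 σ) (∣-∣ {(X - monomial ε q * Y) + (X - monomial ε q * Y)}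
               (∣+∣ {X - monomial ε q * Y} (delay-error ε) (delay-error ε))
               (∣*∣ {q} ∣q∣≤1 (∣*∣ {q} ∣q∣≤1 (subst (λ x → ∣ x ∣ ≤ (A + A) * τ)
                 (sym (eval-suc-suc n (geo σ (delay ε a)) q)) (last-terms {B = A + A} (geo-linear σ ε) q≤ n))))) ⟩
        1ℚ * ((A * τ + A * τ) + 1ℚ * (1ℚ * ((A + A) * τ)))
          ≡⟨ solve 2 (λ A τ → con 1ℚ :* ((A :* τ :+ A :* τ) :+ con 1ℚ :* (con 1ℚ :* ((A :+ A) :* τ)))
               := (A :+ A :+ (A :+ A)) :* τ) refl A τ ⟩
        (A + A + (A + A)) * τ ∎
        where
        open ℚ.≤-Reasoning
        s = sgn σ
        x = delay ε a
        e = geo σ x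
        E = eval n e q
        E₂ = eval (2 ℕ.+ n) e q
        X = eval (2 ℕ.+ n) x q
        Y = eval (2 ℕ.+ n) a q
        numerator-eq : ∀ ε → numerator (ω σ ε) q ≡ s * ((1ℚ + 1ℚ) * monomial ε q)
        numerator-eq Sign.- = refl
        numerator-eq Sign.+ = refl
        E₂-eq : E₂ ≡ s * (q * (q * E) + (X + X))
        E₂-eq = trans (eval-cong (2 ℕ.+ n) q (geo-eq σ x)) (trans (eval-* (2 ℕ.+ n) s (λ k → shift (shift e) k + (x k + x k)) q)
          (cong (s *_) (trans (eval-+ (2 ℕ.+ n) (shift (shift e)) (λ k → x k + x k) q)
            (cong₂ _+_ (solve 2 (λ q z → con 0ℚ :+ q :* (con 0ℚ :+ q :* z) := q :* (q :* z)) refl q E)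
              (eval-+ (2 ℕ.+ n) x x q)))))

  step-null : ∀ {η} → 0ℚ < η → ρ + η ≤ 1ℚ → ∀ l {q : ℕ → ℚ} → (Eventually λ n → ∣ q n ∣ ≤ ρ) →
              Null (λ n → cofactor l (q n) * eval n (step l a) (q n) - numerator l (q n) * eval n a (q n))
  step-null {η} 0<η ρ+η≤1 l {q} (N , q≤) ε 0<ε =
    let δ , 0<δ , small = divide 0<ε (+-nonNeg (+-nonNeg 0≤A 0≤A) (+-nonNeg 0≤A 0≤A))
    in eventually-shift 2 (eventually₂
      (λ n p τ≤ → ℚ.≤-trans (step-error p n l)
        (ℚ.≤-trans (*-monoˡ _ (+-nonNeg (+-nonNeg 0≤A 0≤A) (+-nonNeg 0≤A 0≤A)) (ℚ.≤-trans (x≤∣x∣ _) τ≤)) small))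
      (N , λ n N≤n → q≤ (2 ℕ.+ n) (ℕ.≤-trans N≤n (ℕ.m≤n+m n 2)))
      (T+T-null δ 0<δ))
    where
    T-null : Null T
    T-null = null-cong (always λ n → solve 2 (λ i p → p :+ i :* p := (con 1ℚ :+ i) :* p) refl (ι n) (ρ ^ n))
      (null-+ (^-null 0≤ρ 0<η ρ+η≤1) (ι*^-null 0≤ρ 0<η ρ+η≤1))
    T+T-null : Null (λ n → T n + T (suc n))
    T+T-null = null-+ T-null λ ε 0<ε → let N , p = T-null ε 0<ε in N , λ n N≤n → p (suc n) (ℕ.m≤n⇒m≤1+n N≤n)

-- The factor q · cofactor is bounded away from 0, so it may be multiplied in. Then `density-spec`
-- removes the reciprocal, `*-slope` turns q F′ into θF, and up to sign the difference is the
-- truncation error of `step-null`.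
derivative-null : ∀ l w → Ends (l ∷ w) → ∀ t →
                  Null (λ n → let q = seq (pt t) n in
                    seq (density l t Real.* antiderivative w t) n - slope n (coef (l ∷ w)) q q)
derivative-null l w ends t =
  let r = radius t
      open Radius r
      q = seq (pt t)
      ε , 0<ε , q≥ = 0<pt t
      c , 0<c , cof≥ = cofactor>0 l t
      ρ≤1 = ℚ.≤-trans (≤-slack {ρ} η (ℚ.<⇒≤ 0<η) refl) ρ+η≤1
      err = step-null (0≤size w) (coef-dominated w) 0≤ρ ρ≤1 0<η ρ+η≤1 l
              (eventually-map (λ n → ∣∣-below) (below-self r))
  in null-cancel (*-pos 0<ε 0<c)
       (eventually₂ (λ n q≥ c≤ → *-mono-≤ (ℚ.≤-trans (ℚ.<⇒≤ 0<ε) (subst (_≤ q n) (ℚ.+-identityˡ ε) q≥)) (ℚ.<⇒≤ 0<c)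
         (subst (_≤ q n) (ℚ.+-identityˡ ε) q≥) c≤) q≥ cof≥)
       (null-cong (eventually-map (λ n spec → sym (identity n spec)) (density-spec l t))
         (null-*ˡ {y = λ _ → - 1ℚ} {C = 1ℚ} (always λ _ → ℚ.≤-refl) err))
  where
  identity : ∀ n → let q = seq (pt t) n in
    q * cofactor l q * seq (density l t) n ≡ numerator l q →
    q * cofactor l q * (seq (density l t) n * eval n (coef w) q - slope n (coef (l ∷ w)) q q)
      ≡ (- 1ℚ) * (cofactor l q * eval n (step l (coef w)) q - numerator l q * eval n (coef w) q)
  identity n spec = begin
    q * c * (d * y - s)
      ≡⟨ solve 5 (λ q c d y s → q :* c :* (d :* y :- s) := q :* c :* d :* y :- c :* (q :* s)) refl q c d y s ⟩
    q * c * d * y - c * (q * s)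
      ≡⟨ cong₂ (λ u v → u * y - c * v) spec
           (trans (*-slope n (coef (l ∷ w)) q) (eval-cong n q (θ-coef l w ends))) ⟩
    numerator l q * y - c * e
      ≡⟨ solve 2 (λ u v → u :- v := (:- con 1ℚ) :* (v :- u)) refl (numerator l q * y) (c * e) ⟩
    (- 1ℚ) * (c * e - numerator l q * y) ∎
    where
    open ≡-Reasoning
    q = seq (pt t) n
    c = cofactor l q
    d = seq (density l t) n
    y = eval n (coef w) q
    s = slope n (coef (l ∷ w)) q q
    e = eval n (step l (coef w)) q

-- Riemann integrals

∣∣≲ : ∀ {x g} → x ≲ g → (λ n → - x n) ≲ g → (λ n → ∣ x n ∣) ≲ g
∣∣≲ p q = ≲-intro λ ε 0<ε → eventually₂ (λ n → ∣∣-intro) (at p ε 0<ε) (at q ε 0<ε)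

both : ∀ {P Q : ℕ → Set} → Eventually P → Eventually Q → Eventually (λ n → P n × Q n)
both = eventually₂ (λ n p q → p , q)

within : ∀ {ε x y} → (λ n → ∣ seq x n - seq y n ∣) ≲ (λ _ → ε) → Within ε x y
within {ε} {x} {y} p =
    (λ η 0<η → eventually-map (λ n → ℚ.≤-trans (x≤∣x∣ (seq x n - seq y n))) (at p η 0<η))
  , (λ η 0<η → eventually-map (λ n le → ℚ.≤-trans
      (subst (_≤ ∣ seq x n - seq y n ∣) (solve 2 (λ x y → :- (x :- y) := y :- x) refl (seq x n) (seq y n))
        (-x≤∣x∣ (seq x n - seq y n))) le) (at p η 0<η))

≈⇒≤ : ∀ {x y} → x Real.≈ y → x Real.≤ y
≈⇒≤ {x} {y} x≈y ε 0<ε = eventually-map (λ n p → ≤-slack (ε - (seq x n - seq y n))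
    (slack (ℚ.≤-trans (x≤∣x∣ (seq x n - seq y n)) p))
    (solve 3 (λ x y e → y :+ e := x :+ (e :- (x :- y))) refl (seq x n) (seq y n) ε)) (x≈y ε 0<ε)

≤ᴿ-trans : ∀ {x y z : ℝ} → x Real.≤ y → y Real.≤ z → x Real.≤ z
≤ᴿ-trans {x} {y} {z} x≤y y≤z = at (≲-trans {seq x} {seq y} {seq z} (≲-intro x≤y) (≲-intro y≤z))

<⇒≤ᴿ : ∀ {x y} → x Real.< y → x Real.≤ y
<⇒≤ᴿ {x} {y} (ε , 0<ε , e) = at (eventually⇒≲ (eventually-map (λ n → ℚ.≤-trans
  (≤-slack {seq x n} ε (ℚ.<⇒≤ 0<ε) refl)) e))

⊓-pos : ∀ {p q} → 0ℚ < p → 0ℚ < q → 0ℚ < p ℚ.⊓ q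
⊓-pos {p} {q} 0<p 0<q with ℚ.≤-total p q
... | inj₁ p≤q = subst (0ℚ <_) (sym (ℚ.p≤q⇒p⊓q≡p p≤q)) 0<p
... | inj₂ q≤p = subst (0ℚ <_) (sym (ℚ.p≥q⇒p⊓q≡q q≤p)) 0<q

partition-≤ : ∀ {δ s y} → Partition δ s y → pt s Real.≤ pt y
partition-≤ {s = s} {y} (end s≈y) = ≈⇒≤ {pt s} {pt y} s≈y
partition-≤ {s = s} {y} (cell tag m s≤tag tag≤m _ π) = ≤ᴿ-trans {pt s} {pt m} {pt y}
  (≤ᴿ-trans {pt s} {pt tag} {pt m} s≤tag tag≤m) (partition-≤ π)

length≤1 : ∀ s y → Eventually λ n → seq (pt y) n - seq (pt s) n ≤ 1ℚ
length≤1 s y with pt<1 y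
... | η , 0<η , e = eventually₂ (λ n 0≤s y+η≤1 → ≤-slack
    ((1ℚ - (seq (pt y) n + η)) + η + seq (pt s) n) (+-nonNeg (+-nonNeg (slack y+η≤1) (ℚ.<⇒≤ 0<η)) 0≤s)
    (solve 3 (λ y s h → con 1ℚ := y :- s :+ ((con 1ℚ :- (y :+ h)) :+ h :+ s)) refl (seq (pt y) n) (seq (pt s) n) η))
  (eventually-pos s) e

-- f is the derivative of F on ]0 , y], uniformly: a cell of length at most δ contributes
-- an error at most Kδ times its length.
record UniformDerivative (F f : 𝕀 → ℝ) (y : 𝕀) : Set where
  field
    K     : ℚ
    0≤K   : 0ℚ ≤ K
    close : ∀ s → pt s Real.≈ pt y → (λ n → ∣ seq (F y) n - seq (F s) n ∣) ≲ (λ _ → 0ℚ)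
    error : ∀ {δ} → 0ℚ < δ → ∀ s r m → pt s Real.≤ pt r → pt r Real.≤ pt m → pt m Real.≤ pt y →
            pt m -ᴿ pt s Real.≤ fromℚ δ →
            (λ n → ∣ seq (f r) n * (seq (pt m) n - seq (pt s) n) - (seq (F m) n - seq (F s) n) ∣)
              ≲ (λ n → K * δ * (seq (pt m) n - seq (pt s) n))

  riemannSum-error : ∀ {δ s} → 0ℚ < δ → (π : Partition δ s y) →
    (λ n → ∣ seq (riemannSum f π) n - (seq (F y) n - seq (F s) n) ∣)
      ≲ (λ n → K * δ * (seq (pt y) n - seq (pt s) n))
  -- An empty partition gives only s ≈ y, so F has to respect this equality. The bound K δ (y - s)
  -- may be negative at single indices, but it is ≈ 0.
  riemannSum-error {δ} {s} 0<δ (end s≈y) = ≲-trans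
    (≲-trans (eventually⇒≲ (always λ n → ℚ.≤-reflexive (trans
        (cong ∣_∣ (ℚ.+-identityˡ (- (seq (F y) n - seq (F s) n)))) (ℚ.∣-p∣≡∣p∣ (seq (F y) n - seq (F s) n)))))
      (close s s≈y))
    (≲-trans
      (eventually⇒≲ (always λ n → ℚ.≤-reflexive (sym (ℚ.*-zeroʳ (K * δ)))))
      (≲-* 0≤Kδ (≲-intro λ ε 0<ε → eventually-map (λ n p →
          ≤-slack (seq (pt y) n + ε - seq (pt s) n) (slack p)
            (solve 3 (λ y s e → y :- s :+ e := con 0ℚ :+ (y :+ e :- s)) refl (seq (pt y) n) (seq (pt s) n) ε))
        (≈⇒≤ {pt s} {pt y} s≈y ε 0<ε))))
    where
    0≤Kδ = *-nonNeg 0≤K (ℚ.<⇒≤ 0<δ)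
  riemannSum-error {δ} {s} 0<δ (cell r m s≤r r≤m m-s≤δ π) = ≲-trans
    (≲-trans
      (eventually⇒≲ (always λ n → let open ℚ.≤-Reasoning in begin
        ∣ seq (f r) n * (seq (pt m) n - seq (pt s) n) + seq (riemannSum f π) n - (seq (F y) n - seq (F s) n) ∣
          ≡⟨ cong ∣_∣ (solve 5 (λ c S y s m → c :+ S :- (y :- s) := (c :- (m :- s)) :+ (S :- (y :- m)))
               refl (seq (f r) n * (seq (pt m) n - seq (pt s) n)) (seq (riemannSum f π) n)
               (seq (F y) n) (seq (F s) n) (seq (F m) n)) ⟩
        ∣ (seq (f r) n * (seq (pt m) n - seq (pt s) n) - (seq (F m) n - seq (F s) n))
          + (seq (riemannSum f π) n - (seq (F y) n - seq (F m) n)) ∣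
          ≤⟨ ℚ.∣p+q∣≤∣p∣+∣q∣ (seq (f r) n * (seq (pt m) n - seq (pt s) n) - (seq (F m) n - seq (F s) n)) _ ⟩
        _ ∎))
      (≲-+ (error 0<δ s r m s≤r r≤m (partition-≤ π) m-s≤δ) (riemannSum-error 0<δ π)))
    (eventually⇒≲ (always λ n → ℚ.≤-reflexive
      (solve 4 (λ k m s y → k :* (m :- s) :+ k :* (y :- m) := k :* (y :- s)) refl
        (K * δ) (seq (pt m) n) (seq (pt s) n) (seq (pt y) n))))

  isIntegral : ∀ s → IsIntegral f s y (F y -ᴿ F s)
  isIntegral s ε 0<ε =
    let δ , 0<δ , Kδ≤ε = divide 0<ε 0≤K
    in δ , 0<δ , λ π → within {ε} {riemannSum f π} {F y -ᴿ F s} (≲-trans (riemannSum-error 0<δ π)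
         (eventually⇒≲ (eventually-map (λ n y-s≤1 → ℚ.≤-trans
           (*-monoˡ (K * δ) (*-nonNeg 0≤K (ℚ.<⇒≤ 0<δ)) y-s≤1)
           (ℚ.≤-trans (ℚ.≤-reflexive (ℚ.*-identityʳ (K * δ))) Kδ≤ε)) (length≤1 s y))))

module _ (l : Letter) (w : Word) (ends : Ends (l ∷ w)) where
  private
    a  = coef (l ∷ w)
    A  = size (l ∷ w)
    0≤A = 0≤size (l ∷ w)
    a≤ : ∀ k → ∣ a k ∣ ≤ A
    a≤ = dominated⇒bounded 0≤A (coef-dominated (l ∷ w))
    F = antiderivative (l ∷ w)
    φ = λ t → density l t Real.* antiderivative w t

  primitive-lipschitz : ∀ {t} (r : Radius t) → let open Disc (Radius.0≤ρ r) (Radius.0<η r) (Radius.ρ+η≤1 r) in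
    ∀ p q → pt p Real.≤ pt t → pt q Real.≤ pt t →
    Eventually λ n → ∣ seq (F q) n - seq (F p) n ∣ ≤ Lip 0≤A * ∣ seq (pt q) n - seq (pt p) n ∣
  primitive-lipschitz r p q p≤t q≤t = eventually₂
    (λ n p≤ q≤ → eval-lipschitz 0≤A n a≤ (∣∣-below p≤) (∣∣-below q≤) ℚ.≤-refl)
    (below p p≤t) (below q q≤t)
    where
    open Radius r
    open Disc 0≤ρ 0<η ρ+η≤1

  uniformDerivative : ∀ y → UniformDerivative F φ y
  uniformDerivative y = record
    { K     = K
    ; 0≤K   = 0≤K
    ; close = λ s s≈y → ≲-trans
        (eventually⇒≲ (primitive-lipschitz (radius y) s y (≈⇒≤ {pt s} {pt y} s≈y) (≤ᴿ-refl (pt y))))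
        (≲-trans (≲-* (0≤Lip 0≤A) (≲-intro λ ε 0<ε → eventually-map
            (λ n p → ℚ.≤-trans (∣-∣-sym (seq (pt s) n) (seq (pt y) n) p) (ℚ.≤-reflexive (sym (ℚ.+-identityˡ ε)))) (s≈y ε 0<ε)))
          (eventually⇒≲ (always λ n → ℚ.≤-reflexive (ℚ.*-zeroʳ (Lip 0≤A)))))
    ; error = error
    }
    where
    open Radius (radius y)
    open Disc 0≤ρ 0<η ρ+η≤1
    -- The constant of `slope-lipschitz` at distance 2δ: the cell has length at most δ only up to an
    -- error, which the second δ absorbs.
    K = (Lip 0≤A + Lip 0≤A) * (1ℚ + 1ℚ) * η⁻¹
    0≤K = *-nonNeg (*-nonNeg (+-nonNeg (0≤Lip 0≤A) (0≤Lip 0≤A)) (+-nonNeg 0≤1 0≤1)) 0≤η⁻¹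

    error : ∀ {δ} → 0ℚ < δ → ∀ s r m → pt s Real.≤ pt r → pt r Real.≤ pt m → pt m Real.≤ pt y →
            pt m -ᴿ pt s Real.≤ fromℚ δ →
            (λ n → ∣ seq (φ r) n * (seq (pt m) n - seq (pt s) n) - (seq (F m) n - seq (F s) n) ∣)
              ≲ (λ n → K * δ * (seq (pt m) n - seq (pt s) n))
    error {δ} 0<δ s r m s≤r r≤m m≤y m-s≤δ = ≲-trans (eventually⇒≲ split)
      (≲-trans (≲-+ (null⇒≲ derivative-error) (≲-* 0≤Kδ ∣m-s∣≲))
        (eventually⇒≲ (always λ n → ℚ.≤-reflexive (ℚ.+-identityˡ _))))
      where
      0≤Kδ = *-nonNeg 0≤K (ℚ.<⇒≤ 0<δ)
      s≤m = ≤ᴿ-trans {pt s} {pt r} {pt m} s≤r r≤m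
      r≤y = ≤ᴿ-trans {pt r} {pt m} {pt y} r≤m m≤y
      s≤y = ≤ᴿ-trans {pt s} {pt m} {pt y} s≤m m≤y
      x = seq (pt s)
      z = seq (pt r)
      u = seq (pt m)
      slopeᵣ = λ n → slope n a (z n) (z n)

      ∣m-s∣≲ : (λ n → ∣ u n - x n ∣) ≲ (λ n → u n - x n)
      ∣m-s∣≲ = ∣∣≲ (eventually⇒≲ (always λ n → ℚ.≤-refl)) (≲-intro λ ε 0<ε → eventually-map
        (λ n p → ≤-slack ((u n + ε * ½ - x n) + (u n + ε * ½ - x n)) (+-nonNeg (slack p) (slack p))
          (solve 3 (λ u x e → u :- x :+ e := :- (u :- x) :+ ((u :+ e :* con ½ :- x) :+ (u :+ e :* con ½ :- x))) refl (u n) (x n) ε))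
        (s≤m (ε * ½) (half>0 0<ε)))

      derivative-error : Null (λ n → (u n - x n) * (seq (φ r) n - slopeᵣ n))
      derivative-error = null-*ˡ {y = λ n → u n - x n}
        (eventually₂ (λ n m≤ s≤ → ∣-∣ {u n} (∣∣-below m≤) (∣∣-below s≤)) (below m m≤y) (below s s≤y))
        (derivative-null l w ends r)

      near : Eventually λ n → ∣ x n - z n ∣ ≤ δ + δ × ∣ u n - z n ∣ ≤ δ + δ
      near = eventually₂
        {P = λ n → x n ≤ z n + δ * ½ × z n ≤ u n + δ * ½} {Q = λ n → u n - x n ≤ δ + δ * ½}
        (λ { n (p , q) d →
          let e₁ = slack p ; e₂ = slack q ; e₃ = slack d ; 0≤δ = ℚ.<⇒≤ 0<δ in
            ∣∣-intro
              (≤-slack ((z n + δ * ½ - x n) + (δ + δ * ½)) (+-nonNeg e₁ (+-nonNeg 0≤δ (ℚ.<⇒≤ (half>0 0<δ))))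
                (solve 3 (λ x z d → d :+ d := x :- z :+ ((z :+ d :* con ½ :- x) :+ (d :+ d :* con ½))) refl (x n) (z n) δ))
              (≤-slack ((u n + δ * ½ - z n) + (δ + δ * ½ - (u n - x n))) (+-nonNeg e₂ e₃)
                (solve 4 (λ x z u d → d :+ d := :- (x :- z) :+ ((u :+ d :* con ½ :- z) :+ (d :+ d :* con ½ :- (u :- x))))
                  refl (x n) (z n) (u n) δ))
          , ∣∣-intro
              (≤-slack ((z n + δ * ½ - x n) + (δ + δ * ½ - (u n - x n))) (+-nonNeg e₁ e₃)
                (solve 4 (λ x z u d → d :+ d := u :- z :+ ((z :+ d :* con ½ :- x) :+ (d :+ d :* con ½ :- (u :- x))))
                  refl (x n) (z n) (u n) δ))
              (≤-slack ((u n + δ * ½ - z n) + (δ + δ * ½)) (+-nonNeg e₂ (+-nonNeg 0≤δ (ℚ.<⇒≤ (half>0 0<δ))))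
                (solve 3 (λ u z d → d :+ d := :- (u :- z) :+ ((u :+ d :* con ½ :- z) :+ (d :+ d :* con ½))) refl (u n) (z n) δ)) })
        (both (s≤r (δ * ½) (half>0 0<δ)) (r≤m (δ * ½) (half>0 0<δ)))
        (m-s≤δ (δ * ½) (half>0 0<δ))

      -- The derivative at the tag is inserted between φ(r) and the difference quotient. The first
      -- difference is a null sequence, the second is small uniformly over all cells.
      split : Eventually λ n →
        ∣ seq (φ r) n * (u n - x n) - (seq (F m) n - seq (F s) n) ∣
          ≤ ∣ (u n - x n) * (seq (φ r) n - slopeᵣ n) ∣ + K * δ * ∣ u n - x n ∣
      split = eventually₂
        (λ { n (s≤ , r≤ , m≤) (x-z , u-z) → let open ℚ.≤-Reasoning ; c = seq (φ r) n ; σ = slope n a (x n) (u n) in begin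
          ∣ c * (u n - x n) - (eval n a (u n) - eval n a (x n)) ∣
            ≡⟨ cong (λ v → ∣ c * (u n - x n) - v ∣) (eval-slope n a (x n) (u n)) ⟩
          ∣ c * (u n - x n) - σ * (u n - x n) ∣
            ≡⟨ cong ∣_∣ (solve 4 (λ c d s t → c :* d :- s :* d := d :* (c :- t) :- (s :- t) :* d) refl
                 c (u n - x n) σ (slopeᵣ n)) ⟩
          ∣ (u n - x n) * (c - slopeᵣ n) - (σ - slopeᵣ n) * (u n - x n) ∣
            ≤⟨ ∣-∣ {(u n - x n) * (c - slopeᵣ n)} ℚ.≤-refl
                 (∣*∣ {σ - slopeᵣ n} (slope-lipschitz 0≤A n a≤ (∣∣-below s≤) (∣∣-below m≤) (∣∣-below r≤) x-z u-z) ℚ.≤-refl) ⟩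
          ∣ (u n - x n) * (c - slopeᵣ n) ∣ + (Lip 0≤A * (δ + δ) + Lip 0≤A * (δ + δ)) * η⁻¹ * ∣ u n - x n ∣
            ≡⟨ cong (∣ (u n - x n) * (c - slopeᵣ n) ∣ +_) (solve 4 (λ L d η⁻¹ v →
                 (L :* (d :+ d) :+ L :* (d :+ d)) :* η⁻¹ :* v := (L :+ L) :* (con 1ℚ :+ con 1ℚ) :* η⁻¹ :* d :* v) refl
                 (Lip 0≤A) δ η⁻¹ ∣ u n - x n ∣) ⟩
          ∣ (u n - x n) * (c - slopeᵣ n) ∣ + K * δ * ∣ u n - x n ∣ ∎ })
        (both (below s s≤y) (both (below r r≤y) (below m m≤y)))
        near

  eval-at-0 : ∀ n → eval n a 0ℚ ≡ 0ℚ
  eval-at-0 zero    = refl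
  eval-at-0 (suc n) = trans (ℚ.+-identityˡ _) (ℚ.*-zeroˡ (eval n (a ∘ suc) 0ℚ))

  primitive-at-0 : ∀ ε → 0ℚ < ε → ∃[ δ ] 0ℚ < δ ×
                   (∀ s → pt s Real.≤ fromℚ δ → (λ n → ∣ seq (F s) n ∣) ≲ (λ _ → ε))
  primitive-at-0 ε 0<ε =
    let δ , 0<δ , Lδ≤ε = divide 0<ε (0≤Lip 0≤A)
        0<¼ = *-pos {½} {½} (ℚ.positive⁻¹ ½) (ℚ.positive⁻¹ ½)
    -- A bound of ¼ on s plus an approximation error of ¼ keeps s in the disc of radius ½.
    in δ ℚ.⊓ (½ * ½) , ⊓-pos 0<δ 0<¼ , λ s s≤δ → ≲-trans
      (eventually⇒≲ (eventually₂ {P = λ n → seq (pt s) n ≤ δ ℚ.⊓ (½ * ½) + ½ * ½}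
        (λ n s≤ 0≤s → let q = seq (pt s) n in
          subst (λ v → ∣ v ∣ ≤ Lip 0≤A * q)
            (trans (cong (λ v → eval n a q - v) (eval-at-0 n)) (ℚ.+-identityʳ (eval n a q)))
            (eval-lipschitz 0≤A n {p = 0ℚ} {q} a≤ (ℚ.<⇒≤ (ℚ.positive⁻¹ ½))
              (∣∣-nonNeg 0≤s (ℚ.≤-trans s≤ (ℚ.+-monoˡ-≤ (½ * ½) (ℚ.p⊓q≤q δ (½ * ½)))))
              (ℚ.≤-reflexive (trans (cong ∣_∣ (ℚ.+-identityʳ q)) (ℚ.0≤p⇒∣p∣≡p 0≤s)))))
        (s≤δ (½ * ½) 0<¼) (eventually-pos s)))
      (≲-trans (≲-* (0≤Lip 0≤A) (≲-intro s≤δ))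
        (eventually⇒≲ (always λ n → ℚ.≤-trans (*-monoˡ (Lip 0≤A) (0≤Lip 0≤A) (ℚ.p⊓q≤p δ (½ * ½))) Lδ≤ε)))
    where
    open Disc {½} {½} (ℚ.nonNegative⁻¹ ½) (ℚ.positive⁻¹ ½) ℚ.≤-refl

  -- F vanishes at 0 whatever the upper limit b, so only the behaviour at b remains to be supplied:
  -- Lipschitz continuity at an interior point, Abel's theorem at 1.
  isImproperIntegral : ∀ {b v} →
    (∀ ε → 0ℚ < ε → ∃[ δ ] 0ℚ < δ × (∀ y → pt y Real.< b → b -ᴿ pt y Real.≤ fromℚ δ →
      (λ n → ∣ seq (F y) n - seq v n ∣) ≲ (λ _ → ε))) →
    IsImproperIntegral φ b v
  isImproperIntegral {b} {v} lim ε 0<ε =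
    let δ₀ , 0<δ₀ , at-0 = primitive-at-0 (ε * ½) (half>0 0<ε)
        δ₁ , 0<δ₁ , at-b = lim (ε * ½) (half>0 0<ε)
        δ = δ₀ ℚ.⊓ δ₁
    in δ , ⊓-pos 0<δ₀ 0<δ₁ , λ s y s≤y y<b s≤δ b-y≤δ →
      F y -ᴿ F s , UniformDerivative.isIntegral (uniformDerivative y) s ,
      within {ε} {F y -ᴿ F s} {v} (≲-trans
        (≲-trans
          (eventually⇒≲ (always λ n → ℚ.≤-trans
            (ℚ.≤-reflexive (cong ∣_∣ (solve 3 (λ y s v → y :- s :- v := (y :- v) :- s) refl (seq (F y) n) (seq (F s) n) (seq v n))))
            (ℚ.∣p-q∣≤∣p∣+∣q∣ (seq (F y) n - seq v n) (seq (F s) n))))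
          (≲-+ (at-b y y<b (≤ᴿ-trans {b -ᴿ pt y} {fromℚ δ} {fromℚ δ₁} b-y≤δ (const-≤ (ℚ.p⊓q≤q δ₀ δ₁))))
               (at-0 s (≤ᴿ-trans {pt s} {fromℚ δ} {fromℚ δ₀} s≤δ (const-≤ (ℚ.p⊓q≤p δ₀ δ₁))))))
        (eventually⇒≲ (always λ n → ℚ.≤-reflexive (half+half ε))))
    where
    const-≤ : ∀ {p q} → p ≤ q → fromℚ p Real.≤ fromℚ q
    const-≤ {p} {q} p≤q = at (eventually⇒≲ {λ _ → p} {λ _ → q} (always λ _ → p≤q))

  isImproperIntegral-𝕀 : ∀ t → IsImproperIntegral φ (pt t) (F t)
  isImproperIntegral-𝕀 t = isImproperIntegral {pt t} {F t} λ ε 0<ε →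
    let δ , 0<δ , Lδ≤ε = divide 0<ε (0≤Lip 0≤A)
    in δ , 0<δ , λ y y<t t-y≤δ →
      let y≤t = <⇒≤ᴿ {pt y} {pt t} y<t in
      ≲-trans (eventually⇒≲ (primitive-lipschitz (radius t) t y (≤ᴿ-refl (pt t)) y≤t))
        (≲-trans (≲-* (0≤Lip 0≤A) (∣∣≲
            (≲-intro λ η 0<η → eventually-map (λ n p → ≤-slack (seq (pt t) n + η - seq (pt y) n + δ) (+-nonNeg (slack p) (ℚ.<⇒≤ 0<δ))
              (solve 4 (λ t y e d → d :+ e := y :- t :+ (t :+ e :- y :+ d)) refl (seq (pt t) n) (seq (pt y) n) η δ)) (y≤t η 0<η))
            (≲-intro λ η 0<η → eventually-map (λ n → subst (_≤ δ + η)
              (solve 2 (λ t y → t :- y := :- (y :- t)) refl (seq (pt t) n) (seq (pt y) n))) (t-y≤δ η 0<η))))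
          (eventually⇒≲ (always λ n → Lδ≤ε)))
    where
    open Radius (radius t)
    open Disc 0≤ρ 0<η ρ+η≤1

  isImproperIntegral-1 : ∀ (reg : Regular a) → IsImproperIntegral φ 1ℝ (value reg)
  isImproperIntegral-1 reg = isImproperIntegral {1ℝ} {value reg} λ ε 0<ε →
    let δ , 0<δ , lim = abel reg ε 0<ε
    -- The other half of δ absorbs the approximation error in 1 - y ≤ δ/2.
    in δ * ½ , half>0 0<δ , λ y y<1 1-y≤ → eventually⇒≲
      (eventually₂ (λ { n lim (0≤y , y≤1 , 1-y≤) → lim (seq (pt y) n) (∣∣-nonNeg 0≤y y≤1)
          (∣∣-intro
            (≤-slack ((1ℚ - seq (pt y) n) + δ) (+-nonNeg (slack y≤1) (ℚ.<⇒≤ 0<δ))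
              (solve 2 (λ y d → d := y :- con 1ℚ :+ ((con 1ℚ :- y) :+ d)) refl (seq (pt y) n) δ))
            (ℚ.≤-trans (ℚ.≤-reflexive (solve 1 (λ y → :- (y :- con 1ℚ) := con 1ℚ :- y) refl (seq (pt y) n)))
              (ℚ.≤-trans 1-y≤ (ℚ.≤-reflexive (half+half δ))))) })
        lim (both (eventually-pos y)
          (both {λ n → seq (pt y) n ≤ 1ℚ}
            (eventually-map (λ n → ℚ.≤-trans (≤-slack {seq (pt y) n} (proj₁ (pt<1 y)) (ℚ.<⇒≤ (proj₁ (proj₂ (pt<1 y)))) refl))
              (proj₂ (proj₂ (pt<1 y))))
            (1-y≤ (δ * ½) (half>0 0<δ)))))

-- Iterated integrals of words

isIteratedIntegral-𝕀 : ∀ w → Ends w → ∀ t → IsIteratedIntegral w (pt t) (antiderivative w t)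
-- The truncation to zero terms is 0 rather than 1, hence the threshold 1.
isIteratedIntegral-𝕀 []      ends t ε 0<ε = 1 , λ { (suc n) _ → ℚ.≤-trans (ℚ.≤-reflexive (cong ∣_∣
  (trans (cong (λ x → 1ℚ + seq (pt t) (suc n) * x - 1ℚ) (eval-0 n (seq (pt t) (suc n))))
    (solve 1 (λ q → con 1ℚ :+ q :* con 0ℚ :- con 1ℚ := con 0ℚ) refl (seq (pt t) (suc n)))))) (ℚ.<⇒≤ 0<ε) }
isIteratedIntegral-𝕀 (l ∷ w) ends t =
  antiderivative w , isIteratedIntegral-𝕀 w (ends-tail l w ends) , isImproperIntegral-𝕀 l w ends t

Mʷ : ∀ w → Admissible w → ℝ
Mʷ w adm = value (regular-coef w adm)

Mʷ-isIteratedIntegral : ∀ w adm → IsIteratedIntegral w 1ℝ (Mʷ w adm)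
Mʷ-isIteratedIntegral []      adm ε 0<ε = 1 , λ { (suc n) _ → ℚ.≤-trans (ℚ.≤-reflexive (cong ∣_∣
  (cong (λ x → 1ℚ + 1ℚ * x - 1ℚ) (eval-0 n 1ℚ)))) (ℚ.<⇒≤ 0<ε) }
Mʷ-isIteratedIntegral (l ∷ w) adm@(starts , ends) =
  antiderivative w , isIteratedIntegral-𝕀 w (ends-tail l w ends) ,
  isImproperIntegral-1 l w ends (regular-coef (l ∷ w) adm)

-- The algebra homomorphism

linear : (Word → ℚ) → 𝔄 → ℚ
linear j []            = 0ℚ
linear j ((c , w) ∷ p) = c * j w + linear j p

remove : Word → 𝔄 → 𝔄
remove w []            = []
remove w ((c , u) ∷ p) with ≡-dec _≟ᴸ_ u w
... | yes _ = remove w p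
... | no  _ = (c , u) ∷ remove w p

linear-remove : ∀ j w p → linear j p ≡ coeff p w * j w + linear j (remove w p)
linear-remove j w []            = solve 1 (λ x → con 0ℚ := con 0ℚ :* x :+ con 0ℚ) refl (j w)
linear-remove j w ((c , u) ∷ p) with ≡-dec _≟ᴸ_ u w
... | yes refl = trans (cong (c * j w +_) (linear-remove j w p))
  (solve 4 (λ c d x r → c :* x :+ (d :* x :+ r) := (c :+ d) :* x :+ r) refl c (coeff p w) (j w) (linear j (remove w p)))
... | no _ = trans (cong (c * j u +_) (linear-remove j w p))
  (solve 3 (λ x y r → x :+ (y :+ r) := y :+ (x :+ r)) refl (c * j u) (coeff p w * j w) (linear j (remove w p)))

coeff-remove-≡ : ∀ w p → coeff (remove w p) w ≡ 0ℚ
coeff-remove-≡ w []            = refl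
coeff-remove-≡ w ((c , u) ∷ p) with ≡-dec _≟ᴸ_ u w
... | yes _  = coeff-remove-≡ w p
... | no u≢w with ≡-dec _≟ᴸ_ u w
...   | yes u≡w = contradiction u≡w u≢w
...   | no  _   = coeff-remove-≡ w p

coeff-remove-≢ : ∀ w {v} p → v ≢ w → coeff (remove w p) v ≡ coeff p v
coeff-remove-≢ w {v} []            v≢w = refl
coeff-remove-≢ w {v} ((c , u) ∷ p) v≢w with ≡-dec _≟ᴸ_ u w
coeff-remove-≢ w {v} ((c , u) ∷ p) v≢w | yes refl with ≡-dec _≟ᴸ_ u v
... | yes u≡v = contradiction (sym u≡v) v≢w
... | no  _   = coeff-remove-≢ w p v≢w
coeff-remove-≢ w {v} ((c , u) ∷ p) v≢w | no _ with ≡-dec _≟ᴸ_ u v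
... | yes _ = cong (c +_) (coeff-remove-≢ w p v≢w)
... | no  _ = coeff-remove-≢ w p v≢w

remove-cong : ∀ w {p q} → p ≋ q → remove w p ≋ remove w q
remove-cong w {p} {q} p≋q v with ≡-dec _≟ᴸ_ v w
... | yes refl = trans (coeff-remove-≡ w p) (sym (coeff-remove-≡ w q))
... | no v≢w   = trans (coeff-remove-≢ w p v≢w) (trans (p≋q v) (sym (coeff-remove-≢ w q v≢w)))

Supported : List Word → 𝔄 → Set
Supported ws = All (λ t → proj₂ t ∈ ws)

remove-supported : ∀ {w ws} p → Supported (w ∷ ws) p → Supported ws (remove w p)
remove-supported         []            []       = []
remove-supported {w}     ((c , u) ∷ p) (i ∷ is) with ≡-dec _≟ᴸ_ u w
... | yes _ = remove-supported p is
remove-supported ((c , u) ∷ p) (here u≡w ∷ is) | no u≢w = contradiction u≡w u≢w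
remove-supported ((c , u) ∷ p) (there i ∷ is)  | no _   = i ∷ remove-supported p is

-- A formal sum may list a word several times, while ≋ sees only total coefficients. Induction over
-- a list containing all words of both sums gathers the contribution of one word at a time.
linear-cong-supported : ∀ j ws {p q} → Supported ws p → Supported ws q → p ≋ q → linear j p ≡ linear j q
linear-cong-supported j []       {[]}    {[]}    _        _        p≋q = refl
linear-cong-supported j []       {_ ∷ _} {_}     (() ∷ _) _        p≋q
linear-cong-supported j []       {[]}    {_ ∷ _} _        (() ∷ _) p≋q
linear-cong-supported j (w ∷ ws) {p}     {q}     sp       sq       p≋q = begin
  linear j p                                 ≡⟨ linear-remove j w p ⟩
  coeff p w * j w + linear j (remove w p)    ≡⟨ cong₂ (λ c x → c * j w + x) (p≋q w)
                                                  (linear-cong-supported j ws (remove-supported p sp)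
                                                    (remove-supported q sq) (remove-cong w {p} {q} p≋q)) ⟩
  coeff q w * j w + linear j (remove w q)    ≡⟨ linear-remove j w q ⟨
  linear j q                                 ∎
  where open ≡-Reasoning

linear-cong : ∀ j {p q} → p ≋ q → linear j p ≡ linear j q
linear-cong j {p} {q} = linear-cong-supported j (map proj₂ p ++ map proj₂ q) {p} {q}
  (All.tabulate (λ t∈p → ∈-++⁺ˡ (∈-map⁺ proj₂ t∈p)))
  (All.tabulate (λ t∈q → ∈-++⁺ʳ (map proj₂ p) (∈-map⁺ proj₂ t∈q)))

linear-++ : ∀ j p q → linear j (p ++ q) ≡ linear j p + linear j q
linear-++ j []            q = sym (ℚ.+-identityˡ _)
linear-++ j ((c , w) ∷ p) q = trans (cong (c * j w +_) (linear-++ j p q)) (sym (ℚ.+-assoc (c * j w) _ _))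

linear-· : ∀ j c p → linear j (c · p) ≡ c * linear j p
linear-· j c []            = sym (ℚ.*-zeroʳ c)
linear-· j c ((d , w) ∷ p) = trans (cong (c * d * j w +_) (linear-· j c p))
  (solve 4 (λ c d x r → c :* d :* x :+ c :* r := c :* (d :* x :+ r)) refl c d (j w) (linear j p))

series : 𝔄 → Series
series p k = linear (λ w → coef w k) p

series-words : ∀ c ws k → series (map (c ,_) ws) k ≡ c * coefs ws k
series-words c []       k = sym (ℚ.*-zeroʳ c)
series-words c (w ∷ ws) k = trans (cong (c * coef w k +_) (series-words c ws k)) (sym (ℚ.*-distribˡ-+ c _ _))

EndsAll : 𝔄 → Set
EndsAll = All (λ t → Ends (proj₂ t))

series-⧢-word : ∀ c u q → Ends u → EndsAll q → ∀ k →
  series (concatMap (λ (d , v) → map (c * d ,_) (u ⧢ʷ v)) q) k ≡ c * conv (coef u) (series q) k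
series-⧢-word c u []            eu []         k = sym (trans (cong (c *_) (conv-0ʳ (coef u) k)) (ℚ.*-zeroʳ c))
series-⧢-word c u ((d , v) ∷ q) eu (ev ∷ evs) k = begin
  series (map (c * d ,_) (u ⧢ʷ v) ++ rest) k
    ≡⟨ linear-++ (λ w → coef w k) (map (c * d ,_) (u ⧢ʷ v)) rest ⟩
  series (map (c * d ,_) (u ⧢ʷ v)) k + series rest k
    ≡⟨ cong₂ _+_ (trans (series-words (c * d) (u ⧢ʷ v) k) (cong (c * d *_) (sym (conv-coef u v eu ev k))))
                 (series-⧢-word c u q eu evs k) ⟩
  c * d * conv (coef u) (coef v) k + c * conv (coef u) (series q) k
    ≡⟨ solve 4 (λ c d x y → c :* d :* x :+ c :* y := c :* (d :* x :+ y)) refl c d _ _ ⟩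
  c * (d * conv (coef u) (coef v) k + conv (coef u) (series q) k)
    ≡⟨ cong (λ x → c * (x + conv (coef u) (series q) k)) (conv-*ʳ d (coef u) (coef v) k) ⟨
  c * (conv (coef u) (λ k → d * coef v k) k + conv (coef u) (series q) k)
    ≡⟨ cong (c *_) (conv-+ʳ (coef u) (λ k → d * coef v k) (series q) k) ⟨
  c * conv (coef u) (series ((d , v) ∷ q)) k ∎
  where
  open ≡-Reasoning
  rest = concatMap (λ (d , v) → map (c * d ,_) (u ⧢ʷ v)) q

series-⧢ : ∀ p q → EndsAll p → EndsAll q → ∀ k → series (p ⧢ q) k ≡ conv (series p) (series q) k
series-⧢ []            q []         evs k = sym (conv-0ˡ (series q) k)
series-⧢ ((c , u) ∷ p) q (eu ∷ eus) evs k = begin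
  series (concatMap (λ (d , v) → map (c * d ,_) (u ⧢ʷ v)) q ++ p ⧢ q) k
    ≡⟨ linear-++ (λ w → coef w k) (concatMap (λ (d , v) → map (c * d ,_) (u ⧢ʷ v)) q) (p ⧢ q) ⟩
  series (concatMap (λ (d , v) → map (c * d ,_) (u ⧢ʷ v)) q) k + series (p ⧢ q) k
    ≡⟨ cong₂ _+_ (trans (series-⧢-word c u q eu evs k) (sym (conv-*ˡ c (coef u) (series q) k))) (series-⧢ p q eus evs k) ⟩
  conv (λ k → c * coef u k) (series q) k + conv (series p) (series q) k
    ≡⟨ conv-+ˡ (λ k → c * coef u k) (series p) (series q) k ⟨
  conv (series ((c , u) ∷ p)) (series q) k ∎
  where open ≡-Reasoning

-- Values of formal sums at t = 1

AllAdmissible : 𝔄 → Set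
AllAdmissible = All (λ t → Admissible (proj₂ t))

regular-series : ∀ p → AllAdmissible p → Regular (series p)
regular-series []            []       = regular-0
regular-series ((c , w) ∷ p) (a ∷ as) = regular-+ (regular-* c (regular-coef w a)) (regular-series p as)

-- The equality holds index by index, so the additive and scalar laws are exact identities of
-- partial sums; only the product needs a limit.
linearExtension-seq : ∀ p n → seq (linearExtension Mʷ p) n ≡ eval n (series (poly p)) 1ℚ
linearExtension-seq ([]          , [])     n = sym (eval-0 n 1ℚ)
linearExtension-seq ((c , w) ∷ p , a ∷ as) n = trans
  (cong₂ _+_ (sym (eval-* n c (coef w) 1ℚ)) (linearExtension-seq (p , as) n))
  (sym (eval-+ n (λ k → c * coef w k) (series p) 1ℚ))

-- Convergence at 1 may be conditional, so the Cauchy product is compared at q = 1 - δ, where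
-- `eval-conv` applies, and `abel` moves a, b and their product from q to 1. Regularity of the
-- product is an assumption here; it comes from the shuffle.
value-conv : ∀ {a b} → Regular a → Regular b → Regular (conv a b) →
             Null (λ n → eval n a 1ℚ * eval n b 1ℚ - eval n (conv a b) 1ℚ)
value-conv {a} {b} ra rb rc ε 0<ε =
  let A , 0<A , A-bound = bound {λ n → eval n a 1ℚ} (value-cauchy ra)
      B , 0<B , B-bound = bound {λ n → eval n b 1ℚ} (value-cauchy rb)
      -- Moving both factors costs Aη + (B+1)η ≤ ε/2; the Cauchy product at q and Abel's theorem for
      -- the product cost ε/4 each. Capping η at 1 gives the bound B + 1 on the second factor at q.
      η , 0<η , small = divide (half>0 0<ε) (+-nonNeg (ℚ.<⇒≤ 0<A) (+-nonNeg (ℚ.<⇒≤ 0<B) 0≤1))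
      0<η₁ = ⊓-pos 0<η 0<1
      δ₁ , 0<δ₁ , lim₁ = abel ra (η ℚ.⊓ 1ℚ) 0<η₁
      δ₂ , 0<δ₂ , lim₂ = abel rb (η ℚ.⊓ 1ℚ) 0<η₁
      δ₃ , 0<δ₃ , lim₃ = abel rc (ε * ½ * ½) (half>0 (half>0 0<ε))
      δ≤₁₂ = ℚ.p⊓q≤p (δ₁ ℚ.⊓ δ₂) (δ₃ ℚ.⊓ 1ℚ)
      δ≤₃₁ = ℚ.p⊓q≤q (δ₁ ℚ.⊓ δ₂) (δ₃ ℚ.⊓ 1ℚ)
  in close (⊓-pos (⊓-pos 0<δ₁ 0<δ₂) (⊓-pos 0<δ₃ 0<1)) (ℚ.≤-trans δ≤₃₁ (ℚ.p⊓q≤q δ₃ 1ℚ))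
       (ℚ.≤-trans δ≤₁₂ (ℚ.p⊓q≤p δ₁ δ₂)) (ℚ.≤-trans δ≤₁₂ (ℚ.p⊓q≤q δ₁ δ₂)) (ℚ.≤-trans δ≤₃₁ (ℚ.p⊓q≤p δ₃ 1ℚ))
       (ℚ.p⊓q≤q η 1ℚ) (ℚ.<⇒≤ 0<A) (ℚ.<⇒≤ 0<B)
       (ℚ.≤-trans (*-monoˡ (A + (B + 1ℚ)) (+-nonNeg (ℚ.<⇒≤ 0<A) (+-nonNeg (ℚ.<⇒≤ 0<B) 0≤1)) (ℚ.p⊓q≤p η 1ℚ)) small)
       A-bound B-bound lim₁ lim₂ lim₃
  where
  Near : ℚ → Series → ℚ → ℕ → Set
  Near δ a ε n = ∀ q → ∣ q ∣ ≤ 1ℚ → ∣ q - 1ℚ ∣ ≤ δ → ∣ eval n a q - eval n a 1ℚ ∣ ≤ ε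

  close : ∀ {A B η δ δ₁ δ₂ δ₃} → 0ℚ < δ → δ ≤ 1ℚ → δ ≤ δ₁ → δ ≤ δ₂ → δ ≤ δ₃ → η ≤ 1ℚ → 0ℚ ≤ A → 0ℚ ≤ B →
          (A + (B + 1ℚ)) * η ≤ ε * ½ →
          (Eventually λ n → ∣ eval n a 1ℚ ∣ ≤ A) → (Eventually λ n → ∣ eval n b 1ℚ ∣ ≤ B) →
          Eventually (Near δ₁ a η) → Eventually (Near δ₂ b η) → Eventually (Near δ₃ (conv a b) (ε * ½ * ½)) →
          Eventually λ n → ∣ eval n a 1ℚ * eval n b 1ℚ - eval n (conv a b) 1ℚ ∣ ≤ ε
  close {A} {B} {η} {δ} 0<δ δ≤1 δ≤δ₁ δ≤δ₂ δ≤δ₃ η≤1 0≤A 0≤B small A-bound B-bound lim₁ lim₂ lim₃ = eventually₂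
    (λ { n ((x≤A , y≤B) , conv≤) ((l₁ , l₂) , l₃) →
      let x    = eval n a 1ℚ
          y    = eval n b 1ℚ
          x′   = eval n a q
          y′   = eval n b q
          y′-y = l₂ q ∣q∣≤1 (ℚ.≤-trans q-1 δ≤δ₂)
          y′≤ : ∣ y′ ∣ ≤ B + 1ℚ
          y′≤  = subst (λ v → ∣ v ∣ ≤ B + 1ℚ) (solve 2 (λ y z → y :+ (z :- y) := z) refl y y′)
                   (∣+∣ {y} y≤B (ℚ.≤-trans y′-y η≤1))
      in ℚ.≤-trans
        (∣-∣-trans (x * y) (x′ * y′) (eval n (conv a b) 1ℚ)
          (*-estimate {x = x} {x′} {y} {y′} 0≤A (+-nonNeg 0≤B 0≤1) x≤A y′≤ (∣-∣-sym y′ y y′-y)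
            (∣-∣-sym x′ x (l₁ q ∣q∣≤1 (ℚ.≤-trans q-1 δ≤δ₁))))
          (∣-∣-trans (x′ * y′) (eval n (conv a b) q) (eval n (conv a b) 1ℚ) conv≤
            (l₃ q ∣q∣≤1 (ℚ.≤-trans q-1 δ≤δ₃))))
        (ℚ.≤-trans
          (ℚ.+-mono-≤
            (ℚ.≤-trans (ℚ.≤-reflexive (sym (ℚ.*-distribʳ-+ η A (B + 1ℚ)))) small)
            (ℚ.≤-reflexive (half+half (ε * ½))))
          (ℚ.≤-reflexive (half+half ε))) })
    (both (both A-bound B-bound) conv-close) (both (both lim₁ lim₂) lim₃)
    where
    -- This point is fixed while n grows; δ was capped at 1 to keep it nonnegative.
    q = 1ℚ - δ
    0≤q : 0ℚ ≤ q
    0≤q = slack δ≤1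
    ∣q∣≤1 : ∣ q ∣ ≤ 1ℚ
    ∣q∣≤1 = ∣∣-nonNeg 0≤q (≤-slack {q} δ (ℚ.<⇒≤ 0<δ) (solve 1 (λ d → con 1ℚ := con 1ℚ :- d :+ d) refl δ))
    q-1 : ∣ q - 1ℚ ∣ ≤ δ
    q-1 = ℚ.≤-reflexive (trans (cong ∣_∣ (solve 1 (λ d → con 1ℚ :- d :- con 1ℚ := :- d) refl δ))
            (trans (ℚ.∣-p∣≡∣p∣ δ) (ℚ.0≤p⇒∣p∣≡p (ℚ.<⇒≤ 0<δ))))
    q+δ≤1 : q + δ ≤ 1ℚ
    q+δ≤1 = ℚ.≤-reflexive (solve 1 (λ d → con 1ℚ :- d :+ d := con 1ℚ) refl δ)

    conv-close : Eventually λ n → ∣ eval n a q * eval n b q - eval n (conv a b) q ∣ ≤ ε * ½ * ½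
    conv-close =
      let open Disc 0≤q 0<δ q+δ≤1
          0≤C = *-nonNeg (0≤A/η (Regular.0≤A ra)) (Regular.0≤A rb)
          θ , 0<θ , Cθ≤ = divide (half>0 (half>0 0<ε)) 0≤C
      in eventually-map (λ n small → ℚ.≤-trans
           (eval-conv (Regular.0≤A ra) n (dominated⇒bounded (Regular.0≤A ra) (Regular.a≤ ra)) (dominated⇒bounded (Regular.0≤A rb) (Regular.a≤ rb))
             (∣∣-nonNeg 0≤q ℚ.≤-refl))
           (ℚ.≤-trans (*-monoˡ (Regular.A ra * η⁻¹ * Regular.A rb) 0≤C (ℚ.≤-trans (x≤∣x∣ (ι n * q ^ n)) small)) Cθ≤))
         (ι*^-null 0≤q 0<δ q+δ≤1 θ 0<θ)

≡⇒≈ : ∀ {x y} → (∀ n → seq x n ≡ seq y n) → x Real.≈ y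
≡⇒≈ {x} {y} eq ε 0<ε = always λ n → ℚ.≤-trans
  (ℚ.≤-reflexive (cong ∣_∣ (trans (cong (_- seq y n) (eq n)) (ℚ.+-inverseʳ (seq y n))))) (ℚ.<⇒≤ 0<ε)

M : 𝔄⁰ → ℝ
M = linearExtension Mʷ

M-cong : ∀ {p q} → poly p ≋ poly q → M p Real.≈ M q
M-cong {p} {q} p≋q = ≡⇒≈ {M p} {M q} λ n → trans (linearExtension-seq p n)
  (trans (eval-cong n 1ℚ λ k → linear-cong (λ w → coef w k) {poly p} {poly q} p≋q) (sym (linearExtension-seq q n)))

M-+ : ∀ p q → M (RawRing._+_ 𝔄⁰-rawRing p q) Real.≈ M p +ᴿ M q
M-+ p q = ≡⇒≈ {M (RawRing._+_ 𝔄⁰-rawRing p q)} {M p +ᴿ M q} λ n → begin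
  seq (M (RawRing._+_ 𝔄⁰-rawRing p q)) n
    ≡⟨ linearExtension-seq (RawRing._+_ 𝔄⁰-rawRing p q) n ⟩
  eval n (series (poly p ++ poly q)) 1ℚ
    ≡⟨ eval-cong n 1ℚ (λ k → linear-++ (λ w → coef w k) (poly p) (poly q)) ⟩
  eval n (λ k → series (poly p) k + series (poly q) k) 1ℚ
    ≡⟨ eval-+ n (series (poly p)) (series (poly q)) 1ℚ ⟩
  eval n (series (poly p)) 1ℚ + eval n (series (poly q)) 1ℚ
    ≡⟨ cong₂ _+_ (linearExtension-seq p n) (linearExtension-seq q n) ⟨
  seq (M p) n + seq (M q) n ∎
  where open ≡-Reasoning

M-*ˢ-seq : ∀ c p n → seq (M (c *ˢ p)) n ≡ c * seq (M p) n
M-*ˢ-seq c p n = begin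
  seq (M (c *ˢ p)) n
    ≡⟨ linearExtension-seq (c *ˢ p) n ⟩
  eval n (series (c · poly p)) 1ℚ
    ≡⟨ eval-cong n 1ℚ (λ k → linear-· (λ w → coef w k) c (poly p)) ⟩
  eval n (λ k → c * series (poly p) k) 1ℚ
    ≡⟨ eval-* n c (series (poly p)) 1ℚ ⟩
  c * eval n (series (poly p)) 1ℚ
    ≡⟨ cong (c *_) (linearExtension-seq p n) ⟨
  c * seq (M p) n ∎
  where open ≡-Reasoning

M-*ˢ : ∀ c p → M (c *ˢ p) Real.≈ fromℚ c Real.* M p
M-*ˢ c p = ≡⇒≈ {M (c *ˢ p)} {fromℚ c Real.* M p} (M-*ˢ-seq c p)

M-neg : ∀ p → M ((- 1ℚ) *ˢ p) Real.≈ neg (M p)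
M-neg p = ≡⇒≈ {M ((- 1ℚ) *ˢ p)} {neg (M p)} λ n → trans (M-*ˢ-seq (- 1ℚ) p n)
  (solve 1 (λ x → (:- con 1ℚ) :* x := :- x) refl (seq (M p) n))

M-1 : M (RawRing.1# 𝔄⁰-rawRing) Real.≈ 1ℝ
M-1 ε 0<ε = 1 , λ { (suc n) _ → ℚ.≤-trans (ℚ.≤-reflexive (cong ∣_∣
  (cong (λ x → 1ℚ * (1ℚ + 1ℚ * x) + 0ℚ - 1ℚ) (eval-0 n 1ℚ)))) (ℚ.<⇒≤ 0<ε) }

-- The Cauchy product is regular because it coincides with the series of p ⧢ q, again a sum of
-- admissible words; no estimate on convolutions is required.
M-⧢ : ∀ p q → M (RawRing._*_ 𝔄⁰-rawRing p q) Real.≈ M p Real.* M q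
M-⧢ p q ε 0<ε = eventually-map {Q = λ n → ∣ seq (M pq) n - seq (M p) n * seq (M q) n ∣ ≤ ε}
  (λ n le → subst (λ d → ∣ d ∣ ≤ ε) (sym (cong₂ _-_ (product-seq n) (cong₂ _*_ (linearExtension-seq p n) (linearExtension-seq q n))))
    (∣-∣-sym (eval n a 1ℚ * eval n b 1ℚ) (eval n (conv a b) 1ℚ) le))
  (value-conv regular-p regular-q (regular-cong shuffle regular-pq) ε 0<ε)
  where
  pq : 𝔄⁰
  pq = RawRing._*_ 𝔄⁰-rawRing p q
  a b : Series
  a = series (poly p)
  b = series (poly q)
  regular-p : Regular a
  regular-p = regular-series (poly p) (admissible p)
  regular-q : Regular b
  regular-q = regular-series (poly q) (admissible q)
  regular-pq : Regular (series (poly p ⧢ poly q))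
  regular-pq = regular-series (poly p ⧢ poly q) (⧢-admissible (admissible p) (admissible q))
  shuffle : ∀ k → series (poly p ⧢ poly q) k ≡ conv a b k
  shuffle = series-⧢ (poly p) (poly q) (All.map proj₂ (admissible p)) (All.map proj₂ (admissible q))
  product-seq : ∀ n → seq (M pq) n ≡ eval n (conv a b) 1ℚ
  product-seq n = trans (linearExtension-seq pq n) (eval-cong n 1ℚ shuffle)

proposition2p2 : Σ[ I ∈ (∀ w → Admissible w → ℝ) ]
    (∀ w (a : Admissible w) → IsIteratedIntegral w 1ℝ (I w a)) ×
    IsℚAlgebraHomomorphism (linearExtension I)
proposition2p2 = Mʷ , Mʷ-isIteratedIntegral , record
    { isSemiringHomomorphism = record
      { isNearSemiringHomomorphism = record
        { +-isMonoidHomomorphism = +-isMonoidHomomorphism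
        ; *-homo                 = M-⧢
        }
      ; 1#-homo = M-1
      }
    ; -‿homo = M-neg
    } , record
    { +ᴹ-isGroupHomomorphism = record
      { isMonoidHomomorphism = +-isMonoidHomomorphism
      ; ⁻¹-homo              = M-neg
      }
    ; *ₗ-homo = M-*ˢ
    }
  where
  +-isMonoidHomomorphism : MonoidMorphisms.IsMonoidHomomorphism
    (RawRing.+-rawMonoid 𝔄⁰-rawRing) (RawRing.+-rawMonoid ℝ-rawRing) M
  +-isMonoidHomomorphism = record
    { isMagmaHomomorphism = record
      { isRelHomomorphism = record { cong = λ {p} {q} → M-cong {p} {q} }
      ; homo              = M-+
      }
    ; ε-homo = ≡⇒≈ {0ℝ} {0ℝ} λ _ → refl
    }
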